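{- Let $\mathbf{k}=(k_1,\ldots,k_n)$ be a tuple of positive integers of length $\ell\ge1$ and weight $(a_1,\ldots,a_\ell;t_1,\ldots,t_\ell;0)$. Then for every positive integer $m$, $$B_{\mathbf{k}}(m)=S_{\mathbf{k}}(\ell+m,m),\qquad b_{\mathbf{k}}(m)=s_{\mathbf{k}}(m,m-\ell).$$ Moreover, $$S_{\mathbf{k}}(\ell+m,m)=\sum_{1\le i_1\le\cdots\le i_\ell\le m} i_1^{a_1}\cdots i_\ell^{a_\ell}\binom{t_1+i_2-i_1-2}{i_2-i_1}\cdots\binom{t_{\ell-1}+i_\ell-i_{\ell-1}-2}{i_\ell-i_{\ell-1}}\binom{t_\ell+m-i_\ell-2}{m-i_\ell},$$ $$s_{\mathbf{k}}(m,m-\ell)=\sum_{1\le i_1<\cdots<i_\ell< m} i_1^{a_1}\cdots i_\ell^{a_\ell}\binom{i_2-i_1-1}{t_1-2}\cdots\binom{i_\ell-i_{\ell-1}-1}{t_{\ell-1}-2}\binom{m-i_\ell-1}{t_\ell-2}.$$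
   Context: Stirling polynomials: for $\mathbf{k}=(k_1,\ldots,k_n)$, $K=\sum k_i$, a Stirling permutation of $\{1^{k_1},\ldots,n^{k_n}\}$ is a word $\sigma(1)\cdots\sigma(K)$ with each $i$ appearing $k_i$ times such that $\sigma(i)=\sigma(j)$, $i<s<j$ imply $\sigma(s)\ge\sigma(i)$; index $i$ is a descent if $i<K$ and $\sigma(i)>\sigma(i+1)$, or $i=K$; $A_{\mathbf{k},i}$ counts those with exactly $i$ descents; $\sum_{m\ge0}B_{\mathbf{k}}(m)x^m=\frac{\sum_{i=1}^{n}A_{\mathbf{k},i}x^i}{(1-x)^{K+1}}$ and $\sum_{m\ge0}b_{\mathbf{k}}(m)x^m=\frac{\sum_{i=K-n+1}^{K}A_{\mathbf{k},K+1-i}x^i}{(1-x)^{K+1}}$. Weight: $\mathbf{k}$ has length $\ell$ and weight $(a_1,\ldots,a_\ell;t_1,\ldots,t_\ell;a)$ ($a_i\ge1,t_i\ge2,a\ge0$) if $\mathbf{k}=(1^{a_1-1},t_1,\ldots,1^{a_\ell-1},t_\ell,1^a)$, $1^r$ meaning $r$ consecutive ones. Notation: for a family $\mathcal{F}=\{B_1,\ldots,B_r\}$ of nonempty sets or multisets, $\min(\mathcal{F})=\{\min B_1,\ldots,\min B_r\}$; $a\sim_{\mathcal{F}}b$ means $a,b\in B_j$ for some $j$; $\mathrm{multiset}(\mathcal{F})=B_1\uplus\cdots\uplus B_r$ (multiset union). With a ground set $U$, $\mathcal{F}$ is segmented if for all $a<b<c$ in $U$, $a\sim_{\mathcal{F}}c$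 implies $b\in\min(\mathcal{F})$. For a permutation $\sigma$ of $[n]$ in one-line notation, $\mathrm{lmin}(\sigma)$ is its set of left-to-right minima. Let $n\ge m$ be integers, $U=[n+1]$, $\mathbf{k}$ of weight $(a_1,\ldots,a_{n-m};t_1,\ldots,t_{n-m};0)$, $M=\max(a_1,\ldots,a_{n-m})$. A $\mathbf{k}$-partition system of $[n]$ into $m$ blocks is an ordered tuple $(\pi_0,\pi_1,\ldots,\pi_M)$ with: (i) $\pi_1,\ldots,\pi_M$ are set partitions of $[n]$ into nonempty blocks; (ii) $\min(\pi_1)=\cdots=\min(\pi_M)$ and $|\min(\pi_1)|=m$; (iii) writing $[n]\setminus\min(\pi_1)=\{x_1<\cdots<x_{n-m}\}$, for all $1\le i\le n-m$ and $a_i<j\le M$ we have $x_i\sim_{\pi_j}1$; (iv) $\pi_0$ is a segmented family of nonempty multisets with $\min(\pi_0)=\min(\pi_1)$, $x_1\sim_{\pi_0}1$, and $\mathrm{multiset}(\pi_0)\subseteq\min(\pi_1)\uplus\{x_1,x_2^{t_1-2},\ldots,x_{n-m}^{t_{n-m-1}-2},(n+1)^{t_{n-m}-2}\}$. A $\mathbf{k}$-permutation system of $[n]$ with $m$ left-to-right minima is an ordered tuple $(\sigma_0,\sigma_1,\ldots,\sigma_M)$ with: (i) $\sigma_1,\ldots,\sigma_M$ are permutations of $[n]$; (ii) $\mathrm{lmin}(\sigma_1)=\cdots=\mathrm{lmin}(\sigma_M)$ and $|\mathrm{lmin}(\sigma_1)|=m$; (iii) writing $[n]\setminus\mathrm{lmin}(\sigma_1)=\{x_1<\cdots<x_{n-m}\}$,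 for all $1\le i\le n-m$ and $a_i<j\le M$: if $\sigma_j(p)=x_i$ then $\sigma_j(q)>x_i$ for all $q>p$; (iv) $\sigma_0$ is a segmented family of nonempty sets with $\min(\sigma_0)=\mathrm{lmin}(\sigma_1)$, $x_1\sim_{\sigma_0}1$, and $\mathrm{multiset}(\sigma_0)=\mathrm{lmin}(\sigma_1)\uplus\{x_1,x_2^{t_1-2},\ldots,x_{n-m}^{t_{n-m-1}-2},(n+1)^{t_{n-m}-2}\}$. $S_{\mathbf{k}}(n,m)$ is the number of $\mathbf{k}$-partition systems of $[n]$ into $m$ blocks and $s_{\mathbf{k}}(n,m)$ the number of $\mathbf{k}$-permutation systems of $[n]$ with $m$ left-to-right minima (these counts are $0$ when no such systems exist, e.g. when $m\le0$). -}

module Defs where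

open import Data.Bool using (Bool; true; false; _∧_; _∨_; not; if_then_else_; T)
open import Data.Nat using (ℕ; zero; suc; _+_; _*_; _∸_; _^_; _⊔_; _≡ᵇ_; _<ᵇ_; _≤ᵇ_)
open import Data.Nat.Combinatorics using (_C_)
open import Data.List as L using (List; []; _∷_; _++_; length; map; filterᵇ; concatMap;
  zipWith; zip; replicate; concat; upTo; drop; foldr)
open import Data.Bool.ListAction using (all; any)
open import Data.Nat.ListAction using (sum; product)
open import Data.Product using (Σ; _×_; _,_)
open import Data.Vec as V using (Vec; toList)

-- Generic helpers (elements of [n] are the naturals 1..n)

range : ℕ → List ℕ
range n = map suc (upTo n)

at : List ℕ → ℕ → ℕ
at []       _       = 0
at (x ∷ xs) zero    = x
at (x ∷ xs) (suc i) = at xs i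

at1 : List ℕ → ℕ → ℕ
at1 xs zero    = 0
at1 xs (suc i) = at xs i

memb : ℕ → List ℕ → Bool
memb x = any (λ y → x ≡ᵇ y)

eqList : List ℕ → List ℕ → Bool
eqList []       []       = true
eqList (x ∷ xs) (y ∷ ys) = (x ≡ᵇ y) ∧ eqList xs ys
eqList _        _        = false

strictlyIncreasing : List ℕ → Bool
strictlyIncreasing []           = true
strictlyIncreasing (x ∷ [])     = true
strictlyIncreasing (x ∷ y ∷ xs) = (x <ᵇ y) ∧ strictlyIncreasing (y ∷ xs)

countᵇ : {A : Set} → (A → Bool) → List A → ℕ
countᵇ p xs = length (filterᵇ p xs)

words : ℕ → ℕ → List (List ℕ)
words zero    n = [] ∷ []
words (suc L) n = concatMap (λ v → map (v ∷_) (words L n)) (range n)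

-- k of weight (a₁,…,a_ℓ; t₁,…,t_ℓ; a') is (1^{a₁-1}, t₁, …, 1^{a_ℓ-1}, t_ℓ, 1^{a'})
weightTuple : {ℓ : ℕ} → Vec ℕ ℓ → Vec ℕ ℓ → ℕ → List ℕ
weightTuple as ts a' =
  concat (zipWith (λ ai ti → replicate (ai ∸ 1) 1 ++ (ti ∷ [])) (toList as) (toList ts))
  ++ replicate a' 1

stirlingCond : List ℕ → Bool
stirlingCond w =
  all (λ i → all (λ s → all (λ j →
        not ((i <ᵇ s) ∧ (s <ᵇ j) ∧ (at w i ≡ᵇ at w j)) ∨ (at w i ≤ᵇ at w s))
      (upTo (length w))) (upTo (length w))) (upTo (length w))

isStirlingPerm : List ℕ → List ℕ → Bool
isStirlingPerm k w =
  (length w ≡ᵇ sum k)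
  ∧ all (λ v → countᵇ (λ x → x ≡ᵇ v) w ≡ᵇ at1 k v) (range (length k))
  ∧ all (λ x → memb x (range (length k))) w
  ∧ stirlingCond w

descents : List ℕ → ℕ
descents w = countᵇ (λ i → ((i <ᵇ K) ∧ (at1 w (suc i) <ᵇ at1 w i)) ∨ (i ≡ᵇ K)) (range K)
  where K = length w

Acoef : List ℕ → ℕ → ℕ
Acoef k i = countᵇ (λ w → isStirlingPerm k w ∧ (descents w ≡ᵇ i))
                   (words (sum k) (length k))

Series : Set
Series = ℕ → ℕ

_⊛_ : Series → Series → Series
(f ⊛ g) m = sum (map (λ j → f j * g (m ∸ j)) (upTo (suc m)))

oneS : Series
oneS zero    = 1
oneS (suc _) = 0

geomS : Series
geomS _ = 1

invPowS : ℕ → Series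
invPowS zero    = oneS
invPowS (suc r) = geomS ⊛ invPowS r

numB : List ℕ → Series
numB k i = if (1 ≤ᵇ i) ∧ (i ≤ᵇ length k) then Acoef k i else 0

numb : List ℕ → Series
numb k i = if (suc (sum k) ≤ᵇ i + length k) ∧ (i ≤ᵇ sum k) then Acoef k (suc (sum k) ∸ i) else 0

Bpoly : List ℕ → ℕ → ℕ
Bpoly k = numB k ⊛ invPowS (suc (sum k))

bpoly : List ℕ → ℕ → ℕ
bpoly k = numb k ⊛ invPowS (suc (sum k))

-- Families of (multi)sets.  A (multi)set over [N] is its multiplicity
-- list of length N (entry x-1 = multiplicity of x).  A family is a list
-- of blocks listed in strictly increasing order of their minima.

minBlock : List ℕ → ℕ
minBlock B = go 1 B
  where
  go : ℕ → List ℕ → ℕ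
  go i []       = 0
  go i (zero  ∷ xs) = go (suc i) xs
  go i (suc _ ∷ xs) = i

nonemptyBlock : List ℕ → Bool
nonemptyBlock B = any (λ x → 1 ≤ᵇ x) B

inBlock : ℕ → List ℕ → Bool
inBlock x B = 1 ≤ᵇ at1 B x

minsF : List (List ℕ) → List ℕ
minsF F = map minBlock F

simF : List (List ℕ) → ℕ → ℕ → Bool
simF F x y = any (λ B → inBlock x B ∧ inBlock y B) F

multF : List (List ℕ) → ℕ → ℕ
multF F x = sum (map (λ B → at1 B x) F)

familyOK : List (List ℕ) → Bool
familyOK F = all nonemptyBlock F ∧ strictlyIncreasing (minsF F)

segmented : ℕ → List (List ℕ) → Bool
segmented N F =
  all (λ a → all (λ b → all (λ c →
     not ((a <ᵇ b) ∧ (b <ᵇ c) ∧ simF F a c) ∨ memb b (minsF F))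
   (range N)) (range N)) (range N)

boolMult : List Bool → List ℕ
boolMult = map (λ b → if b then 1 else 0)

isSetPartition : ℕ → List (List ℕ) → Bool
isSetPartition n P =
  familyOK P ∧ all (λ x → countᵇ (inBlock x) P ≡ᵇ 1) (range n)

complementL : ℕ → List ℕ → List ℕ
complementL n S = filterᵇ (λ x → not (memb x S)) (range n)

-- the multiset {x₁, x₂^{t₁-2}, …, x_ℓ^{t_{ℓ-1}-2}, (n+1)^{t_ℓ-2}} ⊎ mins, as multiplicity of u
boundMult : ℕ → List ℕ → List ℕ → List ℕ → ℕ → ℕ
boundMult n ts mins xs u =
  (if memb u mins then 1 else 0)
  + (if u ≡ᵇ at1 xs 1 then 1 else 0)
  + sum (zipWith (λ y ti → if u ≡ᵇ y then ti ∸ 2 else 0)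
                 (drop 1 xs ++ (suc n ∷ [])) ts)

maxL : List ℕ → ℕ
maxL = foldr _⊔_ 0

module _ {ℓ : ℕ} (as ts : Vec ℕ ℓ) (n m : ℕ) where

  Mmax : ℕ
  Mmax = maxL (toList as)

  PartData : Set
  PartData = List (Vec ℕ (suc n)) × Vec (List (Vec Bool n)) Mmax

  isPartSystem : PartData → Bool
  isPartSystem (π0 , πs) =
      all (isSetPartition n) Ps
    ∧ all (λ P → eqList (minsF P) mins1) Ps
    ∧ (length mins1 ≡ᵇ m)
    ∧ all (λ { (x , ai) → all (λ { (j , P) → not (ai <ᵇ j) ∨ simF P x 1 })
                                 (zip (range Mmax) Ps) })
          (zip xs (toList as))
    ∧ familyOK F0 ∧ segmented (suc n) F0 ∧ eqList (minsF F0) mins1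
    ∧ simF F0 (at1 xs 1) 1
    ∧ all (λ u → multF F0 u ≤ᵇ boundMult n (toList ts) mins1 xs u) (range (suc n))
    where
    Ps : List (List (List ℕ))
    Ps = map (map boolMult) (map (map toList) (toList πs))
    P1 : List (List ℕ)
    P1 = at1' Ps
      where
      at1' : List (List (List ℕ)) → List (List ℕ)
      at1' []      = []
      at1' (P ∷ _) = P
    mins1 : List ℕ
    mins1 = minsF P1
    xs : List ℕ
    xs = complementL n mins1
    F0 : List (List ℕ)
    F0 = map toList π0

  PartSystem : Set
  PartSystem = Σ PartData (λ d → T (isPartSystem d))

isPermutation : ℕ → List ℕ → Bool
isPermutation n σ = all (λ v → countᵇ (λ x → x ≡ᵇ v) σ ≡ᵇ 1) (range n)
                  ∧ all (λ x → memb x (range n)) σ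

lmin : List ℕ → List ℕ
lmin σ = filterᵇ isL (range (length σ))
  where
  isL : ℕ → Bool
  isL v = any (λ p → (at σ p ≡ᵇ v) ∧ all (λ q → not (q <ᵇ p) ∨ (v <ᵇ at σ q)) (upTo (length σ)))
              (upTo (length σ))

module _ {ℓ : ℕ} (as ts : Vec ℕ ℓ) (n m : ℕ) where

  PermData : Set
  PermData = List (Vec Bool (suc n)) × Vec (Vec ℕ n) (Mmax as ts n m)

  isPermSystem : PermData → Bool
  isPermSystem (σ0 , σs) =
      all (isPermutation n) Ss
    ∧ all (λ σ → eqList (lmin σ) mins1) Ss
    ∧ (length mins1 ≡ᵇ m)
    ∧ all (λ { (x , ai) → all (λ { (j , σ) → not (ai <ᵇ j) ∨
              all (λ p → all (λ q → not ((at σ p ≡ᵇ x) ∧ (p <ᵇ q)) ∨ (x <ᵇ at σ q))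
                     (upTo n)) (upTo n) })
                     (zip (range (Mmax as ts n m)) Ss) })
          (zip xs (toList as))
    ∧ familyOK F0 ∧ segmented (suc n) F0 ∧ eqList (minsF F0) mins1
    ∧ simF F0 (at1 xs 1) 1
    ∧ all (λ u → multF F0 u ≡ᵇ boundMult n (toList ts) mins1 xs u) (range (suc n))
    where
    Ss : List (List ℕ)
    Ss = map toList (toList σs)
    mins1 : List ℕ
    mins1 = lmin (at1' Ss)
      where
      at1' : List (List ℕ) → List ℕ
      at1' []      = []
      at1' (σ ∷ _) = σ
    xs : List ℕ
    xs = complementL n mins1
    F0 : List (List ℕ)
    F0 = map (λ B → boolMult (toList B)) σ0

  PermSystem : Set
  PermSystem = Σ PermData (λ d → T (isPermSystem d))

zipWith3 : {A B C D : Set} → (A → B → C → D) → List A → List B → List C → List D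
zipWith3 f (x ∷ xs) (y ∷ ys) (z ∷ zs) = f x y z ∷ zipWith3 f xs ys zs
zipWith3 f _ _ _ = []

nondecreasing : List ℕ → Bool
nondecreasing []           = true
nondecreasing (x ∷ [])     = true
nondecreasing (x ∷ y ∷ xs) = (x ≤ᵇ y) ∧ nondecreasing (y ∷ xs)

sumS : {ℓ : ℕ} → Vec ℕ ℓ → Vec ℕ ℓ → ℕ → ℕ
sumS {ℓ} as ts m = sum (map term (filterᵇ nondecreasing (words ℓ m)))
  where
  term : List ℕ → ℕ
  term is = product (zipWith _^_ is (toList as))
          * product (zipWith3 (λ t i i' → (t + i' ∸ i ∸ 2) C (i' ∸ i))
                                (toList ts) is (drop 1 is ++ (m ∷ [])))

sumP : {ℓ : ℕ} → Vec ℕ ℓ → Vec ℕ ℓ → ℕ → ℕ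
sumP {ℓ} as ts m = sum (map term (filterᵇ strictlyIncreasing (words ℓ (m ∸ 1))))
  where
  term : List ℕ → ℕ
  term is = product (zipWith _^_ is (toList as))
          * product (zipWith3 (λ t i i' → (i' ∸ i ∸ 1) C (t ∸ 2))
                                (toList ts) is (drop 1 is ++ (m ∷ [])))

{-# OPTIONS --safe #-}

-- The copies of the largest letter n of a Stirling permutation are adjacent, so the permutation is obtained
-- from one of k₁,…,k_{n-1} by inserting a block of k_n letters: in a descent gap this keeps the number of
-- descents, in any other gap it adds one.  On generating functions this says
--   B_{k,t} = (1-x)^{1-t} x d/dx B_k   and   b_{k,t} = (x/(1-x))^{t-1} x d/dx b_k,
-- and iterating over the weight gives the two sums.
--
-- On the combinatorial side fix the set S of minima, a mask on [n].  Write a family as a 0/1 or multiplicity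
-- matrix with one row per block.  The column of a minimum is then determined, and the column of the i-th
-- non-minimum x_i can be chosen independently of the others: in π_j it is any of the rows opened before x_i
-- (only the first row if a_i < j), while segmentation confines it in π₀ to the rows opened between x_{i-1} and
-- x_i, which produces the binomial coefficients.  A permutation is built by inserting 1, 2, …, n in turn; x is
-- a left-to-right minimum iff it goes to the front, which leaves x - 1 places for a non-minimum x (only the
-- last place if it is forced).  The index i_j of the sums is the number of minima below x_j, respectively
-- x_j - 1.
module Submission where

open import Defs
open import Data.Bool using (Bool; true; false; _∧_; _∨_; not; if_then_else_; T)
open import Data.Bool.ListAction using (all; any)
open import Data.Bool.Properties using (T-irrelevant; T-∧)
open import Data.Empty using (⊥; ⊥-elim)
open import Data.Fin as Fin using (Fin)
open import Data.List as L using (List; []; _∷_; _++_; length; map; filterᵇ; concatMap; concat; upTo; applyUpTo; drop; replicate; foldl; zip; zipWith)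
open import Data.List.Membership.Propositional using (_∈_)
open import Data.List.Membership.Propositional.Properties using (∈-map⁺; ∈-map⁻; ∈-++⁺ˡ; ∈-++⁺ʳ; ∈-++⁻; ∈-lookup; ∈-filter⁺; ∈-filter⁻; ∈-upTo⁺; ∈-upTo⁻)
open import Data.List.Membership.Propositional.Properties.WithK using (unique⇒irrelevant; unique∧set⇒bag)
open import Data.List.Properties using (length-map; length-++; length-replicate; length-upTo; map-++; map-∘; map-id; map-cong; map-cong-local; map-applyUpTo; upTo-∷ʳ; foldl-++; ++-identityʳ; ∷-injectiveˡ; ∷-injectiveʳ)
open import Data.List.Relation.Binary.BagAndSetEquality using (∼bag⇒↭)
open import Data.List.Relation.Binary.Permutation.Propositional using (_↭_)
open import Data.List.Relation.Binary.Permutation.Propositional.Properties using (↭-length)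
open import Data.List.Relation.Binary.Sublist.Propositional using (_⊆_; []; _∷_; _∷ʳ_; ⊆-refl; ⊆-trans; minimum)
open import Data.List.Relation.Unary.All as All using (All; []; _∷_)
import Data.List.Relation.Unary.All.Properties as All
open import Data.List.Relation.Unary.AllPairs using ([]; _∷_)
open import Data.List.Relation.Unary.Any as Any using (Any; here; there; index)
import Data.List.Relation.Unary.Any.Properties as Any
open import Data.List.Relation.Unary.Unique.Propositional using (Unique)
import Data.List.Relation.Unary.Unique.Propositional.Properties as Unique
open import Data.Nat
open import Data.Nat.Combinatorics using (_C_; nCn≡1; nC1≡n; nCk+nC[k+1]≡[n+1]C[k+1])
open import Data.Nat.ListAction using (sum; product)
open import Data.Nat.ListAction.Properties using (sum-++)
open import Data.Nat.Properties
open import Data.Nat.Tactic.RingSolver using (solve-∀)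
open import Data.Product using (Σ; ∃; ∃₂; _×_; _,_; proj₁; proj₂)
open import Data.Sum using (_⊎_; inj₁; inj₂)
open import Data.Unit using (⊤; tt)
open import Data.Vec as V using (Vec; lookup; toList)
open import Data.Vec.Properties using (length-toList)
open import Function using (_↔_; _∘_; id; mk↔ₛ′; mk⇔; Equivalence)
open import Relation.Binary.Definitions using (tri<; tri≈; tri>)
open import Relation.Binary.PropositionalEquality
open import Relation.Nullary using (¬_; yes; no)
open import Relation.Nullary.Decidable using (T?)
open ≡-Reasoning

-- Finite enumerations and cardinalities

-- Descents and ascents together count all K+1 gaps, the front being an ascent, so an insertion
-- weights its two outcomes by d and K+1-d. The numerator of b is that of B with ascents in place of
-- descents, so one Euler identity serves both series. The two sides fit together through a shift of
-- the labels: t_i limits the column of x_{i+1}, and t_ℓ that of the additional element n+1, while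
-- x_1 must join the block of 1 with multiplicity one. The mask is therefore extended by a
-- non-minimum n+1, and the last binomial coefficient compares i_ℓ with m. A column with d
-- admissible rows is a multiset of at most t-2 rows in π₀ and a set of exactly t-2 rows in σ₀. In
-- the second case the i_j are positions, and i_{j+1} - i_j - 1 minima lie between consecutive
-- non-minima.

record Enumerates {A : Set} (P : A → Set) (xs : List A) : Set where
  constructor enum
  field
    unique   : Unique xs
    sound    : ∀ {x} → x ∈ xs → P x
    complete : ∀ {x} → P x → x ∈ xs
open Enumerates

-- Cardinality as the length of a duplicate-free list rather than as a bijection with `Fin n`:
-- counts then split over concatenations and become sums over lists. `P` may be any predicate, since
-- its proofs are never compared.
record Size {A : Set} (P : A → Set) (n : ℕ) : Set where
  constructor size
  field
    elements   : List A
    enumerates : Enumerates P elements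
    counts     : length elements ≡ n

enumerates⇒Size : {A : Set} {P : A → Set} {xs : List A} → Enumerates P xs → Size P (length xs)
enumerates⇒Size e = size _ e refl

-- Duplicate-free lists with the same elements are equal as bags. This moves a count over all words
-- to a count over words built by insertion.
enumerates-↭ : {A : Set} {P Q : A → Set} {xs ys : List A} → Enumerates P xs → Enumerates Q ys →
  (∀ {x} → P x → Q x) → (∀ {x} → Q x → P x) → xs ↭ ys
enumerates-↭ e f to from = ∼bag⇒↭ (unique∧set⇒bag (unique e) (unique f)
  (mk⇔ (complete f ∘ to ∘ sound e) (complete e ∘ from ∘ sound f)))

unique-map-on : {A B : Set} (f : A → B) {xs : List A} →
  (∀ {x y} → x ∈ xs → y ∈ xs → f x ≡ f y → x ≡ y) → Unique xs → Unique (map f xs)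
unique-map-on f inj [] = []
unique-map-on f {x ∷ xs} inj (x∉ ∷ u) =
  All.tabulate (λ fy∈ fx≡ → let (y , y∈ , eq) = ∈-map⁻ f fy∈ in
    All.lookup x∉ y∈ (inj (here refl) (there y∈) (trans fx≡ eq)))
  ∷ unique-map-on f (λ p q → inj (there p) (there q)) u

-- `f` and `g` are total but have to be mutually inverse only on `P` and `Q`, so maps such as
-- `drop 1` or `rem` may do anything elsewhere.
Size-bij : {A B : Set} {P : A → Set} {Q : B → Set} {n : ℕ} (f : A → B) (g : B → A) →
  (∀ {a} → P a → Q (f a)) → (∀ {b} → Q b → P (g b)) →
  (∀ {a} → P a → g (f a) ≡ a) → (∀ {b} → Q b → f (g b) ≡ b) → Size P n → Size Q n
Size-bij {P = P} {Q} f g pf qg gf fg (size xs e refl) = size (map f xs)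
  (enum (unique-map-on f (λ x∈ y∈ eq → trans (sym (gf (sound e x∈))) (trans (cong g eq) (gf (sound e y∈)))) (unique e))
        snd
        (λ q → subst (_∈ map f xs) (fg q) (∈-map⁺ f (complete e (qg q)))))
  (length-map f xs)
  where
  snd : ∀ {y} → y ∈ map f xs → Q y
  snd y∈ with ∈-map⁻ f y∈
  ... | x , x∈ , refl = pf (sound e x∈)

Size-cong : {A : Set} {P Q : A → Set} {n : ℕ} →
  (∀ {a} → P a → Q a) → (∀ {a} → Q a → P a) → Size P n → Size Q n
Size-cong to from = Size-bij id id to from (λ _ → refl) (λ _ → refl)

Size-⊥ : {A : Set} {P : A → Set} → (∀ {a} → ¬ P a) → Size P 0
Size-⊥ none = size [] (enum [] (λ ()) (λ p → ⊥-elim (none p))) refl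

Size-≡ : {A : Set} (a : A) → Size (_≡ a) 1
Size-≡ a = size (a ∷ []) (enum ([] ∷ []) (λ { (here p) → p }) here) refl

Size-⊎ : {A : Set} {P Q : A → Set} {m n : ℕ} → (∀ {a} → P a → Q a → ⊥) →
  Size P m → Size Q n → Size (λ a → P a ⊎ Q a) (m + n)
Size-⊎ {P = P} {Q} disj (size xs e refl) (size ys f refl) = size (xs ++ ys)
  (enum (Unique.++⁺ (unique e) (unique f) (λ { (x∈ , y∈) → disj (sound e x∈) (sound f y∈) }))
        snd
        (λ { (inj₁ p) → ∈-++⁺ˡ (complete e p) ; (inj₂ q) → ∈-++⁺ʳ xs (complete f q) }))
  (length-++ xs)
  where
  snd : ∀ {z} → z ∈ xs ++ ys → P z ⊎ Q z
  snd z∈ with ∈-++⁻ xs z∈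
  ... | inj₁ p = inj₁ (sound e p)
  ... | inj₂ q = inj₂ (sound f q)

Size-Σ∈ : {A B : Set} {Q : A → B → Set} (n : A → ℕ) {xs : List A} → Unique xs →
  (∀ {a} → a ∈ xs → Size (Q a) (n a)) →
  Size (λ (ab : A × B) → proj₁ ab ∈ xs × Q (proj₁ ab) (proj₂ ab)) (sum (map n xs))
Size-Σ∈ n [] s = Size-⊥ λ { (() , _) }
Size-Σ∈ {A} {B} {Q} n {x ∷ xs} (x∉ ∷ u) s =
  Size-cong to from
    (Size-⊎ (λ { (refl , _) (p , _) → All.lookup x∉ p refl })
      (Size-bij {Q = λ ab → proj₁ ab ≡ x × Q x (proj₂ ab)} (x ,_) proj₂ (refl ,_) proj₂
        (λ _ → refl) (λ { (refl , _) → refl }) (s (here refl)))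
      (Size-Σ∈ n u (s ∘ there)))
  where
  to : ∀ {ab : A × B} → (proj₁ ab ≡ x × Q x (proj₂ ab)) ⊎ (proj₁ ab ∈ xs × Q (proj₁ ab) (proj₂ ab)) →
       proj₁ ab ∈ x ∷ xs × Q (proj₁ ab) (proj₂ ab)
  to (inj₁ (refl , q)) = here refl , q
  to (inj₂ (p , q))    = there p , q
  from : ∀ {ab : A × B} → proj₁ ab ∈ x ∷ xs × Q (proj₁ ab) (proj₂ ab) →
       (proj₁ ab ≡ x × Q x (proj₂ ab)) ⊎ (proj₁ ab ∈ xs × Q (proj₁ ab) (proj₂ ab))
  from (here refl , q) = inj₁ (refl , q)
  from (there p , q)   = inj₂ (p , q)

-- The enumeration of the base stays visible in the count: with index words as base, this sum
-- becomes the sum over i_1, ..., i_ℓ.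
Size-Σ : {A B : Set} {P : A → Set} {Q : A → B → Set} (n : A → ℕ) {xs : List A} → Enumerates P xs →
  (∀ {a} → P a → Size (Q a) (n a)) →
  Size (λ (ab : A × B) → P (proj₁ ab) × Q (proj₁ ab) (proj₂ ab)) (sum (map n xs))
Size-Σ n e s = Size-cong (λ { (p , q) → sound e p , q }) (λ { (p , q) → complete e p , q })
  (Size-Σ∈ n (unique e) (s ∘ sound e))

sum-map-const : {A : Set} (c : ℕ) (xs : List A) → sum (map (λ _ → c) xs) ≡ length xs * c
sum-map-const c []       = refl
sum-map-const c (x ∷ xs) = cong (c +_) (sum-map-const c xs)

Size-× : {A B : Set} {P : A → Set} {Q : B → Set} {m n : ℕ} → Size P m → Size Q n →
  Size (λ (ab : A × B) → P (proj₁ ab) × Q (proj₂ ab)) (m * n)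
Size-× {n = n} (size xs e refl) s =
  subst (Size _) (sum-map-const n xs) (Size-Σ (λ _ → n) e (λ _ → s))

-- A duplicate-free list has only one membership proof per element, so positions are well defined;
-- proofs of `T` are unique, so an element of the Σ-type is determined by its first component.
Size⇒↔ : {A : Set} {p : A → Bool} {n : ℕ} → Size (T ∘ p) n → Σ A (T ∘ p) ↔ Fin n
Size⇒↔ {A} {p} (size xs e refl) = mk↔ₛ′ to from to∘from from∘to
  where
  to : Σ A (T ∘ p) → Fin (length xs)
  to (_ , q) = index (complete e q)
  from : Fin (length xs) → Σ A (T ∘ p)
  from i = L.lookup xs i , sound e (∈-lookup i)
  index-∈-lookup : ∀ {ys : List A} (i : Fin (length ys)) → index (∈-lookup {xs = ys} i) ≡ i
  index-∈-lookup {_ ∷ _} Fin.zero    = refl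
  index-∈-lookup {_ ∷ _} (Fin.suc i) = cong Fin.suc (index-∈-lookup i)
  to∘from : ∀ i → to (from i) ≡ i
  to∘from i = trans (cong index (unique⇒irrelevant (unique e) _ (∈-lookup i))) (index-∈-lookup i)
  Σ-T-≡ : ∀ {a b : A} {q : T (p a)} {r : T (p b)} → a ≡ b → (a , q) ≡ (b , r)
  Σ-T-≡ refl = cong (_ ,_) (T-irrelevant _ _)
  from∘to : ∀ s → from (to s) ≡ s
  from∘to (a , q) = Σ-T-≡ (sym (Any.lookup-index (complete e q)))

enumerates-filterᵇ : {A : Set} {P : A → Set} {xs : List A} (p : A → Bool) → Enumerates P xs →
  Enumerates (λ a → P a × T (p a)) (filterᵇ p xs)
enumerates-filterᵇ p e = enum (Unique.filter⁺ (T? ∘ p) (unique e))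
  (λ x∈ → let (x∈xs , px) = ∈-filter⁻ (T? ∘ p) x∈ in sound e x∈xs , px)
  (λ { (q , px) → ∈-filter⁺ (T? ∘ p) (complete e q) px })

sum-map-concatMap : {A B : Set} (f : B → ℕ) (g : A → List B) (xs : List A) →
  sum (map f (concatMap g xs)) ≡ sum (map (λ x → sum (map f (g x))) xs)
sum-map-concatMap f g [] = refl
sum-map-concatMap f g (x ∷ xs) = begin
  sum (map f (g x ++ concatMap g xs))               ≡⟨ cong sum (map-++ f (g x) (concatMap g xs)) ⟩
  sum (map f (g x) ++ map f (concatMap g xs))       ≡⟨ sum-++ (map f (g x)) _ ⟩
  sum (map f (g x)) + sum (map f (concatMap g xs))  ≡⟨ cong (sum (map f (g x)) +_) (sum-map-concatMap f g xs) ⟩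
  sum (map f (g x)) + sum (map (λ y → sum (map f (g y))) xs) ∎
  where open ≡-Reasoning

enumerates-cong : {A : Set} {P Q : A → Set} {xs : List A} →
  (∀ {a} → P a → Q a) → (∀ {a} → Q a → P a) → Enumerates P xs → Enumerates Q xs
enumerates-cong to from e = enum (unique e) (to ∘ sound e) (complete e ∘ from)

enumerates-map : {A B : Set} {P : A → Set} {xs : List A} (f : A → B) →
  (∀ {x y} → P x → P y → f x ≡ f y → x ≡ y) → Enumerates P xs →
  Enumerates (λ b → ∃ λ a → P a × b ≡ f a) (map f xs)
enumerates-map {P = P} {xs} f inj e = enum
  (unique-map-on f (λ x∈ y∈ → inj (sound e x∈) (sound e y∈)) (unique e))
  (λ y∈ → let (a , a∈ , eq) = ∈-map⁻ f y∈ in a , sound e a∈ , eq)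
  (λ { (a , p , refl) → ∈-map⁺ f (complete e p) })

-- The lists `ys a` are disjoint because an element `b` determines the `a` from which it came.
enumerates-concatMap : {A B : Set} {P : A → Set} {Q : A → B → Set} {xs : List A} (ys : A → List B) →
  (∀ {a a' b} → Q a b → Q a' b → a ≡ a') → Enumerates P xs →
  (∀ {a} → P a → Enumerates (Q a) (ys a)) →
  Enumerates (λ b → ∃ λ a → P a × Q a b) (concatMap ys xs)
enumerates-concatMap {A} {B} {P} {Q} {xs} ys inj e es =
  enumerates-cong (λ { (a , a∈ , q) → a , sound e a∈ , q }) (λ { (a , p , q) → a , complete e p , q })
    (go (unique e) (es ∘ sound e))
  where
  go : ∀ {xs} → Unique xs → (∀ {a} → a ∈ xs → Enumerates (Q a) (ys a)) →
       Enumerates (λ b → ∃ λ a → a ∈ xs × Q a b) (concatMap ys xs)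
  go [] _ = enum [] (λ ()) (λ { (_ , () , _) })
  go {x ∷ xs} (x∉ ∷ u) es = enum
    (Unique.++⁺ (unique (es (here refl))) (unique rest)
      (λ { (b∈ , b∈') → let (a , a∈ , q) = sound rest b∈' in
           All.lookup x∉ a∈ (inj (sound (es (here refl)) b∈) q) }))
    snd cmp
    where
    rest = go u (es ∘ there)
    snd : ∀ {b} → b ∈ ys x ++ concatMap ys xs → ∃ λ a → a ∈ x ∷ xs × Q a b
    snd b∈ with ∈-++⁻ (ys x) b∈
    ... | inj₁ p = x , here refl , sound (es (here refl)) p
    ... | inj₂ p = let (a , a∈ , q) = sound rest p in a , there a∈ , q
    cmp : ∀ {b} → (∃ λ a → a ∈ x ∷ xs × Q a b) → b ∈ ys x ++ concatMap ys xs
    cmp (a , here refl , q) = ∈-++⁺ˡ (complete (es (here refl)) q)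
    cmp (a , there a∈ , q)  = ∈-++⁺ʳ (ys x) (complete rest (a , a∈ , q))

-- Enumerations of intervals and words

enumerates-upTo : ∀ n → Enumerates (_< n) (upTo n)
enumerates-upTo n = enum (Unique.upTo⁺ n) ∈-upTo⁻ ∈-upTo⁺

InRange : ℕ → ℕ → Set
InRange n x = 1 ≤ x × x ≤ n

enumerates-range : ∀ n → Enumerates (InRange n) (range n)
enumerates-range n = enumerates-cong
  (λ { (_ , a<n , refl) → s≤s z≤n , a<n })
  (λ { {suc a} (_ , a<n) → a , a<n , refl })
  (enumerates-map suc (λ _ _ → suc-injective) (enumerates-upTo n))

enumerates-words : ∀ L n → Enumerates (λ w → length w ≡ L × All (InRange n) w) (words L n)
enumerates-words zero n = enum ([] ∷ []) (λ { (here refl) → refl , [] })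
  (λ { {[]} _ → here refl ; {_ ∷ _} (() , _) })
enumerates-words (suc L) n = enumerates-cong
  (λ { (v , p , w , (l , a) , refl) → cong suc l , p ∷ a })
  (λ { {[]} (() , _) ; {v ∷ w} (l , p ∷ a) → v , p , w , (suc-injective l , a) , refl })
  (enumerates-concatMap (λ v → map (v ∷_) (words L n))
    (λ { (_ , _ , refl) (_ , _ , refl) → refl })
    (enumerates-range n)
    (λ {v} _ → enumerates-map (v ∷_) (λ _ _ → ∷-injectiveʳ) (enumerates-words L n)))

-- Iterated partial sums of series

∑ : ℕ → (ℕ → ℕ) → ℕ
∑ zero    f = 0
∑ (suc n) f = ∑ n f + f n

sum-upTo : ∀ f n → sum (map f (upTo n)) ≡ ∑ n f
sum-upTo f zero    = refl
sum-upTo f (suc n) = begin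
  sum (map f (upTo (suc n)))            ≡⟨ cong (sum ∘ map f) (upTo-∷ʳ n) ⟨
  sum (map f (upTo n ++ n ∷ []))        ≡⟨ cong sum (map-++ f (upTo n) _) ⟩
  sum (map f (upTo n) ++ f n ∷ [])      ≡⟨ sum-++ (map f (upTo n)) _ ⟩
  sum (map f (upTo n)) + (f n + 0)      ≡⟨ cong₂ _+_ (sum-upTo f n) (+-identityʳ (f n)) ⟩
  ∑ n f + f n                           ∎

∑-cong : ∀ {f g : ℕ → ℕ} n → (∀ j → j < n → f j ≡ g j) → ∑ n f ≡ ∑ n g
∑-cong zero    eq = refl
∑-cong (suc n) eq = cong₂ _+_ (∑-cong n (λ j j<n → eq j (m<n⇒m<1+n j<n))) (eq n ≤-refl)

∑-zero : ∀ {f : ℕ → ℕ} n → (∀ j → j < n → f j ≡ 0) → ∑ n f ≡ 0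
∑-zero zero    eq = refl
∑-zero (suc n) eq = cong₂ _+_ (∑-zero n (λ j j<n → eq j (m<n⇒m<1+n j<n))) (eq n ≤-refl)

∑-+ : ∀ (f g : ℕ → ℕ) n → ∑ n (λ j → f j + g j) ≡ ∑ n f + ∑ n g
∑-+ f g zero    = refl
∑-+ f g (suc n) rewrite ∑-+ f g n = lemma (∑ n f) (∑ n g) (f n) (g n)
  where
  lemma : ∀ a b c d → a + b + (c + d) ≡ a + c + (b + d)
  lemma = solve-∀

∑-suc : ∀ (f : ℕ → ℕ) n → ∑ (suc n) f ≡ f 0 + ∑ n (f ∘ suc)
∑-suc f zero    = sym (+-identityʳ (f 0))
∑-suc f (suc n) rewrite ∑-suc f n = +-assoc (f 0) _ _

-- With `u = suc` the sum includes the index m, with `u = id` it stops before m. The series of B and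
-- b differ in this choice, and everything that only needs linearity is shared.
partial : (ℕ → ℕ) → (ℕ → ℕ) → ℕ → ℕ
partial u f m = ∑ (u m) f

-- Multiplication by 1/(1-x), x/(1-x) and x, respectively.
psum psum< shift : (ℕ → ℕ) → ℕ → ℕ
psum  = partial suc
psum< = partial (λ m → m)
shift f zero    = 0
shift f (suc m) = f m

iter : ((ℕ → ℕ) → ℕ → ℕ) → ℕ → (ℕ → ℕ) → ℕ → ℕ
iter Φ zero    f = f
iter Φ (suc r) f = Φ (iter Φ r f)

iter-+ : ∀ Φ r s f → iter Φ (r + s) f ≡ iter Φ r (iter Φ s f)
iter-+ Φ zero    s f = refl
iter-+ Φ (suc r) s f = cong Φ (iter-+ Φ r s f)

partial-cong : ∀ u {f g} → f ≗ g → partial u f ≗ partial u g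
partial-cong u eq m = ∑-cong (u m) (λ j _ → eq j)

iter-cong : ∀ u r {f g} → f ≗ g → iter (partial u) r f ≗ iter (partial u) r g
iter-cong u zero    eq = eq
iter-cong u (suc r) eq = partial-cong u (iter-cong u r eq)

shift-cong : ∀ {f g} → f ≗ g → shift f ≗ shift g
shift-cong eq zero    = refl
shift-cong eq (suc m) = eq m

psum-shift : ∀ f → psum (shift f) ≗ psum< f
psum-shift f m = ∑-suc (shift f) m

psum<-shift : ∀ f → psum< f ≗ shift (psum f)
psum<-shift f zero    = refl
psum<-shift f (suc m) = refl

iter-psum-shift : ∀ r f → iter psum r (shift f) ≗ shift (iter psum r f)
iter-psum-shift zero    f m = refl
iter-psum-shift (suc r) f m = begin
  psum (iter psum r (shift f)) m  ≡⟨ partial-cong suc (iter-psum-shift r f) m ⟩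
  psum (shift (iter psum r f)) m  ≡⟨ psum-shift (iter psum r f) m ⟩
  psum< (iter psum r f) m         ≡⟨ psum<-shift (iter psum r f) m ⟩
  shift (psum (iter psum r f)) m  ∎

∑-* : ∀ c (f : ℕ → ℕ) n → ∑ n (λ j → c * f j) ≡ c * ∑ n f
∑-* c f zero    = sym (*-zeroʳ c)
∑-* c f (suc n) rewrite ∑-* c f n = sym (*-distribˡ-+ c (∑ n f) (f n))

∑-sum : ∀ {A : Set} (F : A → ℕ → ℕ) (ws : List A) n →
  ∑ n (λ i → sum (map (λ w → F w i) ws)) ≡ sum (map (λ w → ∑ n (F w)) ws)
∑-sum F []       n = ∑-zero n (λ _ _ → refl)
∑-sum F (w ∷ ws) n = trans (∑-+ (F w) _ n) (cong (∑ n (F w) +_) (∑-sum F ws n))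

iter-sum : ∀ {A : Set} u r (F : A → ℕ → ℕ) (ws : List A) →
  iter (partial u) r (λ i → sum (map (λ w → F w i) ws)) ≗ (λ m → sum (map (λ w → iter (partial u) r (F w) m) ws))
iter-sum u zero    F ws m = refl
iter-sum u (suc r) F ws m =
  trans (partial-cong u (iter-sum u r F ws) m) (∑-sum (λ w → iter (partial u) r (F w)) ws (u m))

iter-linear : ∀ u r c d (f g : ℕ → ℕ) →
  iter (partial u) r (λ j → c * f j + d * g j) ≗ (λ m → c * iter (partial u) r f m + d * iter (partial u) r g m)
iter-linear u zero    c d f g m = refl
iter-linear u (suc r) c d f g m =
  trans (partial-cong u (iter-linear u r c d f g) m)
    (trans (∑-+ (λ j → c * F j) _ (u m)) (cong₂ _+_ (∑-* c F (u m)) (∑-* d G (u m))))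
  where
  F = iter (partial u) r f
  G = iter (partial u) r g

-- Kernels of iterated partial sums

⊛-∑ : ∀ f g m → (f ⊛ g) m ≡ ∑ (suc m) (λ j → f j * g (m ∸ j))
⊛-∑ f g m = sum-upTo _ (suc m)

invPowS-zero : ∀ r → invPowS r 0 ≡ 1
invPowS-zero zero    = refl
invPowS-zero (suc r) = trans (+-identityʳ _) (trans (+-identityʳ _) (invPowS-zero r))

invPowS-suc : ∀ r d → invPowS (suc r) (suc d) ≡ invPowS (suc r) d + invPowS r (suc d)
invPowS-suc r d = begin
  invPowS (suc r) (suc d)                                               ≡⟨ ⊛-∑ geomS (invPowS r) (suc d) ⟩
  ∑ (suc (suc d)) (λ j → 1 * invPowS r (suc d ∸ j))                     ≡⟨ ∑-suc _ (suc d) ⟩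
  1 * invPowS r (suc d) + ∑ (suc d) (λ j → 1 * invPowS r (d ∸ j))       ≡⟨ cong₂ _+_ (*-identityˡ (invPowS r (suc d))) (sym (⊛-∑ geomS (invPowS r) d)) ⟩
  invPowS r (suc d) + invPowS (suc r) d                                 ≡⟨ +-comm (invPowS r (suc d)) _ ⟩
  invPowS (suc r) d + invPowS r (suc d)                                 ∎

-- Each summation is a factor 1/(1-x). The inner induction on m compares the terms one by one
-- through `invPowS-suc`, Pascal's rule for powers of 1/(1-x).
iter-psum-kernel : ∀ r f m → iter psum r f m ≡ ∑ (suc m) (λ j → f j * invPowS r (m ∸ j))
iter-psum-kernel zero f m = sym (begin
  ∑ m (λ j → f j * oneS (m ∸ j)) + f m * oneS (m ∸ m)
    ≡⟨ cong₂ _+_ (∑-zero m off) (trans (cong (λ z → f m * oneS z) (n∸n≡0 m)) (*-identityʳ (f m))) ⟩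
  f m ∎)
  where
  off : ∀ j → j < m → f j * oneS (m ∸ j) ≡ 0
  off j j<m rewrite +-∸-assoc 1 j<m = *-zeroʳ (f j)
iter-psum-kernel (suc r) f m = begin
  psum (iter psum r f) m                              ≡⟨ partial-cong suc (iter-psum-kernel r f) m ⟩
  psum (λ m → ∑ (suc m) (λ j → f j * invPowS r (m ∸ j))) m  ≡⟨ go m ⟩
  ∑ (suc m) (λ j → f j * invPowS (suc r) (m ∸ j))     ∎
  where
  G : ℕ → ℕ → ℕ
  G s m = ∑ (suc m) (λ j → f j * invPowS s (m ∸ j))
  split : ∀ m j → j < suc m →
    f j * invPowS (suc r) (suc m ∸ j) ≡ f j * invPowS (suc r) (m ∸ j) + f j * invPowS r (suc m ∸ j)
  split m j (s≤s j≤m) rewrite +-∸-assoc 1 j≤m | invPowS-suc r (m ∸ j) =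
    *-distribˡ-+ (f j) (invPowS (suc r) (m ∸ j)) (invPowS r (suc (m ∸ j)))
  -- At j = m + 1 both powers are evaluated at 0, where they equal 1.
  last : ∀ m → f (suc m) * invPowS (suc r) (suc m ∸ suc m) ≡ f (suc m) * invPowS r (suc m ∸ suc m)
  last m rewrite n∸n≡0 m | invPowS-zero (suc r) | invPowS-zero r = refl
  go : ∀ m → psum (G r) m ≡ G (suc r) m
  go zero rewrite invPowS-zero (suc r) | invPowS-zero r = refl
  go (suc m) = begin
    psum (G r) m + G r (suc m)     ≡⟨ cong (_+ G r (suc m)) (go m) ⟩
    G (suc r) m + G r (suc m)      ≡⟨ +-assoc (G (suc r) m) _ _ ⟨
    G (suc r) m + ∑ (suc m) (λ j → f j * invPowS r (suc m ∸ j)) + f (suc m) * invPowS r (suc m ∸ suc m)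
      ≡⟨ cong₂ _+_ (sym (trans (∑-cong (suc m) (split m)) (∑-+ _ _ (suc m)))) (sym (last m)) ⟩
    G (suc r) (suc m)              ∎

⊛-invPowS : ∀ f r m → (f ⊛ invPowS r) m ≡ iter psum r f m
⊛-invPowS f r m = trans (⊛-∑ f (invPowS r) m) (sym (iter-psum-kernel r f m))

-- Both sides obey Pascal's rule; the exponent r + 1 keeps subtraction out of the upper index.
invPowS-C : ∀ r d → invPowS (suc r) d ≡ (r + d) C d
invPowS-C r zero = trans (invPowS-zero (suc r)) refl
invPowS-C zero (suc d) = begin
  invPowS 1 (suc d)      ≡⟨ invPowS-suc 0 d ⟩
  invPowS 1 d + 0        ≡⟨ +-identityʳ _ ⟩
  invPowS 1 d            ≡⟨ invPowS-C 0 d ⟩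
  d C d                  ≡⟨ nCn≡1 d ⟩
  1                      ≡⟨ nCn≡1 (suc d) ⟨
  suc d C suc d          ∎
invPowS-C (suc r) (suc d) = begin
  invPowS (suc (suc r)) (suc d)                   ≡⟨ invPowS-suc (suc r) d ⟩
  invPowS (suc (suc r)) d + invPowS (suc r) (suc d) ≡⟨ cong₂ _+_ (invPowS-C (suc r) d) (invPowS-C r (suc d)) ⟩
  (suc r + d) C d + (r + suc d) C suc d           ≡⟨ cong (λ z → (suc r + d) C d + z C suc d) (+-suc r d) ⟩
  (suc r + d) C d + (suc r + d) C suc d           ≡⟨ nCk+nC[k+1]≡[n+1]C[k+1] (suc r + d) d ⟩
  suc (suc r + d) C suc d                         ≡⟨ cong (_C suc d) (sym (+-suc (suc r) d)) ⟩
  (suc r + suc d) C suc d                         ∎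

-- The kernel is (x/(1-x))^{r+1}, with coefficient C(d-1, r) at x^d. Only j < m occurs, so the
-- truncated subtractions are genuine.
iter-psum<-kernel : ∀ r f m → iter psum< (suc r) f m ≡ ∑ m (λ j → f j * ((m ∸ j ∸ 1) C r))
iter-psum<-kernel zero f m = ∑-cong m (λ j _ → sym (*-identityʳ (f j)))
iter-psum<-kernel (suc r) f m = trans (partial-cong (λ m → m) (iter-psum<-kernel r f) m) (go m)
  where
  G : ℕ → ℕ → ℕ
  G s m = ∑ m (λ j → f j * ((m ∸ j ∸ 1) C s))
  split : ∀ m j → j < m →
    f j * ((suc m ∸ j ∸ 1) C suc r) ≡ f j * ((m ∸ j ∸ 1) C suc r) + f j * ((m ∸ j ∸ 1) C r)
  split (suc m) j (s≤s j≤m) rewrite +-∸-assoc 2 j≤m | +-∸-assoc 1 j≤m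
    | sym (nCk+nC[k+1]≡[n+1]C[k+1] (m ∸ j) r) =
    trans (*-distribˡ-+ (f j) ((m ∸ j) C r) _) (+-comm (f j * ((m ∸ j) C r)) _)
  -- The new index j = m adds 0 C (r + 1) = 0, so the sum may be extended to it.
  last : ∀ m → f m * ((suc m ∸ m ∸ 1) C suc r) ≡ 0
  last m rewrite +-∸-assoc 1 (≤-refl {m}) | n∸n≡0 m = *-zeroʳ (f m)
  go : ∀ m → psum< (G r) m ≡ G (suc r) m
  go zero = refl
  go (suc m) = begin
    psum< (G r) m + G r m              ≡⟨ cong (_+ G r m) (go m) ⟩
    G (suc r) m + G r m                ≡⟨ ∑-+ _ _ m ⟨
    ∑ m (λ j → f j * ((m ∸ j ∸ 1) C suc r) + f j * ((m ∸ j ∸ 1) C r))  ≡⟨ ∑-cong m (λ j j<m → sym (split m j j<m)) ⟩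
    ∑ m (λ j → f j * ((suc m ∸ j ∸ 1) C suc r))                        ≡⟨ +-identityʳ _ ⟨
    ∑ m (λ j → f j * ((suc m ∸ j ∸ 1) C suc r)) + 0                    ≡⟨ cong (∑ m (λ j → f j * ((suc m ∸ j ∸ 1) C suc r)) +_) (last m) ⟨
    G (suc r) (suc m)                  ∎

δ : ℕ → ℕ → ℕ
δ zero    zero    = 1
δ zero    (suc i) = 0
δ (suc d) zero    = 0
δ (suc d) (suc i) = δ d i

δ-suc : ∀ d → δ (suc d) ≗ shift (δ d)
δ-suc d zero    = refl
δ-suc d (suc i) = refl

iter-δ-suc : ∀ r d → iter psum r (δ (suc d)) ≗ shift (iter psum r (δ d))
iter-δ-suc r d m = trans (iter-cong suc r (δ-suc d) m) (iter-psum-shift r (δ d) m)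

iter-δ-zero : ∀ r → iter psum r (δ 0) ≗ invPowS r
iter-δ-zero zero zero    = refl
iter-δ-zero zero (suc m) = refl
iter-δ-zero (suc r) zero = trans (iter-δ-zero r 0) (trans (invPowS-zero r) (sym (invPowS-zero (suc r))))
iter-δ-zero (suc r) (suc m) =
  trans (cong₂ _+_ (iter-δ-zero (suc r) m) (iter-δ-zero r (suc m))) (sym (invPowS-suc r m))

-- The derivative of (1-x)^{-r}.
invPowS-deriv : ∀ r j → r * invPowS (suc r) j ≡ suc j * invPowS r (suc j)
invPowS-deriv zero j = sym (*-zeroʳ (suc j))
invPowS-deriv (suc r) zero = begin
  suc r * invPowS (2 + r) 0                     ≡⟨ cong (suc r *_) (invPowS-zero (2 + r)) ⟩
  suc r * 1                                     ≡⟨ cong (suc r *_) (invPowS-zero (suc r)) ⟨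
  invPowS (suc r) 0 + r * invPowS (suc r) 0     ≡⟨ cong (invPowS (suc r) 0 +_) (trans (invPowS-deriv r 0) (*-identityˡ _)) ⟩
  invPowS (suc r) 0 + invPowS r 1               ≡⟨ invPowS-suc r 0 ⟨
  invPowS (suc r) 1                             ≡⟨ *-identityˡ _ ⟨
  1 * invPowS (suc r) 1                         ∎
invPowS-deriv (suc r) (suc j) = begin
  suc r * invPowS (2 + r) (suc j)                 ≡⟨ cong (suc r *_) (invPowS-suc (suc r) j) ⟩
  suc r * (invPowS (2 + r) j + u)                 ≡⟨ *-distribˡ-+ (suc r) (invPowS (2 + r) j) u ⟩
  suc r * invPowS (2 + r) j + (u + r * u)         ≡⟨ cong₂ (λ x y → x + (u + y)) (invPowS-deriv (suc r) j) (invPowS-deriv r (suc j)) ⟩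
  suc j * u + (u + suc (suc j) * v)               ≡⟨ lemma (suc j) u v ⟩
  suc (suc j) * (u + v)                           ≡⟨ cong (suc (suc j) *_) (invPowS-suc r (suc j)) ⟨
  suc (suc j) * invPowS (suc r) (suc (suc j))     ∎
  where
  u = invPowS (suc r) (suc j)
  v = invPowS r (suc (suc j))
  lemma : ∀ j u v → j * u + (u + suc j * v) ≡ suc j * (u + v)
  lemma = solve-∀

iter-δ-deriv : ∀ r d m →
  r * iter psum (suc r) (δ d) m + d * iter psum r (δ d) (suc m) ≡ suc m * iter psum r (δ d) (suc m)
iter-δ-deriv r zero m rewrite iter-δ-zero (suc r) m | iter-δ-zero r (suc m) =
  trans (+-identityʳ _) (invPowS-deriv r m)
iter-δ-deriv r (suc d) zero rewrite iter-δ-suc (suc r) d 0 | iter-δ-suc r d 1 | *-zeroʳ r = base d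
  where
  base : ∀ d → suc d * iter psum r (δ d) 0 ≡ 1 * iter psum r (δ d) 0
  base zero    = refl
  base (suc d) rewrite iter-δ-suc r d 0 = *-zeroʳ (suc (suc d))
iter-δ-deriv r (suc d) (suc m) rewrite iter-δ-suc (suc r) d (suc m) | iter-δ-suc r d (2 + m) =
  trans (lemma (r * iter psum (suc r) (δ d) m) d (iter psum r (δ d) (suc m)))
    (cong (iter psum r (δ d) (suc m) +_) (iter-δ-deriv r d m))
  where
  lemma : ∀ a d u → a + (u + d * u) ≡ u + (a + d * u)
  lemma = solve-∀

-- x d/dx (x^d (1-x)^{-(d+e)}) = (d x^d + e x^{d+1}) (1-x)^{-(d+e+1)}
iter-δ-euler : ∀ d e {r} → d + e ≡ r → ∀ m →
  d * iter psum (suc r) (δ d) m + e * iter psum (suc r) (δ (suc d)) m ≡ m * iter psum r (δ d) m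
iter-δ-euler d e refl zero rewrite iter-δ-suc (suc (d + e)) d 0 | *-zeroʳ e = trans (+-identityʳ _) (base d (suc (d + e)))
  where
  base : ∀ d r → d * iter psum r (δ d) 0 ≡ 0
  base zero    r = refl
  base (suc d) r rewrite iter-δ-suc r d 0 = *-zeroʳ (suc d)
iter-δ-euler d e refl (suc m) rewrite iter-δ-suc (suc (d + e)) d (suc m) =
  trans (lemma d e (iter psum (suc (d + e)) (δ d) m) (iter psum (d + e) (δ d) (suc m))) (iter-δ-deriv (d + e) d m)
  where
  lemma : ∀ d e u v → d * (u + v) + e * u ≡ (d + e) * u + d * v
  lemma = solve-∀

-- Each of the t factors x is paired with one of the outer factors 1/(1-x), and x/(1-x) is `psum<`.
-- A block of t + 1 letters raises the number of ascents by at least t, which is the origin of these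
-- factors x.
iter-psum-shifts : ∀ t r x → iter psum (t + r) (δ (t + x)) ≗ iter psum< t (iter psum r (δ x))
iter-psum-shifts zero    r x m = refl
iter-psum-shifts (suc t) r x m = begin
  psum (iter psum (t + r) (δ (suc (t + x)))) m      ≡⟨ partial-cong suc (iter-δ-suc (t + r) (t + x)) m ⟩
  psum (shift (iter psum (t + r) (δ (t + x)))) m    ≡⟨ psum-shift _ m ⟩
  psum< (iter psum (t + r) (δ (t + x))) m           ≡⟨ partial-cong (λ m → m) (iter-psum-shifts t r x) m ⟩
  psum< (iter psum< t (iter psum r (δ x))) m        ∎

-- Words and insertion of the largest letter

≡ᵇ-refl : ∀ v → (v ≡ᵇ v) ≡ true
≡ᵇ-refl zero    = refl
≡ᵇ-refl (suc v) = ≡ᵇ-refl v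

≢⇒≡ᵇ-false : ∀ {x v} → x ≢ v → (x ≡ᵇ v) ≡ false
≢⇒≡ᵇ-false {x} {v} ne with x ≡ᵇ v in eq
... | false = refl
... | true  = ⊥-elim (ne (≡ᵇ⇒≡ x v (subst T (sym eq) _)))

≮⇒<ᵇ-false : ∀ {x v} → ¬ x < v → (x <ᵇ v) ≡ false
≮⇒<ᵇ-false {x} {v} nlt with x <ᵇ v in eq
... | false = refl
... | true  = ⊥-elim (nlt (<ᵇ⇒< x v (subst T (sym eq) _)))

<⇒<ᵇ-true : ∀ {x v} → x < v → (x <ᵇ v) ≡ true
<⇒<ᵇ-true {x} {v} lt with x <ᵇ v | <⇒<ᵇ lt
... | true | _ = refl

count : ℕ → List ℕ → ℕ
count v = countᵇ (λ x → x ≡ᵇ v)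

count-≡ : ∀ {x} w → count x (x ∷ w) ≡ suc (count x w)
count-≡ {x} w rewrite ≡ᵇ-refl x = refl

count-≢ : ∀ {x v} w → x ≢ v → count v (x ∷ w) ≡ count v w
count-≢ w ne rewrite ≢⇒≡ᵇ-false ne = refl

count-absent : ∀ {v w} → All (_≢ v) w → count v w ≡ 0
count-absent [] = refl
count-absent {v} {x ∷ w} (ne ∷ nes) = trans (count-≢ w ne) (count-absent nes)

count-++ : ∀ v xs ys → count v (xs ++ ys) ≡ count v xs + count v ys
count-++ v [] ys = refl
count-++ v (x ∷ xs) ys with x ≟ v
... | yes refl = trans (count-≡ (xs ++ ys)) (trans (cong suc (count-++ v xs ys)) (cong (_+ count v ys) (sym (count-≡ xs))))
... | no ne = trans (count-≢ (xs ++ ys) ne) (trans (count-++ v xs ys) (cong (_+ count v ys) (sym (count-≢ xs ne))))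

count-replicate : ∀ v t → count v (replicate t v) ≡ t
count-replicate v zero    = refl
count-replicate v (suc t) = trans (count-≡ (replicate t v)) (cong suc (count-replicate v t))

-- Together with `firstIndex` this inverts the insertion of a block of copies of v.
rem : ℕ → List ℕ → List ℕ
rem v []       = []
rem v (x ∷ w) = if x ≡ᵇ v then rem v w else x ∷ rem v w

firstIndex : ℕ → List ℕ → ℕ
firstIndex v []       = 0
firstIndex v (x ∷ w) = if x ≡ᵇ v then 0 else suc (firstIndex v w)

-- For p beyond the end of the word the block is appended.
ins : ℕ → List ℕ → List ℕ → List ℕ
ins zero    blk w       = blk ++ w
ins (suc p) blk []      = blk ++ []
ins (suc p) blk (x ∷ w) = x ∷ ins p blk w

rem-≡ : ∀ v w → rem v (v ∷ w) ≡ rem v w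
rem-≡ v w rewrite ≡ᵇ-refl v = refl

rem-≢ : ∀ {x v} w → x ≢ v → rem v (x ∷ w) ≡ x ∷ rem v w
rem-≢ w ne rewrite ≢⇒≡ᵇ-false ne = refl

rem-absent : ∀ {v w} → All (_≢ v) w → rem v w ≡ w
rem-absent [] = refl
rem-absent {v} {x ∷ w} (ne ∷ nes) = trans (rem-≢ w ne) (cong (x ∷_) (rem-absent nes))

rem-⊆ : ∀ v w → rem v w ⊆ w
rem-⊆ v [] = []
rem-⊆ v (x ∷ w) with x ≡ᵇ v
... | true  = x ∷ʳ rem-⊆ v w
... | false = refl ∷ rem-⊆ v w

rem-All-≢ : ∀ v w → All (_≢ v) (rem v w)
rem-All-≢ v [] = []
rem-All-≢ v (x ∷ w) with x ≟ v
... | yes refl rewrite ≡ᵇ-refl v = rem-All-≢ v w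
... | no ne rewrite ≢⇒≡ᵇ-false ne = ne ∷ rem-All-≢ v w

-- A pattern without the letter v survives the deletion of v; hence a forbidden pattern in a word
-- with an inserted block of v was already present before the insertion.
rem-mono : ∀ {v ps w} → All (_≢ v) ps → ps ⊆ w → ps ⊆ rem v w
rem-mono [] _ = minimum _
rem-mono {v} ne@(_ ∷ _) (y ∷ʳ s) with y ≡ᵇ v
... | true  = rem-mono ne s
... | false = y ∷ʳ rem-mono ne s
rem-mono (ne ∷ nes) (refl ∷ s) rewrite ≢⇒≡ᵇ-false ne = refl ∷ rem-mono nes s

count-rem : ∀ {u v} w → u ≢ v → count u (rem v w) ≡ count u w
count-rem [] ne = refl
count-rem {u} {v} (x ∷ w) ne with x ≟ v
... | yes refl rewrite rem-≡ v w = trans (count-rem w ne) (sym (count-≢ w (ne ∘ sym)))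
... | no x≢v rewrite rem-≢ w x≢v with x ≟ u
...   | yes refl = trans (count-≡ (rem v w)) (trans (cong suc (count-rem w ne)) (sym (count-≡ w)))
...   | no x≢u = trans (count-≢ (rem v w) x≢u) (trans (count-rem w ne) (sym (count-≢ w x≢u)))

length-ins : ∀ p blk w → length (ins p blk w) ≡ length blk + length w
length-ins zero    blk w       = length-++ blk
length-ins (suc p) blk []      = length-++ blk
length-ins (suc p) blk (x ∷ w) = trans (cong suc (length-ins p blk w)) (sym (+-suc (length blk) (length w)))

rem-replicate-++ : ∀ v t w → rem v (replicate t v ++ w) ≡ rem v w
rem-replicate-++ v zero    w = refl
rem-replicate-++ v (suc t) w = trans (rem-≡ v (replicate t v ++ w)) (rem-replicate-++ v t w)

rem-ins : ∀ {v w} p t → All (_≢ v) w → rem v (ins p (replicate t v) w) ≡ w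
rem-ins {v} {w} zero t ne = trans (rem-replicate-++ v t w) (rem-absent ne)
rem-ins {v} {[]} (suc p) t ne = rem-replicate-++ v t []
rem-ins {v} {x ∷ w} (suc p) t (ne ∷ nes) =
  trans (rem-≢ (ins p (replicate t v) w) ne) (cong (x ∷_) (rem-ins p t nes))

firstIndex-ins : ∀ {v w} p t → All (_≢ v) w → p ≤ length w → firstIndex v (ins p (replicate (suc t) v) w) ≡ p
firstIndex-ins {v} zero t ne _ rewrite ≡ᵇ-refl v = refl
firstIndex-ins {v} {x ∷ w} (suc p) t (ne ∷ nes) (s≤s le) rewrite ≢⇒≡ᵇ-false ne = cong suc (firstIndex-ins p t nes le)

firstIndex-≤ : ∀ v w → firstIndex v w ≤ length (rem v w)
firstIndex-≤ v [] = z≤n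
firstIndex-≤ v (x ∷ w) with x ≡ᵇ v
... | true  = z≤n
... | false = s≤s (firstIndex-≤ v w)

ins-⊇ : ∀ p blk w → w ⊆ ins p blk w
ins-⊇ zero [] w = ⊆-refl
ins-⊇ zero (x ∷ blk) w = x ∷ʳ ins-⊇ zero blk w
ins-⊇ (suc p) blk [] = minimum _
ins-⊇ (suc p) blk (x ∷ w) = refl ∷ ins-⊇ p blk w

count-ins-self : ∀ {v w} p t → All (_≢ v) w → count v (ins p (replicate t v) w) ≡ t
count-ins-self {v} {w} zero t ne = trans (count-++ v (replicate t v) w)
  (trans (cong₂ _+_ (count-replicate v t) (count-absent ne)) (+-identityʳ t))
count-ins-self {v} {[]} (suc p) t ne = trans (cong (count v) (++-identityʳ (replicate t v))) (count-replicate v t)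
count-ins-self {v} {x ∷ w} (suc p) t (ne ∷ nes) = trans (count-≢ (ins p (replicate t v) w) ne) (count-ins-self p t nes)

All-ins : ∀ {P : ℕ → Set} {v w} p t → P v → All P w → All P (ins p (replicate t v) w)
All-ins zero    t pv pw        = All.++⁺ (All.replicate⁺ t pv) pw
All-ins (suc p) t pv []        = All.++⁺ (All.replicate⁺ t pv) []
All-ins (suc p) t pv (px ∷ pw) = px ∷ All-ins p t pv pw

⊆-All : ∀ {P : ℕ → Set} {xs ys} → xs ⊆ ys → All P ys → All P xs
⊆-All [] [] = []
⊆-All (y ∷ʳ s) (p ∷ ps) = ⊆-All s ps
⊆-All (refl ∷ s) (p ∷ ps) = p ∷ ⊆-All s ps

block-head : ∀ {v b w} t → b ≢ v → All (_≢ v) w → ¬ (b ∷ v ∷ [] ⊆ replicate t v ++ w)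
block-head zero ne nes s with ⊆-All s nes
... | _ ∷ vv ∷ [] = vv refl
block-head (suc t) ne nes (_ ∷ʳ s) = block-head t ne nes s
block-head (suc t) ne nes (refl ∷ s) = ne refl

block-avoids-++ : ∀ {v b w} t → b ≢ v → All (_≢ v) w → ¬ (v ∷ b ∷ v ∷ [] ⊆ replicate t v ++ w)
block-avoids-++ zero ne nes s with ⊆-All s nes
... | vv ∷ _ = vv refl
block-avoids-++ (suc t) ne nes (_ ∷ʳ s)   = block-avoids-++ t ne nes s
block-avoids-++ (suc t) ne nes (refl ∷ s) = block-head t ne nes s

-- All copies of v lie in the inserted block, and between two letters of the block there is only v
-- itself.
block-avoids : ∀ {v b w} p t → b ≢ v → All (_≢ v) w → ¬ (v ∷ b ∷ v ∷ [] ⊆ ins p (replicate t v) w)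
block-avoids zero t ne nes s = block-avoids-++ t ne nes s
block-avoids {w = []} (suc p) t ne nes s = block-avoids-++ t ne nes s
block-avoids {w = x ∷ w} (suc p) t ne (x≢v ∷ nes) (_ ∷ʳ s) = block-avoids p t ne nes s
block-avoids {w = x ∷ w} (suc p) t ne (x≢v ∷ nes) (refl ∷ s) = x≢v refl

present-⊆ : ∀ {v t} w → count v w ≡ suc t → v ∷ [] ⊆ w
present-⊆ {v} (x ∷ w) c with x ≟ v
... | yes refl = refl ∷ minimum w
... | no ne = x ∷ʳ present-⊆ w (trans (sym (count-≢ w ne)) c)

-- This is the situation behind the first v: no smaller letter may precede another v there, so all
-- remaining copies come at the front.
block-run : ∀ {v} w → All (_≤ v) w → (∀ {b} → b < v → ¬ (b ∷ v ∷ [] ⊆ w)) →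
  replicate (count v w) v ++ rem v w ≡ w
block-run [] le av = refl
block-run {v} (x ∷ w) (x≤v ∷ le) av with x ≟ v
... | yes refl rewrite ≡ᵇ-refl x = cong (x ∷_) (block-run w le (λ b<v s → av b<v (x ∷ʳ s)))
... | no ne rewrite ≢⇒≡ᵇ-false ne with count v w in eq | block-run w le (λ b<v s → av b<v (x ∷ʳ s))
...   | zero  | ih = cong (x ∷_) ih
...   | suc _ | _  = ⊥-elim (av (≤∧≢⇒< x≤v ne) (refl ∷ present-⊆ w eq))

-- The copies of the largest letter v are adjacent, since only letters ≥ v may stand between two of them.
ins-rem : ∀ {v} w t → All (_≤ v) w → (∀ {b} → b < v → ¬ (v ∷ b ∷ v ∷ [] ⊆ w)) → count v w ≡ suc t →
  ins (firstIndex v w) (replicate (suc t) v) (rem v w) ≡ w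
ins-rem {v} (x ∷ w) t (x≤v ∷ le) av c with x ≟ v
... | yes refl rewrite ≡ᵇ-refl x =
  cong (x ∷_) (trans (cong (λ u → replicate u x ++ rem x w) (sym (suc-injective c)))
    (block-run w le (λ b<v s → av b<v (refl ∷ s))))
... | no ne rewrite ≢⇒≡ᵇ-false ne =
  cong (x ∷_) (ins-rem w t le (λ b<v s → av b<v (x ∷ʳ s)) c)

-- The condition on indices becomes avoidance of the sublists a b a with b < a, which passes easily
-- through insertion and deletion. The length is omitted because it follows from the counts.
record Stirling (n : ℕ) (cnt : ℕ → ℕ) (w : List ℕ) : Set where
  constructor stirling
  field
    counts  : ∀ v → InRange n v → count v w ≡ cnt v
    inRange : All (InRange n) w
    avoids  : ∀ {a b} → b < a → ¬ (a ∷ b ∷ a ∷ [] ⊆ w)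
open Stirling public

top-absent : ∀ {n w} → All (InRange n) w → All (_≢ suc n) w
top-absent = All.map (λ { (_ , le) refl → 1+n≰n le })

stirling-ins : ∀ {n cnt w} p → Stirling n cnt w → Stirling (suc n) cnt (ins p (replicate (cnt (suc n)) (suc n)) w)
stirling-ins {n} {cnt} {w} p s = stirling cs
  (All-ins p (cnt (suc n)) (s≤s z≤n , ≤-refl) (All.map (λ { (l , u) → l , m≤n⇒m≤1+n u }) (inRange s)))
  av
  where
  absent = top-absent (inRange s)
  W = ins p (replicate (cnt (suc n)) (suc n)) w
  remW : rem (suc n) W ≡ w
  remW = rem-ins p (cnt (suc n)) absent
  cs : ∀ v → InRange (suc n) v → count v W ≡ cnt v
  cs v (l , u) with v ≟ suc n
  ... | yes refl = count-ins-self p (cnt (suc n)) absent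
  ... | no ne = trans (sym (count-rem W ne)) (trans (cong (count v) remW) (counts s v (l , m<1+n⇒m≤n (≤∧≢⇒< u ne))))
  av : ∀ {a b} → b < a → ¬ (a ∷ b ∷ a ∷ [] ⊆ W)
  -- For a = n + 1 the letter b would have to split the block. Otherwise no letter of the pattern is
  -- n + 1, and it survives in the old word.
  av {a} {b} b<a sub with a ≟ suc n
  ... | yes refl = block-avoids p (cnt (suc n)) (<⇒≢ b<a) absent sub
  ... | no ne = avoids s b<a (subst (_ ⊆_) remW (rem-mono (ne ∷ b≢ ∷ ne ∷ []) sub))
    where
    a≤ : a ≤ suc n
    a≤ with ⊆-All sub (All-ins p (cnt (suc n)) ≤-refl (All.map (λ { (_ , u) → m≤n⇒m≤1+n u }) (inRange s)))
    ... | le ∷ _ = le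
    b≢ : b ≢ suc n
    b≢ refl = <⇒≱ b<a a≤

stirling-rem : ∀ {n cnt w} → Stirling (suc n) cnt w → Stirling n cnt (rem (suc n) w)
stirling-rem {n} {cnt} {w} s = stirling
  (λ { v (l , u) → trans (count-rem w (λ { refl → 1+n≰n u })) (counts s v (l , m≤n⇒m≤1+n u)) })
  (All.zipWith (λ { ((l , u) , ne) → l , m<1+n⇒m≤n (≤∧≢⇒< u ne) }) (⊆-All (rem-⊆ (suc n) w) (inRange s) , rem-All-≢ (suc n) w))
  (λ b<a sub → avoids s b<a (⊆-trans sub (rem-⊆ (suc n) w)))

stirling-ins-rem : ∀ {n cnt w} → 1 ≤ cnt (suc n) → Stirling (suc n) cnt w →
  ins (firstIndex (suc n) w) (replicate (cnt (suc n)) (suc n)) (rem (suc n) w) ≡ w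
stirling-ins-rem {n} {cnt} {w} pos s with cnt (suc n) | counts s (suc n) (s≤s z≤n , ≤-refl)
stirling-ins-rem {n} {cnt} {w} (s≤s _) s | suc t | c =
  ins-rem w t (All.map proj₂ (inRange s)) (avoids s) c

stirling-zero : ∀ {cnt w} → Stirling 0 cnt w → w ≡ []
stirling-zero {w = []} s = refl
stirling-zero {w = x ∷ w} s with inRange s
... | (l , u) ∷ _ = ⊥-elim (1+n≰n (≤-trans l u))

[]-stirling : ∀ {cnt} → Stirling 0 cnt []
[]-stirling = stirling (λ { v (l , u) → ⊥-elim (1+n≰n (≤-trans l u)) }) [] (λ _ ())

-- Stirling permutations and descents

T-∧⁺ : ∀ {x y} → T x → T y → T (x ∧ y)
T-∧⁺ p q = Equivalence.from T-∧ (p , q)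

T-∧⁻ : ∀ {x y} → T (x ∧ y) → T x × T y
T-∧⁻ = Equivalence.to T-∧

T-all⁻ : {A : Set} {P : A → Set} {xs : List A} (p : A → Bool) → Enumerates P xs →
  T (all p xs) → ∀ {x} → P x → T (p x)
T-all⁻ p e t q = All.lookup (All.all⁺ p _ t) (Enumerates.complete e q)

T-all⁺ : {A : Set} {P : A → Set} {xs : List A} (p : A → Bool) → Enumerates P xs →
  (∀ {x} → P x → T (p x)) → T (all p xs)
T-all⁺ p e f = All.all⁻ p (All.tabulate (f ∘ Enumerates.sound e))

T-not∨⁻ : ∀ {x y} → T (not x ∨ y) → T x → T y
T-not∨⁻ {true} t _ = t

T-not∨⁺ : ∀ {x y} → (T x → T y) → T (not x ∨ y)
T-not∨⁺ {true}  f = f _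
T-not∨⁺ {false} f = _

at-⊆₁ : ∀ w {j} → j < length w → at w j ∷ [] ⊆ w
at-⊆₁ (x ∷ w) {zero}  _ = refl ∷ minimum w
at-⊆₁ (x ∷ w) {suc j} (s≤s lt) = x ∷ʳ at-⊆₁ w lt

at-⊆₂ : ∀ w {i j} → i < j → j < length w → at w i ∷ at w j ∷ [] ⊆ w
at-⊆₂ (x ∷ w) {zero}  {suc j} _        (s≤s lt) = refl ∷ at-⊆₁ w lt
at-⊆₂ (x ∷ w) {suc i} {suc j} (s≤s ij) (s≤s lt) = x ∷ʳ at-⊆₂ w ij lt

at-⊆₃ : ∀ w {i s j} → i < s → s < j → j < length w → at w i ∷ at w s ∷ at w j ∷ [] ⊆ w
at-⊆₃ (x ∷ w) {zero}  {suc s} {suc j} _        (s≤s sj) (s≤s lt) = refl ∷ at-⊆₂ w sj lt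
at-⊆₃ (x ∷ w) {suc i} {suc s} {suc j} (s≤s is) (s≤s sj) (s≤s lt) = x ∷ʳ at-⊆₃ w is sj lt

⊆-at₁ : ∀ {c w} → c ∷ [] ⊆ w → ∃ λ j → j < length w × at w j ≡ c
⊆-at₁ (y ∷ʳ s) = let (j , lt , eq) = ⊆-at₁ s in suc j , s≤s lt , eq
⊆-at₁ (refl ∷ s) = 0 , s≤s z≤n , refl

⊆-at₂ : ∀ {b c w} → b ∷ c ∷ [] ⊆ w → ∃₂ λ i j → i < j × j < length w × at w i ≡ b × at w j ≡ c
⊆-at₂ (y ∷ʳ s) = let (i , j , ij , lt , eqs) = ⊆-at₂ s in suc i , suc j , s≤s ij , s≤s lt , eqs
⊆-at₂ (refl ∷ s) = let (j , lt , eq) = ⊆-at₁ s in 0 , suc j , s≤s z≤n , s≤s lt , refl , eq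

⊆-at₃ : ∀ {a b c w} → a ∷ b ∷ c ∷ [] ⊆ w →
  ∃₂ λ i s → ∃ λ j → i < s × s < j × j < length w × at w i ≡ a × at w s ≡ b × at w j ≡ c
⊆-at₃ (y ∷ʳ p) = let (i , s , j , is , sj , lt , eqs) = ⊆-at₃ p in
  suc i , suc s , suc j , s≤s is , s≤s sj , s≤s lt , eqs
⊆-at₃ (refl ∷ p) = let (s , j , sj , lt , eqs) = ⊆-at₂ p in
  0 , suc s , suc j , s≤s z≤n , s≤s sj , s≤s lt , refl , eqs

stirlingCond⇒avoids : ∀ w → T (stirlingCond w) → ∀ {a b} → b < a → ¬ (a ∷ b ∷ a ∷ [] ⊆ w)
stirlingCond⇒avoids w t {a} {b} b<a sub with ⊆-at₃ sub
... | i , s , j , is , sj , lt , refl , refl , eq =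
  <⇒≱ b<a (≤ᵇ⇒≤ _ _ (T-not∨⁻
    (T-all⁻ _ up (T-all⁻ _ up (T-all⁻ _ up t (<-trans is (<-trans sj lt))) (<-trans sj lt)) lt)
    (T-∧⁺ (<⇒<ᵇ is) (T-∧⁺ (<⇒<ᵇ sj) (≡⇒≡ᵇ _ _ (sym eq))))))
  where up = enumerates-upTo (length w)

avoids⇒stirlingCond : ∀ w → (∀ {a b} → b < a → ¬ (a ∷ b ∷ a ∷ [] ⊆ w)) → T (stirlingCond w)
avoids⇒stirlingCond w av =
  T-all⁺ _ up λ {i} _ → T-all⁺ _ up λ {s} _ → T-all⁺ _ up λ {j} j< → T-not∨⁺ λ t →
    let (is , t') = T-∧⁻ {i <ᵇ s} t
        (sj , eq) = T-∧⁻ {s <ᵇ j} t' in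
    ≤⇒≤ᵇ (≮⇒≥ λ lt → av lt (subst (λ c → at w i ∷ at w s ∷ c ∷ [] ⊆ w) (sym (≡ᵇ⇒≡ (at w i) (at w j) eq))
      (at-⊆₃ w (<ᵇ⇒< i s is) (<ᵇ⇒< s j sj) j<)))
  where up = enumerates-upTo (length w)

stirlings : (ℕ → ℕ) → ℕ → List (List ℕ)
stirlings cnt zero    = [] ∷ []
stirlings cnt (suc n) =
  concatMap (λ w → map (λ p → ins p (replicate (cnt (suc n)) (suc n)) w) (upTo (suc (length w)))) (stirlings cnt n)

-- Deleting n + 1 recovers the word and its first occurrence recovers the gap. The latter needs at
-- least one inserted letter, hence positive counts.
enumerates-stirlings : ∀ cnt n → (∀ v → InRange n v → 1 ≤ cnt v) → Enumerates (Stirling n cnt) (stirlings cnt n)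
enumerates-stirlings cnt zero pos = enum ([] ∷ []) (λ { (here refl) → []-stirling })
  (λ s → here (stirling-zero s))
enumerates-stirlings cnt (suc n) pos = enumerates-cong to from
  -- The relation repeats `Stirling n cnt w`: only for such `w` does deletion undo the insertion,
  -- which makes the base word unique.
  (enumerates-concatMap {Q = λ w b → Stirling n cnt w × ∃ λ p → p < suc (length w) × b ≡ ins' p w} _
    (λ { (s , p , _ , refl) (s' , p' , _ , eq) → trans (sym (rem-ins' p s)) (trans (cong (rem (suc n)) eq) (rem-ins' p' s')) })
    (enumerates-stirlings cnt n (λ { v (l , u) → pos v (l , m≤n⇒m≤1+n u) }))
    (λ {w} s → enumerates-cong (s ,_) proj₂
      (enumerates-map (λ p → ins' p w)
        (λ { {p} {q} (s≤s p≤) (s≤s q≤) eq → trans (sym (first p s p≤)) (trans (cong (firstIndex (suc n)) eq) (first q s q≤)) })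
        (enumerates-upTo (suc (length w))))))
  where
  ins' : ℕ → List ℕ → List ℕ
  ins' p w = ins p (replicate (cnt (suc n)) (suc n)) w
  pos' : 1 ≤ cnt (suc n)
  pos' = pos (suc n) (s≤s z≤n , ≤-refl)
  rem-ins' : ∀ {w} p → Stirling n cnt w → rem (suc n) (ins' p w) ≡ w
  rem-ins' p s = rem-ins p (cnt (suc n)) (top-absent (inRange s))
  first : ∀ {w} p → Stirling n cnt w → p ≤ length w → firstIndex (suc n) (ins' p w) ≡ p
  first p s le with cnt (suc n) | pos'
  ... | suc t | _ = firstIndex-ins p t (top-absent (inRange s)) le
  to : ∀ {b} → (∃ λ w → Stirling n cnt w × Stirling n cnt w × ∃ λ p → p < suc (length w) × b ≡ ins' p w) → Stirling (suc n) cnt b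
  to (w , s , _ , p , _ , refl) = stirling-ins p s
  from : ∀ {b} → Stirling (suc n) cnt b → (∃ λ w → Stirling n cnt w × Stirling n cnt w × ∃ λ p → p < suc (length w) × b ≡ ins' p w)
  from {b} s = rem (suc n) b , stirling-rem s , stirling-rem s , firstIndex (suc n) b , s≤s (firstIndex-≤ (suc n) b) ,
    sym (stirling-ins-rem pos' s)

stirling-length : ∀ {cnt} n {w} → (∀ v → InRange n v → 1 ≤ cnt v) → Stirling n cnt w → length w ≡ ∑ n (cnt ∘ suc)
stirling-length zero pos s rewrite stirling-zero s = refl
stirling-length {cnt} (suc n) {w} pos s = begin
  length w                                 ≡⟨ cong length (stirling-ins-rem (pos (suc n) (s≤s z≤n , ≤-refl)) s) ⟨
  length (ins (firstIndex (suc n) w) blk (rem (suc n) w))  ≡⟨ length-ins (firstIndex (suc n) w) blk (rem (suc n) w) ⟩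
  length blk + length (rem (suc n) w)      ≡⟨ cong₂ _+_ (length-replicate (cnt (suc n)))
                                                (stirling-length n (λ { v (l , u) → pos v (l , m≤n⇒m≤1+n u) }) (stirling-rem s)) ⟩
  cnt (suc n) + ∑ n (cnt ∘ suc)            ≡⟨ +-comm (cnt (suc n)) _ ⟩
  ∑ (suc n) (cnt ∘ suc)                    ∎
  where blk = replicate (cnt (suc n)) (suc n)

-- Descents and ascents under insertion

indicator : Bool → ℕ
indicator true  = 1
indicator false = 0

countᵇ-sum : {A : Set} (p : A → Bool) (xs : List A) → countᵇ p xs ≡ sum (map (indicator ∘ p) xs)
countᵇ-sum p [] = refl
countᵇ-sum p (x ∷ xs) with p x
... | true  = cong suc (countᵇ-sum p xs)
... | false = countᵇ-sum p xs

sum-range : ∀ f n → sum (map f (range n)) ≡ ∑ n (f ∘ suc)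
sum-range f n = trans (cong sum (sym (map-∘ (upTo n)))) (sum-upTo (f ∘ suc) n)

-- Every gap is one of the two: the gap behind a nonempty word is a descent, the gap in front an
-- ascent, and so is the only gap of the empty word. An inner gap between equal letters counts as an
-- ascent.
desc asc : List ℕ → ℕ
desc []          = 0
desc (x ∷ [])    = 1
desc (x ∷ y ∷ w) = indicator (y <ᵇ x) + desc (y ∷ w)
asc []          = 1
asc (x ∷ [])    = 1
asc (x ∷ y ∷ w) = indicator (not (y <ᵇ x)) + asc (y ∷ w)

desc+asc : ∀ w → desc w + asc w ≡ suc (length w)
desc+asc [] = refl
desc+asc (x ∷ []) = refl
desc+asc (x ∷ y ∷ w) = trans (step (y <ᵇ x) (desc (y ∷ w)) (asc (y ∷ w))) (cong suc (desc+asc (y ∷ w)))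
  where
  step : ∀ b d a → (indicator b + d) + (indicator (not b) + a) ≡ suc (d + a)
  step true  d a = refl
  step false d a = +-suc d a

descents≡desc : ∀ w → descents w ≡ desc w
descents≡desc w = trans (countᵇ-sum _ (range (length w))) (trans (sum-range _ (length w)) (go w))
  where
  isDescent : List ℕ → ℕ → Bool
  isDescent w i = ((suc i <ᵇ length w) ∧ (at w (suc i) <ᵇ at w i)) ∨ (suc i ≡ᵇ length w)
  go : ∀ w → ∑ (length w) (indicator ∘ isDescent w) ≡ desc w
  go [] = refl
  go (x ∷ []) = refl
  go (x ∷ y ∷ w) = trans (∑-suc (indicator ∘ isDescent (x ∷ y ∷ w)) (length (y ∷ w)))
    (cong₂ _+_ (first (y <ᵇ x)) (go (y ∷ w)))
    where
    first : ∀ b → indicator (b ∨ false) ≡ indicator b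
    first true  = refl
    first false = refl

desc-block-++ : ∀ {v w} t → All (_< v) w → desc (replicate (suc t) v ++ w) ≡ suc (desc w)
desc-block-++ zero [] = refl
desc-block-++ zero (y<v ∷ lt) rewrite <⇒<ᵇ-true y<v = refl
desc-block-++ {v} {w} (suc t) lt rewrite ≮⇒<ᵇ-false (<-irrefl {v} refl) = desc-block-++ t lt

desc-∷-block : ∀ {v w x} t → x < v → All (_< v) w → desc (x ∷ replicate (suc t) v ++ w) ≡ suc (desc w)
desc-∷-block t x<v lt rewrite ≮⇒<ᵇ-false (<-asym x<v) = desc-block-++ t lt

desc-ins-≤ : ∀ {v w} p t → All (_< v) w → desc (ins p (replicate (suc t) v) w) ≤ suc (desc w)
desc-ins-≤ zero t lt = ≤-reflexive (desc-block-++ t lt)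
desc-ins-≤ {w = []} (suc p) t lt = ≤-reflexive (desc-block-++ t lt)
desc-ins-≤ {w = x ∷ []} (suc zero) t (x<v ∷ lt) = ≤-trans (≤-reflexive (desc-∷-block t x<v lt)) (s≤s z≤n)
desc-ins-≤ {w = x ∷ []} (suc (suc p)) t (x<v ∷ lt) = ≤-trans (≤-reflexive (desc-∷-block t x<v lt)) (s≤s z≤n)
desc-ins-≤ {w = x ∷ y ∷ w} (suc zero) t (x<v ∷ lt) = ≤-trans (≤-reflexive (desc-∷-block t x<v lt)) (s≤s (m≤n+m _ _))
desc-ins-≤ {w = x ∷ y ∷ w} (suc (suc p)) t (x<v ∷ lt) =
  ≤-trans (+-monoʳ-≤ (indicator (y <ᵇ x)) (desc-ins-≤ {w = y ∷ w} (suc p) t lt)) (≤-reflexive (+-suc _ _))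

-- Inserting the block into a descent gap preserves the number of descents, any other gap adds one.
∑-desc-ins : ∀ {v w} t (f : ℕ → ℕ) → All (_< v) w →
  ∑ (suc (length w)) (λ p → f (desc (ins p (replicate (suc t) v) w))) ≡ desc w * f (desc w) + asc w * f (suc (desc w))
∑-desc-ins {v} t f [] = trans (cong f (desc-block-++ {v} t [])) (sym (+-identityʳ _))
∑-desc-ins {v} {x ∷ []} t f (x<v ∷ [])
  rewrite desc-block-++ t (x<v ∷ []) | desc-∷-block {w = []} t x<v [] = lemma (f 1) (f 2)
  where
  lemma : ∀ a b → b + a ≡ a + 0 + (b + 0)
  lemma = solve-∀
∑-desc-ins {v} {x ∷ y ∷ w} t f (x<v ∷ lt) = begin
  ∑ (suc (suc (suc (length w)))) F                 ≡⟨ ∑-suc F (suc (suc (length w))) ⟩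
  F 0 + ∑ (suc (suc (length w))) (F ∘ suc)         ≡⟨ cong (F 0 +_) (∑-suc (F ∘ suc) (suc (length w))) ⟩
  F 0 + (F 1 + X)                                  ≡⟨ cong₂ (λ a b → a + (b + X)) (cong f (desc-block-++ t (x<v ∷ lt))) (cong f (desc-∷-block t x<v lt)) ⟩
  f (suc (c + D)) + (f (suc D) + X)                ≡⟨ finish (y <ᵇ x) f X ih ⟩
  (c + D) * f (c + D) + (indicator (not (y <ᵇ x)) + A) * f (suc (c + D)) ∎
  where
  c = indicator (y <ᵇ x)
  D = desc (y ∷ w)
  A = asc (y ∷ w)
  blk = replicate (suc t) v
  F : ℕ → ℕ
  F p = f (desc (ins p blk (x ∷ y ∷ w)))
  X = ∑ (suc (length w)) (F ∘ suc ∘ suc)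
  -- The induction hypothesis for `f ∘ (c +_)` on `y ∷ w`, where c accounts for the pair x, y. Its
  -- first gap gives the extra term; its other gaps are those summed in X. For the whole word the
  -- first gap of `y ∷ w` is the one between x and y, which gives a different value.
  ih : f (c + suc D) + X ≡ D * f (c + D) + A * f (c + suc D)
  ih = trans (cong (_+ X) (cong (λ d → f (c + d)) (sym (desc-block-++ t lt))))
    (trans (sym (∑-suc (λ p → f (c + desc (ins p blk (y ∷ w)))) (suc (length w))))
      (∑-desc-ins t (f ∘ (c +_)) lt))
  finish : ∀ b (f : ℕ → ℕ) X → f (indicator b + suc D) + X ≡ D * f (indicator b + D) + A * f (indicator b + suc D) →
    f (suc (indicator b + D)) + (f (suc D) + X) ≡ (indicator b + D) * f (indicator b + D) + (indicator (not b) + A) * f (suc (indicator b + D))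
  finish false f X eq = trans (cong (f (suc D) +_) eq) (lemma (f (suc D)) (D * f D) A)
    where
    lemma : ∀ a b c → a + (b + c * a) ≡ b + (a + c * a)
    lemma = solve-∀
  finish true f X eq = trans (lemma₁ (f (suc (suc D))) (f (suc D)) X) (trans (cong (f (suc D) +_) eq) (sym (+-assoc (f (suc D)) _ _)))
    where
    lemma₁ : ∀ a b c → a + (b + c) ≡ b + (a + c)
    lemma₁ = solve-∀

-- The recurrences for B and b

memb⇒∈ : ∀ x xs → T (memb x xs) → x ∈ xs
memb⇒∈ x xs t = Any.map (≡ᵇ⇒≡ x _) (Any.any⁻ (x ≡ᵇ_) xs t)

∈⇒memb : ∀ {x xs} → x ∈ xs → T (memb x xs)
∈⇒memb {x} x∈ = Any.any⁺ (x ≡ᵇ_) (Any.map (≡⇒≡ᵇ x _) x∈)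

at1-positive : ∀ {k} → All (1 ≤_) k → ∀ v → InRange (length k) v → 1 ≤ at1 k v
at1-positive (p ∷ ps) (suc zero)    _               = p
at1-positive (p ∷ ps) (suc (suc v)) (_ , s≤s le) = at1-positive ps (suc v) (s≤s z≤n , le)

∑-at : ∀ k → ∑ (length k) (at k) ≡ sum k
∑-at []      = refl
∑-at (x ∷ k) = trans (∑-suc (at (x ∷ k)) (length k)) (cong (x +_) (∑-at k))

isStirlingPerm⇒Stirling : ∀ k w → T (isStirlingPerm k w) → Stirling (length k) (at1 k) w
isStirlingPerm⇒Stirling k w t =
  let (_ , t₁)  = T-∧⁻ {length w ≡ᵇ sum k} t
      (c , t₂)  = T-∧⁻ {all _ (range (length k))} t₁
      (r , st)  = T-∧⁻ {all (λ x → memb x (range (length k))) w} t₂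
  in stirling
    (λ v v∈ → ≡ᵇ⇒≡ _ _ (T-all⁻ _ (enumerates-range (length k)) c v∈))
    (All.map (λ {x} m → Enumerates.sound (enumerates-range (length k)) (memb⇒∈ x (range (length k)) m)) (All.all⁺ _ w r))
    (stirlingCond⇒avoids w st)

Stirling⇒isStirlingPerm : ∀ {k w} → All (1 ≤_) k → Stirling (length k) (at1 k) w → T (isStirlingPerm k w)
Stirling⇒isStirlingPerm {k} {w} pos s =
  T-∧⁺ {length w ≡ᵇ sum k} (≡⇒≡ᵇ _ _ (trans (stirling-length (length k) (at1-positive pos) s) (∑-at k)))
    (T-∧⁺ {all _ (range (length k))} (T-all⁺ _ (enumerates-range (length k)) (λ v∈ → ≡⇒≡ᵇ _ _ (counts s _ v∈)))
      (T-∧⁺ {all (λ x → memb x (range (length k))) w}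
        (All.all⁻ (λ x → memb x (range (length k))) (All.map (λ r → ∈⇒memb (Enumerates.complete (enumerates-range (length k)) r)) (inRange s)))
        (avoids⇒stirlingCond w (avoids s))))

indicator-δ : ∀ d i → indicator (d ≡ᵇ i) ≡ δ d i
indicator-δ zero    zero    = refl
indicator-δ zero    (suc i) = refl
indicator-δ (suc d) zero    = refl
indicator-δ (suc d) (suc i) = indicator-δ d i

stirlingsOf : List ℕ → List (List ℕ)
stirlingsOf k = stirlings (at1 k) (length k)

-- Filtering all words and filtering the inserted words enumerate the same set. Writing the count as
-- a sum of monomials allows each word to be treated separately later on.
Acoef-sum : ∀ {k} → All (1 ≤_) k → ∀ i → Acoef k i ≡ sum (map (λ w → δ (desc w) i) (stirlingsOf k))
Acoef-sum {k} pos i = begin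
  Acoef k i
    ≡⟨ ↭-length (enumerates-↭
         (enumerates-filterᵇ (λ w → isStirlingPerm k w ∧ (descents w ≡ᵇ i)) (enumerates-words (sum k) (length k)))
         (enumerates-filterᵇ (λ w → desc w ≡ᵇ i) (enumerates-stirlings (at1 k) (length k) (at1-positive pos)))
         to from) ⟩
  countᵇ (λ w → desc w ≡ᵇ i) (stirlingsOf k)                   ≡⟨ countᵇ-sum _ (stirlingsOf k) ⟩
  sum (map (λ w → indicator (desc w ≡ᵇ i)) (stirlingsOf k))    ≡⟨ cong sum (map-cong (λ w → indicator-δ (desc w) i) (stirlingsOf k)) ⟩
  sum (map (λ w → δ (desc w) i) (stirlingsOf k))               ∎
  where
  to : ∀ {w} → (length w ≡ sum k × All (InRange (length k)) w) × T (isStirlingPerm k w ∧ (descents w ≡ᵇ i)) →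
       Stirling (length k) (at1 k) w × T (desc w ≡ᵇ i)
  to {w} (_ , t) = let (s , d) = T-∧⁻ {isStirlingPerm k w} t in
    isStirlingPerm⇒Stirling k w s , subst (λ z → T (z ≡ᵇ i)) (descents≡desc w) d
  from : ∀ {w} → Stirling (length k) (at1 k) w × T (desc w ≡ᵇ i) →
       (length w ≡ sum k × All (InRange (length k)) w) × T (isStirlingPerm k w ∧ (descents w ≡ᵇ i))
  from {w} (s , d) = (trans (stirling-length (length k) (at1-positive pos) s) (∑-at k) , inRange s) ,
    T-∧⁺ {isStirlingPerm k w} (Stirling⇒isStirlingPerm pos s) (subst (λ z → T (z ≡ᵇ i)) (sym (descents≡desc w)) d)

δ-≢ : ∀ {d i} → d ≢ i → δ d i ≡ 0
δ-≢ {d} {i} ne = trans (sym (indicator-δ d i)) (cong indicator (≢⇒≡ᵇ-false ne))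

δ-complement : ∀ {d a s} i → d + a ≡ s → i ≤ s → δ d (s ∸ i) ≡ δ a i
δ-complement {d} {a} {s} i eq i≤s with a ≟ i
... | yes refl rewrite sym eq | m+n∸n≡m d a = trans (sym (indicator-δ d d)) (trans (cong indicator (trans (≡ᵇ-refl d) (sym (≡ᵇ-refl a)))) (indicator-δ a a))
... | no ne = trans (δ-≢ (λ d≡ → ne (+-cancelˡ-≡ d a i (trans eq (trans (sym (m∸n+n≡m i≤s)) (cong (_+ i) (sym d≡))))))) (sym (δ-≢ ne))

stirling-desc-≤ : ∀ {cnt} n {w} → (∀ v → InRange n v → 1 ≤ cnt v) → Stirling n cnt w → desc w ≤ n
stirling-desc-≤ zero pos s rewrite stirling-zero s = z≤n
stirling-desc-≤ {cnt} (suc n) {w} pos s with cnt (suc n) | pos (suc n) (s≤s z≤n , ≤-refl) | stirling-ins-rem (pos (suc n) (s≤s z≤n , ≤-refl)) s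
... | suc t | _ | eq = subst (λ z → desc z ≤ suc n) eq
  (≤-trans (desc-ins-≤ (firstIndex (suc n) w) t (All.map (s≤s ∘ proj₂) (inRange (stirling-rem s))))
    (s≤s (stirling-desc-≤ n (λ { v (l , u) → pos v (l , m≤n⇒m≤1+n u) }) (stirling-rem s))))

desc-positive : ∀ {w} → 1 ≤ length w → 1 ≤ desc w
desc-positive {x ∷ []} _ = s≤s z≤n
desc-positive {x ∷ y ∷ w} _ = ≤-trans (desc-positive {y ∷ w} (s≤s z≤n)) (m≤n+m _ _)

sum-zero : {A : Set} (f : A → ℕ) (xs : List A) → (∀ {x} → x ∈ xs → f x ≡ 0) → sum (map f xs) ≡ 0
sum-zero f []       eq = refl
sum-zero f (x ∷ xs) eq = cong₂ _+_ (eq (here refl)) (sum-zero f xs (eq ∘ there))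

sum-cong-∈ : {A : Set} (f g : A → ℕ) (xs : List A) → (∀ {x} → x ∈ xs → f x ≡ g x) → sum (map f xs) ≡ sum (map g xs)
sum-cong-∈ f g xs eq = cong sum (map-cong-local (All.tabulate eq))

-- The two numerators as sums over words

module Numerators {k : List ℕ} (pos : All (1 ≤_) k) (nonempty : 1 ≤ length k) where

  n = length k
  K = sum k

  enumS : Enumerates (Stirling n (at1 k)) (stirlingsOf k)
  enumS = enumerates-stirlings (at1 k) n (at1-positive pos)

  length-word : ∀ {w} → w ∈ stirlingsOf k → length w ≡ K
  length-word w∈ = trans (stirling-length n (at1-positive pos) (Enumerates.sound enumS w∈)) (∑-at k)

  desc-≤ : ∀ {w} → w ∈ stirlingsOf k → desc w ≤ n
  desc-≤ w∈ = stirling-desc-≤ n (at1-positive pos) (Enumerates.sound enumS w∈)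

  sum-positive : ∀ {k} → All (1 ≤_) k → 1 ≤ length k → 1 ≤ sum k
  sum-positive (p ∷ _) _ = ≤-trans p (m≤m+n _ _)

  desc-≥ : ∀ {w} → w ∈ stirlingsOf k → 1 ≤ desc w
  desc-≥ {w} w∈ = desc-positive {w} (subst (1 ≤_) (sym (length-word w∈)) (sum-positive pos nonempty))

  -- The cut-offs lose nothing: a nonempty word has its final descent, and each of the n insertions
  -- adds at most one descent.
  numB-sum : ∀ i → numB k i ≡ sum (map (λ w → δ (desc w) i) (stirlingsOf k))
  numB-sum i with (1 ≤ᵇ i) ∧ (i ≤ᵇ n) in eq
  ... | true = Acoef-sum pos i
  ... | false = sym (sum-zero (λ w → δ (desc w) i) (stirlingsOf k) (λ {w} w∈ → δ-≢ {desc w} {i} (λ { refl → subst T eq (T-∧⁺ {1 ≤ᵇ i} (≤⇒≤ᵇ (desc-≥ w∈)) (≤⇒≤ᵇ (desc-≤ w∈))) })))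

  -- Since desc + asc = K + 1, reversing the index replaces descents by ascents, and 1 ≤ desc ≤ n
  -- becomes the range from K - n + 1 to K.
  numb-sum : ∀ i → numb k i ≡ sum (map (λ w → δ (asc w) i) (stirlingsOf k))
  numb-sum i with (suc K ≤ᵇ i + n) ∧ (i ≤ᵇ K) in eq
  ... | true = trans (Acoef-sum pos (suc K ∸ i)) (sum-cong-∈ _ _ (stirlingsOf k) λ {w} w∈ →
          δ-complement {desc w} {asc w} i (trans (desc+asc w) (cong suc (length-word w∈)))
            (m≤n⇒m≤1+n (≤ᵇ⇒≤ i K (proj₂ (T-∧⁻ {suc K ≤ᵇ i + n} (subst T (sym eq) _))))))
  ... | false = sym (sum-zero (λ w → δ (asc w) i) (stirlingsOf k) (λ {w} w∈ → δ-≢ {asc w} {i} (λ asc≡ → subst T eq (bounds w∈ asc≡))))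
    where
    bounds : ∀ {w} → w ∈ stirlingsOf k → asc w ≡ i → T ((suc K ≤ᵇ i + n) ∧ (i ≤ᵇ K))
    bounds {w} w∈ refl = T-∧⁺ {suc K ≤ᵇ asc w + n}
      (≤⇒≤ᵇ (≤-trans (≤-reflexive (trans (sym total) (+-comm (desc w) (asc w)))) (+-monoʳ-≤ (asc w) (desc-≤ w∈))))
      (≤⇒≤ᵇ (m<1+n⇒m≤n (≤-trans (+-monoˡ-≤ (asc w) (desc-≥ w∈)) (≤-reflexive total))))
      where
      total : desc w + asc w ≡ suc K
      total = trans (desc+asc w) (cong suc (length-word w∈))

  Bpoly-sum : ∀ m → Bpoly k m ≡ sum (map (λ w → iter psum (suc K) (δ (desc w)) m) (stirlingsOf k))
  Bpoly-sum m = begin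
    Bpoly k m                          ≡⟨ ⊛-invPowS (numB k) (suc K) m ⟩
    iter psum (suc K) (numB k) m       ≡⟨ iter-cong suc (suc K) numB-sum m ⟩
    _                                  ≡⟨ iter-sum suc (suc K) (δ ∘ desc) (stirlingsOf k) m ⟩
    _                                  ∎

  bpoly-sum : ∀ m → bpoly k m ≡ sum (map (λ w → iter psum (suc K) (δ (asc w)) m) (stirlingsOf k))
  bpoly-sum m = begin
    bpoly k m                          ≡⟨ ⊛-invPowS (numb k) (suc K) m ⟩
    iter psum (suc K) (numb k) m       ≡⟨ iter-cong suc (suc K) numb-sum m ⟩
    _                                  ≡⟨ iter-sum suc (suc K) (δ ∘ asc) (stirlingsOf k) m ⟩
    _                                  ∎

-- With u = suc and u = id these are (1-x)^{1-t} x d/dx and x^{t-1} (1-x)^{1-t} x d/dx on generating functions.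
stepOp : (ℕ → ℕ) → (ℕ → ℕ) → ℕ → ℕ → ℕ
stepOp u f t = iter (partial u) (t ∸ 1) (λ j → j * f j)

stepOps : (ℕ → ℕ) → (ℕ → ℕ) → (ℕ → ℕ) → ℕ → ℕ → ℕ
stepOps u f cnt zero    = f
stepOps u f cnt (suc n) = stepOp u (stepOps u f cnt n) (cnt (suc n))

-- `stepOps` peels off the last entry, as insertion does, while `foldl` peels off the first; this
-- equation mediates.
stepOps-suc : ∀ u f cnt n → stepOps u f cnt (suc n) ≡ stepOps u (stepOp u f (cnt 1)) (cnt ∘ suc) n
stepOps-suc u f cnt zero    = refl
stepOps-suc u f cnt (suc n) = cong (λ g → stepOp u g (cnt (suc (suc n)))) (stepOps-suc u f cnt n)

stepOps-cong-cnt : ∀ u f {cnt cnt'} n → (∀ v → InRange n v → cnt v ≡ cnt' v) → stepOps u f cnt n ≡ stepOps u f cnt' n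
stepOps-cong-cnt u f zero eq = refl
stepOps-cong-cnt u f (suc n) eq = cong₂ (stepOp u) (stepOps-cong-cnt u f n (λ { v (l , le) → eq v (l , m≤n⇒m≤1+n le) })) (eq (suc n) (s≤s z≤n , ≤-refl))

stepOps-foldl : ∀ u f k → stepOps u f (at1 k) (length k) ≡ foldl (stepOp u) f k
stepOps-foldl u f []      = refl
stepOps-foldl u f (t ∷ k) = trans (stepOps-suc u f (at1 (t ∷ k)) (length k))
  (trans (stepOps-cong-cnt u (stepOp u f t) (length k) (λ { (suc v) _ → refl })) (stepOps-foldl u (stepOp u f t) k))

module Recurrence (cnt : ℕ → ℕ) where

  total : ℕ → ℕ
  total n = ∑ n (cnt ∘ suc)

  Pos : ℕ → Set
  Pos n = ∀ v → InRange n v → 1 ≤ cnt v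

  Pos-pred : ∀ {n} → Pos (suc n) → Pos n
  Pos-pred pos v (l , le) = pos v (l , m≤n⇒m≤1+n le)

  -- An arbitrary function of the number of descents covers the ascents as well, because they are
  -- the complement to the number of gaps.
  ins-gap-sum : ∀ {n t} → Pos (suc n) → cnt (suc n) ≡ suc t → (f : ℕ → ℕ) →
    sum (map (λ w → f (desc w)) (stirlings cnt (suc n))) ≡
    sum (map (λ w → desc w * f (desc w) + asc w * f (suc (desc w))) (stirlings cnt n))
  ins-gap-sum {n} {t} pos eq f = trans (sum-map-concatMap (f ∘ desc) _ (stirlings cnt n))
    (sum-cong-∈ _ _ (stirlings cnt n) λ {w} w∈ → trans (cong sum (sym (map-∘ (upTo (suc (length w))))))
      (trans (sum-upTo _ (suc (length w)))
        (trans (cong (λ s → ∑ (suc (length w)) (λ p → f (desc (ins p (replicate s (suc n)) w)))) eq)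
          (∑-desc-ins t f (All.map (s≤s ∘ proj₂) (inRange (Enumerates.sound (enumerates-stirlings cnt n (Pos-pred pos)) w∈)))))))

  word-total : ∀ {n w} → Pos n → w ∈ stirlings cnt n → desc w + asc w ≡ suc (total n)
  word-total {n} {w} pos w∈ = trans (desc+asc w) (cong suc (stirling-length n pos (Enumerates.sound (enumerates-stirlings cnt n pos) w∈)))

  descSeries ascSeries : ℕ → ℕ → ℕ
  descSeries n m = sum (map (λ w → iter psum (suc (total n)) (δ (desc w)) m) (stirlings cnt n))
  ascSeries n m = sum (map (λ w → iter psum (suc (total n)) (δ (asc w)) m) (stirlings cnt n))

  -- Of the t + 1 new factors 1/(1-x), one is absorbed by the Euler identity and t remain as the
  -- partial sums in `stepOp`.
  exponent : ∀ n {t} → cnt (suc n) ≡ suc t → suc (total (suc n)) ≡ t + suc (suc (total n))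
  exponent n {t} eq rewrite eq = lemma (total n) t
    where
    lemma : ∀ a t → suc (a + suc t) ≡ t + suc (suc a)
    lemma = solve-∀

  sum-*ˡ : {A : Set} (c : ℕ) (f : A → ℕ) (xs : List A) → sum (map (λ x → c * f x) xs) ≡ c * sum (map f xs)
  sum-*ˡ c f []       = sym (*-zeroʳ c)
  sum-*ˡ c f (x ∷ xs) rewrite sum-*ˡ c f xs = sym (*-distribˡ-+ c (f x) _)

  descSeries-step : ∀ n → Pos (suc n) → descSeries (suc n) ≗ stepOp suc (descSeries n) (cnt (suc n))
  descSeries-step n pos m = begin
    descSeries (suc n) m
      ≡⟨ cong (λ r → sum (map (λ w → iter psum r (δ (desc w)) m) (stirlings cnt (suc n)))) (exponent n eq) ⟩
    sum (map (λ w → iter psum (t + N) (δ (desc w)) m) (stirlings cnt (suc n)))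
      ≡⟨ ins-gap-sum pos eq (λ d → iter psum (t + N) (δ d) m) ⟩
    sum (map (λ w → desc w * iter psum (t + N) (δ (desc w)) m + asc w * iter psum (t + N) (δ (suc (desc w))) m) ws)
      ≡⟨ sum-cong-∈ _ _ ws perWord ⟩
    sum (map (λ w → iter psum t (λ j → j * iter psum (suc (total n)) (δ (desc w)) j) m) ws)
      ≡⟨ iter-sum suc t (λ w j → j * iter psum (suc (total n)) (δ (desc w)) j) ws m ⟨
    iter psum t (λ j → sum (map (λ w → j * iter psum (suc (total n)) (δ (desc w)) j) ws)) m
      ≡⟨ iter-cong suc t (λ j → sum-*ˡ j _ ws) m ⟩
    iter psum t (λ j → j * descSeries n j) m ∎
    where
    t = cnt (suc n) ∸ 1
    eq : cnt (suc n) ≡ suc t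
    eq = sym (m+[n∸m]≡n (pos (suc n) (s≤s z≤n , ≤-refl)))
    N = suc (suc (total n))
    ws = stirlings cnt n
    perWord : ∀ {w} → w ∈ ws →
      desc w * iter psum (t + N) (δ (desc w)) m + asc w * iter psum (t + N) (δ (suc (desc w))) m ≡
      iter psum t (λ j → j * iter psum (suc (total n)) (δ (desc w)) j) m
    perWord {w} w∈ rewrite iter-+ psum t N (δ (desc w)) | iter-+ psum t N (δ (suc (desc w))) =
      trans (sym (iter-linear suc t (desc w) (asc w) _ _ m)) (iter-cong suc t (iter-δ-euler (desc w) (asc w) (word-total (Pos-pred pos) w∈)) m)

  ascSeries-step : ∀ n → Pos (suc n) → ascSeries (suc n) ≗ stepOp id (ascSeries n) (cnt (suc n))
  ascSeries-step n pos m = begin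
    ascSeries (suc n) m
      ≡⟨ cong (λ r → sum (map (λ w → iter psum r (δ (asc w)) m) (stirlings cnt (suc n)))) (exponent n eq) ⟩
    sum (map (λ w → iter psum (t + N) (δ (asc w)) m) (stirlings cnt (suc n)))
      ≡⟨ sum-cong-∈ _ _ (stirlings cnt (suc n)) (λ {w} w∈ → cong (λ a → iter psum (t + N) (δ a) m) (ascent w∈)) ⟩
    sum (map (λ w → iter psum (t + N) (δ (t + N ∸ desc w)) m) (stirlings cnt (suc n)))
      ≡⟨ ins-gap-sum pos eq (λ d → iter psum (t + N) (δ (t + N ∸ d)) m) ⟩
    sum (map (λ w → desc w * iter psum (t + N) (δ (t + N ∸ desc w)) m + asc w * iter psum (t + N) (δ (t + N ∸ suc (desc w))) m) ws)
      ≡⟨ sum-cong-∈ _ _ ws perWord ⟩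
    sum (map (λ w → iter psum< t (λ j → j * iter psum (suc (total n)) (δ (asc w)) j) m) ws)
      ≡⟨ iter-sum id t (λ w j → j * iter psum (suc (total n)) (δ (asc w)) j) ws m ⟨
    iter psum< t (λ j → sum (map (λ w → j * iter psum (suc (total n)) (δ (asc w)) j) ws)) m
      ≡⟨ iter-cong id t (λ j → sum-*ˡ j _ ws) m ⟩
    iter psum< t (λ j → j * ascSeries n j) m ∎
    where
    t = cnt (suc n) ∸ 1
    eq : cnt (suc n) ≡ suc t
    eq = sym (m+[n∸m]≡n (pos (suc n) (s≤s z≤n , ≤-refl)))
    N = suc (suc (total n))
    ws = stirlings cnt n
    -- Ascents are expressed through descents to bring the summand into the form required by
    -- `ins-gap-sum`.
    ascent : ∀ {w} → w ∈ stirlings cnt (suc n) → asc w ≡ t + N ∸ desc w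
    ascent {w} w∈ = trans (sym (m+n∸m≡n (desc w) (asc w)))
      (cong (_∸ desc w) (trans (word-total pos w∈) (exponent n eq)))
    perWord : ∀ {w} → w ∈ ws →
      desc w * iter psum (t + N) (δ (t + N ∸ desc w)) m + asc w * iter psum (t + N) (δ (t + N ∸ suc (desc w))) m ≡
      iter psum< t (λ j → j * iter psum (suc (total n)) (δ (asc w)) j) m
    perWord {w} w∈ = begin
      desc w * iter psum (t + N) (δ (t + N ∸ desc w)) m + asc w * iter psum (t + N) (δ (t + N ∸ suc (desc w))) m
        ≡⟨ cong₂ (λ x y → desc w * iter psum (t + N) (δ x) m + asc w * iter psum (t + N) (δ y) m) same more ⟩
      desc w * iter psum (t + N) (δ (t + suc (asc w))) m + asc w * iter psum (t + N) (δ (t + asc w)) m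
        ≡⟨ cong₂ (λ x y → desc w * x + asc w * y) (iter-psum-shifts t N (suc (asc w)) m) (iter-psum-shifts t N (asc w) m) ⟩
      desc w * iter psum< t (iter psum N (δ (suc (asc w)))) m + asc w * iter psum< t (iter psum N (δ (asc w))) m
        ≡⟨ iter-linear id t (desc w) (asc w) _ _ m ⟨
      iter psum< t (λ j → desc w * iter psum N (δ (suc (asc w))) j + asc w * iter psum N (δ (asc w)) j) m
        ≡⟨ iter-cong id t euler m ⟩
      iter psum< t (λ j → j * iter psum (suc (total n)) (δ (asc w)) j) m ∎
      where
      tot : asc w + desc w ≡ suc (total n)
      tot = trans (+-comm (asc w) (desc w)) (word-total (Pos-pred pos) w∈)
      -- If the descents are kept, all t + 1 new gaps are ascents; if a descent is gained, only t of
      -- them are.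
      same : t + N ∸ desc w ≡ t + suc (asc w)
      same = trans (cong (λ s → t + suc s ∸ desc w) (sym tot))
        (trans (cong (_∸ desc w) (sym (+-assoc t (suc (asc w)) (desc w)))) (m+n∸n≡m (t + suc (asc w)) (desc w)))
      more : t + N ∸ suc (desc w) ≡ t + asc w
      more = trans (cong (λ s → t + suc s ∸ suc (desc w)) (sym tot))
        (trans (cong (_∸ suc (desc w)) (lemma t (asc w) (desc w))) (m+n∸n≡m (t + asc w) (suc (desc w))))
        where
        lemma : ∀ t a d → t + suc (a + d) ≡ t + a + suc d
        lemma = solve-∀
      euler : ∀ j → desc w * iter psum N (δ (suc (asc w))) j + asc w * iter psum N (δ (asc w)) j ≡ j * iter psum (suc (total n)) (δ (asc w)) j
      euler j = trans (+-comm (desc w * iter psum N (δ (suc (asc w))) j) _) (iter-δ-euler (asc w) (desc w) tot j)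

  -- The contributions 1/(1-x) and x/(1-x) of the empty word, which has no descent and one ascent.
  one nonzero : ℕ → ℕ
  one _ = 1
  nonzero = shift one

  stepOp-cong : ∀ u {f g} t → f ≗ g → stepOp u f t ≗ stepOp u g t
  stepOp-cong u t eq = iter-cong u (t ∸ 1) (λ j → cong (j *_) (eq j))

  psum-δ-zero : psum (δ 0) ≗ one
  psum-δ-zero m = trans (iter-δ-zero 1 m) (trans (invPowS-C 0 m) (nCn≡1 m))

  descSeries-stepOps : ∀ n → Pos n → descSeries n ≗ stepOps suc one cnt n
  descSeries-stepOps zero pos m = trans (+-identityʳ _) (psum-δ-zero m)
  descSeries-stepOps (suc n) pos m = trans (descSeries-step n pos m)
    (stepOp-cong suc (cnt (suc n)) (descSeries-stepOps n (Pos-pred pos)) m)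

  ascSeries-stepOps : ∀ n → Pos n → ascSeries n ≗ stepOps id nonzero cnt n
  ascSeries-stepOps zero pos m = trans (+-identityʳ _) (trans (iter-δ-suc 1 0 m) (shift-cong psum-δ-zero m))
  ascSeries-stepOps (suc n) pos m = trans (ascSeries-step n pos m)
    (stepOp-cong id (cnt (suc n)) (ascSeries-stepOps n (Pos-pred pos)) m)

Bpoly-foldl : ∀ k → All (1 ≤_) k → 1 ≤ length k → ∀ m → Bpoly k m ≡ foldl (stepOp suc) (λ _ → 1) k m
Bpoly-foldl k pos ne m = begin
  Bpoly k m                                          ≡⟨ Numerators.Bpoly-sum pos ne m ⟩
  sum (map (λ w → iter psum (suc (sum k)) (δ (desc w)) m) (stirlingsOf k))
    ≡⟨ cong (λ r → sum (map (λ w → iter psum (suc r) (δ (desc w)) m) (stirlingsOf k))) (∑-at k) ⟨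
  Recurrence.descSeries (at1 k) (length k) m         ≡⟨ Recurrence.descSeries-stepOps (at1 k) (length k) (at1-positive pos) m ⟩
  stepOps suc (λ _ → 1) (at1 k) (length k) m         ≡⟨ cong (λ f → f m) (stepOps-foldl suc (λ _ → 1) k) ⟩
  foldl (stepOp suc) (λ _ → 1) k m                   ∎

bpoly-foldl : ∀ k → All (1 ≤_) k → 1 ≤ length k → ∀ m → bpoly k m ≡ foldl (stepOp id) (shift (λ _ → 1)) k m
bpoly-foldl k pos ne m = begin
  bpoly k m                                          ≡⟨ Numerators.bpoly-sum pos ne m ⟩
  sum (map (λ w → iter psum (suc (sum k)) (δ (asc w)) m) (stirlingsOf k))
    ≡⟨ cong (λ r → sum (map (λ w → iter psum (suc r) (δ (asc w)) m) (stirlingsOf k))) (∑-at k) ⟨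
  Recurrence.ascSeries (at1 k) (length k) m          ≡⟨ Recurrence.ascSeries-stepOps (at1 k) (length k) (at1-positive pos) m ⟩
  stepOps id (shift (λ _ → 1)) (at1 k) (length k) m  ≡⟨ cong (λ f → f m) (stepOps-foldl id (shift (λ _ → 1)) k) ⟩
  foldl (stepOp id) (shift (λ _ → 1)) k m            ∎

-- The closed sums

-- The effect of a segment (1^{a-1}, t) of the tuple: each of its a entries multiplies the j-th
-- coefficient by j, and only t brings partial sums, t - 1 of them.
weightOp : (ℕ → ℕ) → (ℕ → ℕ) → ℕ → ℕ → ℕ → ℕ
weightOp u f a t = iter (partial u) (t ∸ 1) (λ j → j ^ a * f j)

weightOps : (ℕ → ℕ) → (ℕ → ℕ) → List ℕ → List ℕ → ℕ → ℕ
weightOps u f (a ∷ as) (t ∷ ts) = weightOps u (weightOp u f a t) as ts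
weightOps u f _        _        = f

foldl-stepOp-cong : ∀ u k {f g} → f ≗ g → foldl (stepOp u) f k ≗ foldl (stepOp u) g k
foldl-stepOp-cong u []      eq = eq
foldl-stepOp-cong u (t ∷ k) eq = foldl-stepOp-cong u k (iter-cong u (t ∸ 1) (λ j → cong (j *_) (eq j)))

foldl-ones : ∀ u b f → foldl (stepOp u) f (replicate b 1) ≗ (λ j → j ^ b * f j)
foldl-ones u zero    f j = sym (+-identityʳ (f j))
foldl-ones u (suc b) f j = trans (foldl-ones u b (λ j → j * f j) j) (lemma j (j ^ b) (f j))
  where
  lemma : ∀ j p x → p * (j * x) ≡ j * p * x
  lemma = solve-∀

foldl-block : ∀ u f {a} t → 1 ≤ a → foldl (stepOp u) f (replicate (a ∸ 1) 1 ++ t ∷ []) ≗ weightOp u f a t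
foldl-block u f {suc b} t _ m = begin
  foldl (stepOp u) f (replicate b 1 ++ t ∷ []) m               ≡⟨ cong (λ g → g m) (foldl-++ (stepOp u) f (replicate b 1) (t ∷ [])) ⟩
  stepOp u (foldl (stepOp u) f (replicate b 1)) t m            ≡⟨ iter-cong u (t ∸ 1) (λ j → trans (cong (j *_) (foldl-ones u b f j)) (sym (*-assoc j (j ^ b) (f j)))) m ⟩
  weightOp u f (suc b) t m                                     ∎

block : ℕ → ℕ → List ℕ
block a t = replicate (a ∸ 1) 1 ++ (t ∷ [])

foldl-blocks : ∀ u f as ts → All (1 ≤_) as → length as ≡ length ts →
  foldl (stepOp u) f (concat (zipWith block as ts)) ≗ weightOps u f as ts
foldl-blocks u f [] [] pos eq m = refl
foldl-blocks u f (a ∷ as) (t ∷ ts) (p ∷ pos) eq m = begin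
  foldl (stepOp u) f (block a t ++ rest) m                     ≡⟨ cong (λ g → g m) (foldl-++ (stepOp u) f (block a t) rest) ⟩
  foldl (stepOp u) (foldl (stepOp u) f (block a t)) rest m     ≡⟨ foldl-stepOp-cong u rest (foldl-block u f t p) m ⟩
  foldl (stepOp u) (weightOp u f a t) rest m                   ≡⟨ foldl-blocks u (weightOp u f a t) as ts pos (suc-injective eq) m ⟩
  weightOps u (weightOp u f a t) as ts m                       ∎
  where rest = concat (zipWith block as ts)

weightTuple-positive : ∀ as ts → All (1 ≤_) ts → All (1 ≤_) (concat (zipWith block as ts))
weightTuple-positive (a ∷ as) (t ∷ ts) (p ∷ ps) =
  All.++⁺ (All.++⁺ (All.replicate⁺ (a ∸ 1) ≤-refl) (p ∷ [])) (weightTuple-positive as ts ps)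
weightTuple-positive []       ts       _        = []
weightTuple-positive (a ∷ as) []       _        = []

weightTuple-nonempty : ∀ as ts → 1 ≤ length as → length as ≡ length ts → 1 ≤ length (concat (zipWith block as ts))
weightTuple-nonempty (a ∷ as) (t ∷ ts) _ _ with replicate (a ∸ 1) 1
... | []    = s≤s z≤n
... | _ ∷ _ = s≤s z≤n

-- Sums over monotone index words

sum-filterᵇ : {A : Set} (p : A → Bool) (F : A → ℕ) (xs : List A) →
  sum (map F (filterᵇ p xs)) ≡ sum (map (λ x → indicator (p x) * F x) xs)
sum-filterᵇ p F [] = refl
sum-filterᵇ p F (x ∷ xs) with p x
... | true  = cong₂ _+_ (sym (+-identityʳ (F x))) (sum-filterᵇ p F xs)
... | false = sum-filterᵇ p F xs

∑words : ℕ → ℕ → (List ℕ → ℕ) → ℕ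
∑words N zero    F = F []
∑words N (suc L) F = ∑ N (λ v → ∑words N L (λ w → F (suc v ∷ w)))

sum-words : ∀ N L F → sum (map F (words L N)) ≡ ∑words N L F
sum-words N zero    F = +-identityʳ (F [])
sum-words N (suc L) F = begin
  sum (map F (words (suc L) N))                                    ≡⟨ sum-map-concatMap F _ (range N) ⟩
  sum (map (λ v → sum (map F (map (v ∷_) (words L N)))) (range N))  ≡⟨ sum-range _ N ⟩
  ∑ N (λ v → sum (map F (map (suc v ∷_) (words L N))))             ≡⟨ ∑-cong N (λ v _ → trans (cong sum (sym (map-∘ (words L N)))) (sum-words N L (λ w → F (suc v ∷ w)))) ⟩
  ∑ N (λ v → ∑words N L (λ w → F (suc v ∷ w)))                     ∎

∑words-cong : ∀ N L {F G} → (∀ w → length w ≡ L → All (InRange N) w → F w ≡ G w) → ∑words N L F ≡ ∑words N L G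
∑words-cong N zero    eq = eq [] refl []
∑words-cong N (suc L) eq = ∑-cong N (λ v v<N → ∑words-cong N L (λ w l r → eq (suc v ∷ w) (cong suc l) ((s≤s z≤n , v<N) ∷ r)))

∑-swap : ∀ m n (f : ℕ → ℕ → ℕ) → ∑ m (λ i → ∑ n (f i)) ≡ ∑ n (λ j → ∑ m (λ i → f i j))
∑-swap zero    n f = sym (∑-zero n (λ _ _ → refl))
∑-swap (suc m) n f = trans (cong (_+ ∑ n (f m)) (∑-swap m n f)) (sym (∑-+ _ (f m) n))

∑-∑words : ∀ n N L (F : ℕ → List ℕ → ℕ) → ∑ n (λ v → ∑words N L (F v)) ≡ ∑words N L (λ w → ∑ n (λ v → F v w))
∑-∑words n N zero    F = refl
∑-∑words n N (suc L) F = trans (∑-swap n N _) (∑-cong N (λ v' _ → ∑-∑words n N L (λ v w → F v (suc v' ∷ w))))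

-- Letters start at 1 and series at 0; `h 0 ≡ 0` bridges this. M = N + 1 is allowed because the
-- relation ≤ becomes < after a successor.
∑-restrict : ∀ N M (h : ℕ → ℕ) → h 0 ≡ 0 → M ≤ suc N → ∑ N (λ v → indicator (suc v <ᵇ M) * h (suc v)) ≡ ∑ M h
∑-restrict N zero    h h0 le = ∑-zero N (λ _ _ → refl)
∑-restrict N (suc M) h h0 (s≤s le) = trans (go N M le) (sym (trans (∑-suc h M) (cong (_+ ∑ M (h ∘ suc)) h0)))
  where
  go : ∀ N M → M ≤ N → ∑ N (λ v → indicator (v <ᵇ M) * h (suc v)) ≡ ∑ M (h ∘ suc)
  go zero    zero le = refl
  go (suc N) M le with M ≟ suc N
  ... | yes refl = ∑-cong (suc N) (λ v v< → trans (cong (λ b → indicator b * h (suc v)) (<⇒<ᵇ-true v<)) (+-identityʳ _))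
  ... | no ne = trans (cong₂ _+_ (go N M M≤N) (cong (λ b → indicator b * h (suc N)) (≮⇒<ᵇ-false (≤⇒≯ M≤N)))) (+-identityʳ _)
    where M≤N = m<1+n⇒m≤n (≤∧≢⇒< le ne)

-- u = suc with ≤ and u = id with < are the two instances.
module ChainSum (u : ℕ → ℕ) (r : ℕ → ℕ → Bool) (chain : List ℕ → Bool) (ker : ℕ → ℕ → ℕ → ℕ) (N m : ℕ)
  (r-u : ∀ v v' → r v v' ≡ (v <ᵇ u v'))
  (u-bound : ∀ v → v ≤ N → u v ≤ suc N) (u-top : u m ≡ suc N)
  (chain-single : ∀ v → chain (v ∷ []) ≡ true)
  (chain-∷ : ∀ v v' w → chain (v ∷ v' ∷ w) ≡ r v v' ∧ chain (v' ∷ w))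
  (kernel : ∀ f a t v → 2 ≤ t → weightOp u f a t v ≡ ∑ (u v) (λ j → (j ^ a * f j) * ker t j v))
  where

  term : List ℕ → List ℕ → List ℕ → ℕ
  term as ts is = product (zipWith _^_ is as) * product (zipWith3 ker ts is (drop 1 is ++ (m ∷ [])))

  indicator-∧ : ∀ a b → indicator (a ∧ b) ≡ indicator a * indicator b
  indicator-∧ true  b = sym (+-identityʳ _)
  indicator-∧ false b = refl

  0^ : ∀ {a} → 1 ≤ a → 0 ^ a ≡ 0
  0^ {suc a} _ = refl

  step : ∀ f a t v' → 1 ≤ a → 2 ≤ t → v' ≤ N →
    ∑ N (λ v → indicator (r (suc v) v') * ((suc v ^ a * f (suc v)) * ker t (suc v) v')) ≡ weightOp u f a t v'
  step f a t v' pa pt le = begin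
    ∑ N (λ v → indicator (r (suc v) v') * h (suc v))        ≡⟨ ∑-cong N (λ v _ → cong (λ b → indicator b * h (suc v)) (r-u (suc v) v')) ⟩
    ∑ N (λ v → indicator (suc v <ᵇ u v') * h (suc v))       ≡⟨ ∑-restrict N (u v') h (cong (λ z → z * f 0 * ker t 0 v') (0^ pa)) (u-bound v' le) ⟩
    ∑ (u v') h                                              ≡⟨ kernel f a t v' pt ⟨
    weightOp u f a t v'                                     ∎
    where
    h : ℕ → ℕ
    h j = (j ^ a * f j) * ker t j v'

  -- The function `f` of the first letter makes the induction work: summing out that letter against
  -- the next one replaces `f` by `weightOp u f a t`. For the last letter, m takes the place of the
  -- next one.
  chainSum : ∀ L f as ts → length as ≡ suc L → length ts ≡ suc L → All (1 ≤_) as → All (2 ≤_) ts →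
    ∑words N (suc L) (λ w → indicator (chain w) * (f (at w 0) * term as ts w)) ≡ weightOps u f as ts m
  chainSum zero f (a ∷ []) (t ∷ []) la lt (pa ∷ []) (pt ∷ []) = begin
    ∑ N (λ v → indicator (chain (suc v ∷ [])) * (f (suc v) * (suc v ^ a * 1 * (ker t (suc v) m * 1))))
      ≡⟨ ∑-cong N (λ v _ → trans (cong (λ b → indicator b * (f (suc v) * (suc v ^ a * 1 * (ker t (suc v) m * 1)))) (chain-single (suc v)))
           (lemma (f (suc v)) (suc v ^ a) (ker t (suc v) m))) ⟩
    ∑ N (h ∘ suc)                              ≡⟨ cong (_+ ∑ N (h ∘ suc)) (cong (λ z → z * f 0 * ker t 0 m) (0^ pa)) ⟨
    h 0 + ∑ N (h ∘ suc)                        ≡⟨ ∑-suc h N ⟨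
    ∑ (suc N) h                                ≡⟨ cong (λ M → ∑ M h) u-top ⟨
    ∑ (u m) h                                  ≡⟨ kernel f a t m pt ⟨
    weightOp u f a t m                         ∎
    where
    h : ℕ → ℕ
    h j = (j ^ a * f j) * ker t j m
    lemma : ∀ x p k → 1 * (x * (p * 1 * (k * 1))) ≡ p * x * k
    lemma = solve-∀
  chainSum (suc L) f (a ∷ as) (t ∷ ts) la lt (pa ∷ pas) (pt ∷ pts) = begin
    ∑ N (λ v → ∑words N (suc L) (λ w → F (suc v ∷ w)))         ≡⟨ ∑-∑words N N (suc L) (λ v w → F (suc v ∷ w)) ⟩
    ∑words N (suc L) (λ w → ∑ N (λ v → F (suc v ∷ w)))         ≡⟨ ∑words-cong N (suc L) inner ⟩
    ∑words N (suc L) (λ w → indicator (chain w) * (weightOp u f a t (at w 0) * term as ts w))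
                                                              ≡⟨ chainSum L (weightOp u f a t) as ts (suc-injective la) (suc-injective lt) pas pts ⟩
    weightOps u (weightOp u f a t) as ts m                     ∎
    where
    F : List ℕ → ℕ
    F w = indicator (chain w) * (f (at w 0) * term (a ∷ as) (t ∷ ts) w)
    inner : ∀ w → length w ≡ suc L → All (InRange N) w →
      ∑ N (λ v → F (suc v ∷ w)) ≡ indicator (chain w) * (weightOp u f a t (at w 0) * term as ts w)
    inner (v' ∷ w) l ((_ , v'≤N) ∷ _) = begin
      ∑ N (λ v → F (suc v ∷ v' ∷ w))
        ≡⟨ ∑-cong N (λ v _ → trans (cong (λ b → indicator b * (f (suc v) * (suc v ^ a * P * (ker t (suc v) v' * Q)))) (chain-∷ (suc v) v' w))
             (trans (cong (_* (f (suc v) * (suc v ^ a * P * (ker t (suc v) v' * Q)))) (indicator-∧ (r (suc v) v') (chain (v' ∷ w))))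
               (lemma (indicator (r (suc v) v')) c (f (suc v)) (suc v ^ a) P (ker t (suc v) v') Q))) ⟩
      ∑ N (λ v → (c * (P * Q)) * (indicator (r (suc v) v') * (suc v ^ a * f (suc v) * ker t (suc v) v')))
        ≡⟨ ∑-* (c * (P * Q)) _ N ⟩
      (c * (P * Q)) * ∑ N (λ v → indicator (r (suc v) v') * (suc v ^ a * f (suc v) * ker t (suc v) v'))
        ≡⟨ cong ((c * (P * Q)) *_) (step f a t v' pa pt v'≤N) ⟩
      (c * (P * Q)) * weightOp u f a t v'
        ≡⟨ lemma₂ c (P * Q) (weightOp u f a t v') ⟩
      c * (weightOp u f a t v' * (P * Q)) ∎
      where
      c = indicator (chain (v' ∷ w))
      P = product (zipWith _^_ (v' ∷ w) as)
      Q = product (zipWith3 ker ts (v' ∷ w) (drop 1 (v' ∷ w) ++ (m ∷ [])))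
      lemma : ∀ i c x p P k Q → i * c * (x * (p * P * (k * Q))) ≡ c * (P * Q) * (i * (p * x * k))
      lemma = solve-∀
      lemma₂ : ∀ c q o → c * q * o ≡ c * (o * q)
      lemma₂ = solve-∀

  filteredSum : ∀ L as ts → length as ≡ suc L → length ts ≡ suc L → All (1 ≤_) as → All (2 ≤_) ts →
    sum (map (term as ts) (filterᵇ chain (words (suc L) N))) ≡ weightOps u (λ _ → 1) as ts m
  filteredSum L as ts la lt pa pt = begin
    sum (map (term as ts) (filterᵇ chain (words (suc L) N)))                       ≡⟨ sum-filterᵇ chain (term as ts) (words (suc L) N) ⟩
    sum (map (λ w → indicator (chain w) * term as ts w) (words (suc L) N))         ≡⟨ sum-words N (suc L) _ ⟩
    ∑words N (suc L) (λ w → indicator (chain w) * term as ts w)                    ≡⟨ ∑words-cong N (suc L) (λ w _ _ → cong (indicator (chain w) *_) (sym (*-identityˡ (term as ts w)))) ⟩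
    ∑words N (suc L) (λ w → indicator (chain w) * (1 * term as ts w))              ≡⟨ chainSum L (λ _ → 1) as ts la lt pa pt ⟩
    weightOps u (λ _ → 1) as ts m                                                  ∎

kernelS kernelP : ℕ → ℕ → ℕ → ℕ
kernelS t i i' = (t + i' ∸ i ∸ 2) C (i' ∸ i)
kernelP t i i' = (i' ∸ i ∸ 1) C (t ∸ 2)

weightOp-kernelS : ∀ f a t v → 2 ≤ t → weightOp suc f a t v ≡ ∑ (suc v) (λ j → (j ^ a * f j) * kernelS t j v)
weightOp-kernelS f a (suc (suc s)) v _ = trans (iter-psum-kernel (suc s) (λ j → j ^ a * f j) v)
  (∑-cong (suc v) (λ j j≤v → cong ((j ^ a * f j) *_) (trans (invPowS-C s (v ∸ j))
    (cong (_C (v ∸ j)) (sym (cong (_∸ 2) (+-∸-assoc (suc (suc s)) (m<1+n⇒m≤n j≤v))))))))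
weightOp-kernelS f a (suc zero) v (s≤s ())

weightOp-kernelP : ∀ f a t v → 2 ≤ t → weightOp id f a t v ≡ ∑ v (λ j → (j ^ a * f j) * kernelP t j v)
weightOp-kernelP f a (suc (suc s)) v _ = iter-psum<-kernel s (λ j → j ^ a * f j) v
weightOp-kernelP f a (suc zero) v (s≤s ())

All-toList : {A : Set} {P : A → Set} {n : ℕ} (v : Vec A n) → (∀ i → P (lookup v i)) → All P (toList v)
All-toList V.[]       p = []
All-toList (x V.∷ v) p = p Fin.zero ∷ All-toList v (p ∘ Fin.suc)

-- The series of b starts from x/(1-x) instead of 1/(1-x), but a ≥ 1 multiplies the coefficient at 0
-- by 0 in the first operator.
weightOps-shift : ∀ u m as ts → 1 ≤ length as → length as ≡ length ts → All (1 ≤_) as →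
  weightOps u (shift (λ _ → 1)) as ts m ≡ weightOps u (λ _ → 1) as ts m
weightOps-shift u m (a ∷ as) (t ∷ ts) _ _ (pa ∷ _) = weightOps-cong as ts (iter-cong u (t ∸ 1) same) m
  where
  weightOps-cong : ∀ as ts {f g} → f ≗ g → weightOps u f as ts ≗ weightOps u g as ts
  weightOps-cong [] ts eq = eq
  weightOps-cong (a ∷ as) [] eq = eq
  weightOps-cong (a ∷ as) (t ∷ ts) eq = weightOps-cong as ts (iter-cong u (t ∸ 1) (λ j → cong (j ^ a *_) (eq j)))
  zero-power : ∀ {a} → 1 ≤ a → 0 ^ a * 0 ≡ 0 ^ a * 1
  zero-power {suc a} _ = refl
  same : ∀ j → j ^ a * shift (λ _ → 1) j ≡ j ^ a * 1
  same zero    = zero-power pa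
  same (suc j) = refl

module ClosedSums {ℓ : ℕ} (as ts : Vec ℕ (suc ℓ)) (a≥1 : ∀ i → 1 ≤ lookup as i) (t≥2 : ∀ i → 2 ≤ lookup ts i) where

  lengths : length (toList as) ≡ length (toList ts)
  lengths = trans (length-toList as) (sym (length-toList ts))

  sumS-weightOps : ∀ m → sumS as ts m ≡ weightOps suc (λ _ → 1) (toList as) (toList ts) m
  sumS-weightOps m = ChainSum.filteredSum suc _≤ᵇ_ nondecreasing kernelS m m ≤ᵇ-<ᵇ (λ _ → s≤s) refl
    (λ _ → refl) (λ _ _ _ → refl) weightOp-kernelS ℓ (toList as) (toList ts)
    (length-toList as) (length-toList ts) (All-toList as a≥1) (All-toList ts t≥2)
    where
    ≤ᵇ-<ᵇ : ∀ v v' → (v ≤ᵇ v') ≡ (v <ᵇ suc v')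
    ≤ᵇ-<ᵇ zero    v' = refl
    ≤ᵇ-<ᵇ (suc v) v' = refl

  sumP-weightOps : ∀ m → 1 ≤ m → sumP as ts m ≡ weightOps id (λ _ → 1) (toList as) (toList ts) m
  sumP-weightOps (suc m) _ = ChainSum.filteredSum id _<ᵇ_ strictlyIncreasing kernelP m (suc m) (λ _ _ → refl) (λ _ → m≤n⇒m≤1+n) refl
    (λ _ → refl) (λ _ _ _ → refl) weightOp-kernelP ℓ (toList as) (toList ts)
    (length-toList as) (length-toList ts) (All-toList as a≥1) (All-toList ts t≥2)

  k = concat (zipWith block (toList as) (toList ts))

  weightTuple≡ : weightTuple as ts 0 ≡ k
  weightTuple≡ = ++-identityʳ k

  k-pos : All (1 ≤_) k
  k-pos = weightTuple-positive (toList as) (toList ts) (All.map (≤-trans (s≤s z≤n)) (All-toList ts t≥2))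

  nonempty : 1 ≤ length (toList as)
  nonempty = subst (1 ≤_) (sym (length-toList as)) (s≤s z≤n)

  k-nonempty : 1 ≤ length k
  k-nonempty = weightTuple-nonempty (toList as) (toList ts) nonempty lengths

  Bpoly≡sumS : ∀ m → Bpoly (weightTuple as ts 0) m ≡ sumS as ts m
  Bpoly≡sumS m = begin
    Bpoly (weightTuple as ts 0) m                            ≡⟨ cong (λ k → Bpoly k m) weightTuple≡ ⟩
    Bpoly k m                                                ≡⟨ Bpoly-foldl k k-pos k-nonempty m ⟩
    foldl (stepOp suc) (λ _ → 1) k m                         ≡⟨ foldl-blocks suc _ (toList as) (toList ts) (All-toList as a≥1) lengths m ⟩
    weightOps suc (λ _ → 1) (toList as) (toList ts) m        ≡⟨ sumS-weightOps m ⟨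
    sumS as ts m                                             ∎

  bpoly≡sumP : ∀ m → 1 ≤ m → bpoly (weightTuple as ts 0) m ≡ sumP as ts m
  bpoly≡sumP m m≥1 = begin
    bpoly (weightTuple as ts 0) m                            ≡⟨ cong (λ k → bpoly k m) weightTuple≡ ⟩
    bpoly k m                                                ≡⟨ bpoly-foldl k k-pos k-nonempty m ⟩
    foldl (stepOp id) (shift (λ _ → 1)) k m                  ≡⟨ foldl-blocks id _ (toList as) (toList ts) (All-toList as a≥1) lengths m ⟩
    weightOps id (shift (λ _ → 1)) (toList as) (toList ts) m ≡⟨ weightOps-shift id m (toList as) (toList ts) nonempty lengths (All-toList as a≥1) ⟩
    weightOps id (λ _ → 1) (toList as) (toList ts) m         ≡⟨ sumP-weightOps m m≥1 ⟨
    sumP as ts m                                             ∎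

-- Masks: subsets of an interval and their codes

nthB : List Bool → ℕ → Bool
nthB []      _       = false
nthB (x ∷ b) zero    = x
nthB (x ∷ b) (suc j) = nthB b j

truesFrom falsesFrom : ℕ → List Bool → List ℕ
truesFrom i []          = []
truesFrom i (true ∷ b)  = i ∷ truesFrom (suc i) b
truesFrom i (false ∷ b) = truesFrom (suc i) b
falsesFrom i []          = []
falsesFrom i (true ∷ b)  = falsesFrom (suc i) b
falsesFrom i (false ∷ b) = i ∷ falsesFrom (suc i) b

rangeFrom : ℕ → ℕ → List ℕ
rangeFrom i zero    = []
rangeFrom i (suc n) = i ∷ rangeFrom (suc i) n

range≡rangeFrom : ∀ n → range n ≡ rangeFrom 1 n
range≡rangeFrom n = trans (map-applyUpTo id suc n) (go suc n 1 (λ _ → refl))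
  where
  go : ∀ (f : ℕ → ℕ) n i → (∀ j → f j ≡ i + j) → applyUpTo f n ≡ rangeFrom i n
  go f zero    i eq = refl
  go f (suc n) i eq = cong₂ _∷_ (trans (eq 0) (+-identityʳ i)) (go (f ∘ suc) n (suc i) (λ j → trans (eq (suc j)) (+-suc i j)))

truesFrom-≥ : ∀ i b → All (i ≤_) (truesFrom i b)
truesFrom-≥ i []          = []
truesFrom-≥ i (true ∷ b)  = ≤-refl ∷ All.map (≤-trans (n≤1+n i)) (truesFrom-≥ (suc i) b)
truesFrom-≥ i (false ∷ b) = All.map (≤-trans (n≤1+n i)) (truesFrom-≥ (suc i) b)

falsesFrom-≥ : ∀ i b → All (i ≤_) (falsesFrom i b)
falsesFrom-≥ i []          = []
falsesFrom-≥ i (false ∷ b) = ≤-refl ∷ All.map (≤-trans (n≤1+n i)) (falsesFrom-≥ (suc i) b)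
falsesFrom-≥ i (true ∷ b)  = All.map (≤-trans (n≤1+n i)) (falsesFrom-≥ (suc i) b)

memb-absent : ∀ {x xs} → All (x <_) xs → memb x xs ≡ false
memb-absent [] = refl
memb-absent {x} (lt ∷ lts) rewrite ≢⇒≡ᵇ-false (<⇒≢ lt) = memb-absent lts

memb-truesFrom : ∀ i b j → memb (i + j) (truesFrom i b) ≡ nthB b j
memb-truesFrom i [] j = refl
memb-truesFrom i (true ∷ b) zero rewrite +-identityʳ i | ≡ᵇ-refl i = refl
memb-truesFrom i (true ∷ b) (suc j)
  rewrite ≢⇒≡ᵇ-false {i + suc j} {i} (m+1+n≢m i) | +-suc i j = memb-truesFrom (suc i) b j
memb-truesFrom i (false ∷ b) zero rewrite +-identityʳ i = memb-absent (truesFrom-≥ (suc i) b)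
memb-truesFrom i (false ∷ b) (suc j) rewrite +-suc i j = memb-truesFrom (suc i) b j

filter-rangeFrom : ∀ (p : ℕ → Bool) i b → (∀ j → j < length b → p (i + j) ≡ nthB b j) →
  filterᵇ p (rangeFrom i (length b)) ≡ truesFrom i b
filter-rangeFrom p i [] eq = refl
filter-rangeFrom p i (x ∷ b) eq with p i | trans (cong p (sym (+-identityʳ i))) (eq 0 (s≤s z≤n))
... | true  | refl = cong (i ∷_) (filter-rangeFrom p (suc i) b (λ j lt → trans (cong p (sym (+-suc i j))) (eq (suc j) (s≤s lt))))
... | false | refl = filter-rangeFrom p (suc i) b (λ j lt → trans (cong p (sym (+-suc i j))) (eq (suc j) (s≤s lt)))

nthB-not : ∀ b j → j < length b → nthB (map not b) j ≡ not (nthB b j)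
nthB-not (x ∷ b) zero    _        = refl
nthB-not (x ∷ b) (suc j) (s≤s lt) = nthB-not b j lt

truesFrom-not : ∀ i b → truesFrom i (map not b) ≡ falsesFrom i b
truesFrom-not i []          = refl
truesFrom-not i (true ∷ b)  = truesFrom-not (suc i) b
truesFrom-not i (false ∷ b) = cong (i ∷_) (truesFrom-not (suc i) b)

length-map-not : ∀ b → length (map not b) ≡ length b
length-map-not b = length-map not b

complementL-trues : ∀ b → complementL (length b) (truesFrom 1 b) ≡ falsesFrom 1 b
complementL-trues b = trans (cong (filterᵇ p) (trans (range≡rangeFrom (length b)) (cong (rangeFrom 1) (sym (length-map-not b)))))
  (trans (filter-rangeFrom p 1 (map not b)
    (λ j lt → trans (cong not (memb-truesFrom 1 b j)) (sym (nthB-not b j (subst (j <_) (length-map-not b) lt)))))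
  (truesFrom-not 1 b))
  where
  p : ℕ → Bool
  p x = not (memb x (truesFrom 1 b))

mask : (ℕ → Bool) → ℕ → ℕ → List Bool
mask p i zero    = []
mask p i (suc n) = p i ∷ mask p (suc i) n

length-mask : ∀ p i n → length (mask p i n) ≡ n
length-mask p i zero    = refl
length-mask p i (suc n) = cong suc (length-mask p (suc i) n)

nthB-mask : ∀ p i n j → j < n → nthB (mask p i n) j ≡ p (i + j)
nthB-mask p i (suc n) zero    _        = cong p (sym (+-identityʳ i))
nthB-mask p i (suc n) (suc j) (s≤s lt) = trans (nthB-mask p (suc i) n j lt) (cong p (sym (+-suc i j)))

truesFrom-mask : ∀ p n → truesFrom 1 (mask p 1 n) ≡ filterᵇ p (range n)
truesFrom-mask p n = sym (trans (cong (filterᵇ p) (trans (range≡rangeFrom n) (cong (rangeFrom 1) (sym (length-mask p 1 n)))))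
  (filter-rangeFrom p 1 (mask p 1 n) (λ j lt → sym (nthB-mask p 1 n j (subst (j <_) (length-mask p 1 n) lt)))))

mask-nthB : ∀ p i b → (∀ j → j < length b → p (i + j) ≡ nthB b j) → mask p i (length b) ≡ b
mask-nthB p i [] eq = refl
mask-nthB p i (x ∷ b) eq = cong₂ _∷_ (trans (cong p (sym (+-identityʳ i))) (eq 0 (s≤s z≤n)))
  (mask-nthB p (suc i) b (λ j lt → trans (cong p (sym (+-suc i j))) (eq (suc j) (s≤s lt))))

mask-memb-trues : ∀ b → mask (λ x → memb x (truesFrom 1 b)) 1 (length b) ≡ b
mask-memb-trues b = mask-nthB _ 1 b (λ j _ → memb-truesFrom 1 b j)

-- σ = id gives nondecreasing and σ = suc strictly increasing lists with a lower bound for the head;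
-- it is the same σ as in `code`.
data Chain (σ : ℕ → ℕ) : ℕ → List ℕ → Set where
  []  : ∀ {lo} → Chain σ lo []
  _∷_ : ∀ {lo x xs} → lo ≤ x → Chain σ (σ x) xs → Chain σ lo (x ∷ xs)

chain-weaken : ∀ {σ lo lo' xs} → lo' ≤ lo → Chain σ lo xs → Chain σ lo' xs
chain-weaken le []       = []
chain-weaken le (l ∷ is) = ≤-trans le l ∷ is

chain-≥ : ∀ {σ lo xs} → (∀ c → c ≤ σ c) → Chain σ lo xs → All (lo ≤_) xs
chain-≥ inc []       = []
chain-≥ inc (l ∷ ch) = l ∷ All.map (≤-trans (≤-trans l (inc _))) (chain-≥ inc ch)

strictlyIncreasing⇒Chain : ∀ {lo} xs → lo ≤ at xs 0 → T (strictlyIncreasing xs) → Chain suc lo xs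
strictlyIncreasing⇒Chain []           l t = []
strictlyIncreasing⇒Chain (x ∷ [])     l t = l ∷ []
strictlyIncreasing⇒Chain (x ∷ y ∷ xs) l t =
  l ∷ strictlyIncreasing⇒Chain (y ∷ xs) (<ᵇ⇒< x y (proj₁ (T-∧⁻ {x <ᵇ y} t))) (proj₂ (T-∧⁻ {x <ᵇ y} t))

Chain⇒strictlyIncreasing : ∀ {lo xs} → Chain suc lo xs → T (strictlyIncreasing xs)
Chain⇒strictlyIncreasing [] = tt
Chain⇒strictlyIncreasing (_ ∷ []) = tt
Chain⇒strictlyIncreasing {xs = x ∷ y ∷ xs} (_ ∷ l ∷ is) = T-∧⁺ {x <ᵇ y} (<⇒<ᵇ l) (Chain⇒strictlyIncreasing {suc x} (l ∷ is))

nondecreasing⇒Chain : ∀ {lo} xs → lo ≤ at xs 0 → T (nondecreasing xs) → Chain id lo xs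
nondecreasing⇒Chain []           l t = []
nondecreasing⇒Chain (x ∷ [])     l t = l ∷ []
nondecreasing⇒Chain (x ∷ y ∷ xs) l t =
  l ∷ nondecreasing⇒Chain (y ∷ xs) (≤ᵇ⇒≤ x y (proj₁ (T-∧⁻ {x ≤ᵇ y} t))) (proj₂ (T-∧⁻ {x ≤ᵇ y} t))

Chain⇒nondecreasing : ∀ {lo xs} → Chain id lo xs → T (nondecreasing xs)
Chain⇒nondecreasing [] = tt
Chain⇒nondecreasing (_ ∷ []) = tt
Chain⇒nondecreasing {xs = x ∷ y ∷ xs} (_ ∷ l ∷ ch) = T-∧⁺ {x ≤ᵇ y} (≤⇒≤ᵇ l) (Chain⇒nondecreasing {x} (l ∷ ch))

truesFrom-increasing : ∀ i b → Chain suc i (truesFrom i b)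
truesFrom-increasing i []          = []
truesFrom-increasing i (true ∷ b)  = ≤-refl ∷ truesFrom-increasing (suc i) b
truesFrom-increasing i (false ∷ b) = chain-weaken (n≤1+n i) (truesFrom-increasing (suc i) b)

increasing-mask : ∀ n i xs → Chain suc i xs → All (_< i + n) xs → truesFrom i (mask (λ x → memb x xs) i n) ≡ xs
increasing-mask zero i [] is lts = refl
increasing-mask zero i (x ∷ xs) (l ∷ is) (lt ∷ lts) = ⊥-elim (<⇒≱ lt (subst (_≤ x) (sym (+-identityʳ i)) l))
increasing-mask (suc n) i [] is lts = increasing-mask n (suc i) [] [] []
increasing-mask (suc n) i (x ∷ xs) (l ∷ is) (lt ∷ lts) with i ≟ x
... | yes refl rewrite ≡ᵇ-refl i = cong (i ∷_) (trans (cong (truesFrom (suc i)) (mask-cong (suc i) n skip))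
        (increasing-mask n (suc i) xs is (All.map (λ {y} → subst (y <_) (+-suc i n)) lts)))
  where
  skip : ∀ y → suc i ≤ y → (y ≡ᵇ i) ∨ memb y xs ≡ memb y xs
  skip y le rewrite ≢⇒≡ᵇ-false {y} {i} (λ eq → <⇒≢ le (sym eq)) = refl
  mask-cong : ∀ j n → (∀ y → j ≤ y → (y ≡ᵇ i) ∨ memb y xs ≡ memb y xs) →
    mask (λ y → (y ≡ᵇ i) ∨ memb y xs) j n ≡ mask (λ y → memb y xs) j n
  mask-cong j zero    eq = refl
  mask-cong j (suc n) eq = cong₂ _∷_ (eq j ≤-refl) (mask-cong (suc j) n (λ y le → eq y (≤-trans (n≤1+n j) le)))
... | no ne rewrite ≢⇒≡ᵇ-false ne
        | memb-absent (All.map (λ p → ≤-trans (s≤s l) p) (chain-≥ n≤1+n is)) =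
  increasing-mask n (suc i) (x ∷ xs) (≤∧≢⇒< l ne ∷ is) (subst (x <_) (+-suc i n) lt ∷ All.map (λ {y} → subst (y <_) (+-suc i n)) lts)

-- Codes of masks by index words

trues : List Bool → ℕ
trues []          = 0
trues (true ∷ b)  = suc (trues b)
trues (false ∷ b) = trues b

length-truesFrom : ∀ i b → length (truesFrom i b) ≡ trues b
length-truesFrom i []          = refl
length-truesFrom i (true ∷ b)  = cong suc (length-truesFrom (suc i) b)
length-truesFrom i (false ∷ b) = length-truesFrom (suc i) b

-- The entry of a false position: σ = id counts the trues before it, σ = suc is its index.
code : (ℕ → ℕ) → ℕ → List Bool → List ℕ
code σ c []          = []
code σ c (true ∷ b)  = code σ (suc c) b
code σ c (false ∷ b) = c ∷ code σ (σ c) b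

-- A false is emitted whenever the counter meets the next entry. The length is prescribed, so trues
-- fill up the mask after the last entry.
decode : (ℕ → ℕ) → ℕ → ℕ → List ℕ → List Bool
decode σ zero    c is       = []
decode σ (suc n) c []       = true ∷ decode σ n (suc c) []
decode σ (suc n) c (i ∷ is) = if c ≡ᵇ i then false ∷ decode σ n (σ c) is else true ∷ decode σ n (suc c) (i ∷ is)

length-decode : ∀ σ n c is → length (decode σ n c is) ≡ n
length-decode σ zero    c is = refl
length-decode σ (suc n) c [] = cong suc (length-decode σ n (suc c) [])
length-decode σ (suc n) c (i ∷ is) with c ≡ᵇ i
... | true  = cong suc (length-decode σ n (σ c) is)
... | false = cong suc (length-decode σ n (suc c) (i ∷ is))

code-length : ∀ σ c b → trues b + length (code σ c b) ≡ length b
code-length σ c []          = refl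
code-length σ c (true ∷ b)  = cong suc (code-length σ (suc c) b)
code-length σ c (false ∷ b) = trans (+-suc (trues b) _) (cong suc (code-length σ (σ c) b))

length-falsesFrom : ∀ σ c i b → length (falsesFrom i b) ≡ length (code σ c b)
length-falsesFrom σ c i []          = refl
length-falsesFrom σ c i (true ∷ b)  = length-falsesFrom σ (suc c) (suc i) b
length-falsesFrom σ c i (false ∷ b) = cong suc (length-falsesFrom σ (σ c) (suc i) b)

code-chain : ∀ σ → (∀ c → c ≤ σ c) → ∀ c b → Chain σ c (code σ c b)
code-chain σ inc c []          = []
code-chain σ inc c (true ∷ b)  = chain-weaken (n≤1+n c) (code-chain σ inc (suc c) b)
code-chain σ inc c (false ∷ b) = ≤-refl ∷ code-chain σ inc (σ c) b

decode-code : ∀ σ → (∀ c → c ≤ σ c) → ∀ c b → decode σ (length b) c (code σ c b) ≡ b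
decode-code σ inc c [] = refl
decode-code σ inc c (false ∷ b) rewrite ≡ᵇ-refl c = cong (false ∷_) (decode-code σ inc (σ c) b)
decode-code σ inc c (true ∷ b) with code σ (suc c) b | code-chain σ inc (suc c) b | decode-code σ inc (suc c) b
... | []     | _     | eq = cong (true ∷_) eq
... | i ∷ is | l ∷ _ | eq rewrite ≢⇒≡ᵇ-false (<⇒≢ l) = cong (true ∷_) eq

-- For σ = id the counter moves only at trues. The remaining length is the sum of the M - c trues
-- still to come and the entries left, so the decoder neither stops early nor has room to spare.
code-decode-id : ∀ M n c is → Chain id c is → All (_≤ M) is → c ≤ M → M ∸ c + length is ≡ n → code id c (decode id n c is) ≡ is
code-decode-id M zero c [] ch le c≤M eq = refl
code-decode-id M zero c (i ∷ is) ch le c≤M eq with () ← trans (sym (+-suc (M ∸ c) (length is))) eq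
code-decode-id M (suc n) c [] ch le c≤M eq = code-decode-id M n (suc c) [] [] [] c<M
  (suc-injective (trans (cong (_+ 0) (sym (+-∸-assoc 1 c<M))) eq))
  where
  c<M : c < M
  c<M = ≰⇒> λ M≤c → 0≢1+n (trans (sym (trans (+-identityʳ (M ∸ c)) (m≤n⇒m∸n≡0 M≤c))) eq)
code-decode-id M (suc n) c (i ∷ is) (l ∷ ch) (le ∷ les) c≤M eq with c ≟ i
... | yes refl rewrite ≡ᵇ-refl c =
  cong (c ∷_) (code-decode-id M n c is ch les c≤M (suc-injective (trans (sym (+-suc (M ∸ c) (length is))) eq)))
... | no ne rewrite ≢⇒≡ᵇ-false ne = code-decode-id M n (suc c) (i ∷ is) (c<i ∷ ch) (le ∷ les) (≤-trans c<i le)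
  (suc-injective (trans (cong (_+ suc (length is)) (sym (+-∸-assoc 1 (≤-trans c<i le)))) eq))
  where c<i = ≤∧≢⇒< l ne

code-decode-suc : ∀ M n c is → Chain suc c is → All (_< M) is → c + n ≡ M → code suc c (decode suc n c is) ≡ is
code-decode-suc M zero c [] ch lt eq = refl
code-decode-suc M zero c (i ∷ is) (l ∷ ch) (lt ∷ lts) eq = ⊥-elim (<⇒≱ lt (subst (_≤ i) (trans (sym (+-identityʳ c)) eq) l))
code-decode-suc M (suc n) c [] ch lt eq = code-decode-suc M n (suc c) [] [] [] (trans (sym (+-suc c n)) eq)
code-decode-suc M (suc n) c (i ∷ is) (l ∷ ch) (lt ∷ lts) eq with c ≟ i
... | yes refl rewrite ≡ᵇ-refl c = cong (c ∷_) (code-decode-suc M n (suc c) is ch lts (trans (sym (+-suc c n)) eq))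
... | no ne rewrite ≢⇒≡ᵇ-false ne = code-decode-suc M n (suc c) (i ∷ is) (≤∧≢⇒< l ne ∷ ch) (lt ∷ lts) (trans (sym (+-suc c n)) eq)

code-id-≤ : ∀ c b → All (_≤ c + trues b) (code id c b)
code-id-≤ c []          = []
code-id-≤ c (true ∷ b)  = All.map (λ {x} → subst (x ≤_) (sym (+-suc c (trues b)))) (code-id-≤ (suc c) b)
code-id-≤ c (false ∷ b) = m≤m+n c (trues b) ∷ code-id-≤ c b

code-suc-< : ∀ c b → All (_< c + length b) (code suc c b)
code-suc-< c []          = []
code-suc-< c (true ∷ b)  = All.map (λ {x} → subst (x <_) (sym (+-suc c (length b)))) (code-suc-< (suc c) b)
code-suc-< c (false ∷ b) = m<m+n c (s≤s z≤n) ∷ All.map (λ {x} → subst (x <_) (sym (+-suc c (length b)))) (code-suc-< (suc c) b)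

-- Families as matrices, column by column

firstPos : ℕ → List ℕ → ℕ
firstPos i []           = 0
firstPos i (zero ∷ xs)  = firstPos (suc i) xs
firstPos i (suc _ ∷ xs) = i

-- The local function of minBlock has no name outside Defs; minBlockGo is solved to it by unification.
mutual
  minBlockGo : List ℕ → ℕ → List ℕ → ℕ
  minBlockGo = _

  minBlock-zero : ∀ xs → minBlock (zero ∷ xs) ≡ firstPos 2 xs
  minBlock-zero xs with zero ∷ xs | 2
  ... | B | i = go-firstPos B i xs

  go-firstPos : ∀ B i xs → minBlockGo B i xs ≡ firstPos i xs
  go-firstPos B i []           = refl
  go-firstPos B i (zero ∷ xs)  = go-firstPos B (suc i) xs
  go-firstPos B i (suc _ ∷ xs) = refl

minBlock≡firstPos : ∀ B → minBlock B ≡ firstPos 1 B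
minBlock≡firstPos []          = refl
minBlock≡firstPos (zero ∷ B)  = minBlock-zero B
minBlock≡firstPos (suc _ ∷ B) = refl

minsF≡ : ∀ F → minsF F ≡ map (firstPos 1) F
minsF≡ = map-cong minBlock≡firstPos

firstPos-zero : ∀ i B → at B 0 ≡ 0 → firstPos i B ≡ firstPos (suc i) (drop 1 B)
firstPos-zero i []         _ = refl
firstPos-zero i (zero ∷ B) _ = refl

firstPos-pos : ∀ i B → 1 ≤ at B 0 → firstPos i B ≡ i
firstPos-pos i (suc _ ∷ B) _ = refl

firstPos-bound : ∀ i B → firstPos i B ≡ 0 ⊎ i ≤ firstPos i B
firstPos-bound i [] = inj₁ refl
firstPos-bound i (zero ∷ B) with firstPos-bound (suc i) B
... | inj₁ eq = inj₁ eq
... | inj₂ le = inj₂ (≤-trans (n≤1+n i) le)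
firstPos-bound i (suc _ ∷ B) = inj₂ ≤-refl

firstPos-> : ∀ i B → i < firstPos i B → at B 0 ≡ 0
firstPos-> i (zero ∷ B)  _  = refl
firstPos-> i (suc _ ∷ B) lt = ⊥-elim (<-irrefl refl lt)

-- A zero row has the default value 0, and `1 ≤ i` separates it from a row that starts at i.
firstPos-≡ : ∀ i B → 1 ≤ i → firstPos i B ≡ i → 1 ≤ at B 0
firstPos-≡ (suc i) [] _ ()
firstPos-≡ i (zero ∷ B) i≥1 eq with firstPos-bound (suc i) B
... | inj₁ eq0 = ⊥-elim (<⇒≢ i≥1 (trans (sym eq0) eq))
... | inj₂ le  = ⊥-elim (1+n≰n (subst (suc i ≤_) eq le))
firstPos-≡ i (suc _ ∷ B) _ _ = s≤s z≤n

col : List (List ℕ) → ℕ → List ℕ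
col F x = map (λ B → at B x) F

tails : List (List ℕ) → List (List ℕ)
tails = map (drop 1)

at-drop : ∀ B x → at (drop 1 B) x ≡ at B (suc x)
at-drop []      x = refl
at-drop (_ ∷ B) x = refl

col-tails : ∀ F x → col (tails F) x ≡ col F (suc x)
col-tails F x = trans (sym (map-∘ F)) (map-cong (λ B → at-drop B x) F)

-- The minima are the trues of the mask, said column by column. Rows are sorted by their minima, so
-- row c is opened exactly at the next true, rows beyond the opened ones are still zero, and at the
-- end all M rows must be open.
Starts : ℕ → ℕ → List Bool → (ℕ → List ℕ) → Set
Starts M c []          κ = M ≤ c
Starts M c (true ∷ b)  κ = 1 ≤ at (κ 0) c × (∀ r → c < r → at (κ 0) r ≡ 0) × Starts M (suc c) b (κ ∘ suc)
Starts M c (false ∷ b) κ = (∀ r → c ≤ r → at (κ 0) r ≡ 0) × Starts M c b (κ ∘ suc)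

starts-cong : ∀ {M} c b {κ κ'} → (∀ x → κ x ≡ κ' x) → Starts M c b κ → Starts M c b κ'
starts-cong c []          eq s = s
starts-cong c (true ∷ b)  eq (p , q , s) =
  subst (λ l → 1 ≤ at l c) (eq 0) p , (λ r lt → trans (cong (λ l → at l r) (sym (eq 0))) (q r lt)) , starts-cong (suc c) b (eq ∘ suc) s
starts-cong c (false ∷ b) eq (q , s) =
  (λ r lt → trans (cong (λ l → at l r) (sym (eq 0))) (q r lt)) , starts-cong c b (eq ∘ suc) s

-- All remaining minima lie beyond i, so column i vanishes in these rows and can be cut off without
-- changing the minima.
unstarted-step : ∀ i b F → map (firstPos i) F ≡ truesFrom (suc i) b →
  (∀ r → at (col F 0) r ≡ 0) × map (firstPos (suc i)) (tails F) ≡ truesFrom (suc i) b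
unstarted-step i b F eq = zeros F later , trans (advance F (zeros F later)) eq
  where
  lower : ∀ F {ys} → map (firstPos i) F ≡ ys → All (suc i ≤_) ys → All (λ B → i < firstPos i B) F
  lower []      refl []       = []
  lower (B ∷ F) refl (l ∷ ls) = l ∷ lower F refl ls
  later = lower F eq (truesFrom-≥ (suc i) b)
  zeros : ∀ F → All (λ B → i < firstPos i B) F → ∀ r → at (col F 0) r ≡ 0
  zeros []      []       r       = refl
  zeros (B ∷ F) (l ∷ ls) zero    = firstPos-> i B l
  zeros (B ∷ F) (l ∷ ls) (suc r) = zeros F ls r
  advance : ∀ F → (∀ r → at (col F 0) r ≡ 0) → map (firstPos (suc i)) (tails F) ≡ map (firstPos i) F
  advance []      z = refl
  advance (B ∷ F) z = cong₂ _∷_ (sym (firstPos-zero i B (z 0))) (advance F (z ∘ suc))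

unstarted-unstep : ∀ i F → (∀ r → at (col F 0) r ≡ 0) → map (firstPos i) F ≡ map (firstPos (suc i)) (tails F)
unstarted-unstep i []      z = refl
unstarted-unstep i (B ∷ F) z = cong₂ _∷_ (firstPos-zero i B (z 0)) (unstarted-unstep i F (z ∘ suc))

mins-step-true : ∀ c i b F → 1 ≤ i → drop c (map (firstPos i) F) ≡ truesFrom i (true ∷ b) →
  1 ≤ at (col F 0) c × (∀ r → c < r → at (col F 0) r ≡ 0) × drop (suc c) (map (firstPos (suc i)) (tails F)) ≡ truesFrom (suc i) b
mins-step-true zero i b (B ∷ F) i≥1 eq =
  let (z , adv) = unstarted-step i b F (∷-injectiveʳ eq) in
  firstPos-≡ i B i≥1 (∷-injectiveˡ eq) , (λ { (suc r) _ → z r }) , adv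
mins-step-true (suc c) i b (B ∷ F) i≥1 eq =
  let (p , z , adv) = mins-step-true c i b F i≥1 eq in p , (λ { (suc r) (s≤s lt) → z r lt }) , adv

mins-step-false : ∀ c i b F → drop c (map (firstPos i) F) ≡ truesFrom i (false ∷ b) →
  (∀ r → c ≤ r → at (col F 0) r ≡ 0) × drop c (map (firstPos (suc i)) (tails F)) ≡ truesFrom (suc i) b
mins-step-false zero    i b F       eq = let (z , adv) = unstarted-step i b F eq in (λ r _ → z r) , adv
mins-step-false (suc c) i b []      eq = (λ r _ → refl) , eq
mins-step-false (suc c) i b (B ∷ F) eq =
  let (z , adv) = mins-step-false c i b F eq in (λ { (suc r) (s≤s lt) → z r lt }) , adv

mins-unstep-true : ∀ c i {ys} F → 1 ≤ at (col F 0) c → (∀ r → c < r → at (col F 0) r ≡ 0) →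
  drop (suc c) (map (firstPos (suc i)) (tails F)) ≡ ys → drop c (map (firstPos i) F) ≡ i ∷ ys
mins-unstep-true zero    i (B ∷ F) p z eq =
  cong₂ _∷_ (firstPos-pos i B p) (trans (unstarted-unstep i F (λ r → z (suc r) (s≤s z≤n))) eq)
mins-unstep-true (suc c) i (B ∷ F) p z eq = mins-unstep-true c i F p (λ r lt → z (suc r) (s≤s lt)) eq

mins-unstep-false : ∀ c i {ys} F → (∀ r → c ≤ r → at (col F 0) r ≡ 0) →
  drop c (map (firstPos (suc i)) (tails F)) ≡ ys → drop c (map (firstPos i) F) ≡ ys
mins-unstep-false zero    i F       z eq = trans (unstarted-unstep i F (λ r → z r z≤n)) eq
mins-unstep-false (suc c) i []      z eq = eq
mins-unstep-false (suc c) i (B ∷ F) z eq = mins-unstep-false c i F (λ r lt → z (suc r) (s≤s lt)) eq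

drop-≡[] : ∀ c (xs : List ℕ) → drop c xs ≡ [] → length xs ≤ c
drop-≡[] zero    [] _ = z≤n
drop-≡[] (suc c) [] _ = z≤n
drop-≡[] (suc c) (x ∷ xs) eq = s≤s (drop-≡[] c xs eq)

drop-all : ∀ c (xs : List ℕ) → length xs ≤ c → drop c xs ≡ []
drop-all zero    []       _        = refl
drop-all (suc c) []       _        = refl
drop-all (suc c) (x ∷ xs) (s≤s le) = drop-all c xs le

mins⇒Starts : ∀ c i b F → 1 ≤ i → drop c (map (firstPos i) F) ≡ truesFrom i b → Starts (length F) c b (col F)
mins⇒Starts c i [] F _ eq = subst (_≤ c) (length-map (firstPos i) F) (drop-≡[] c _ eq)
mins⇒Starts c i (true ∷ b) F i≥1 eq =
  let (p , z , adv) = mins-step-true c i b F i≥1 eq in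
  p , z , subst (λ M → Starts M (suc c) b (col F ∘ suc)) (length-map (drop 1) F)
    (starts-cong (suc c) b (col-tails F) (mins⇒Starts (suc c) (suc i) b (tails F) (s≤s z≤n) adv))
mins⇒Starts c i (false ∷ b) F i≥1 eq =
  let (z , adv) = mins-step-false c i b F eq in
  z , subst (λ M → Starts M c b (col F ∘ suc)) (length-map (drop 1) F)
    (starts-cong c b (col-tails F) (mins⇒Starts c (suc i) b (tails F) (s≤s z≤n) adv))

Starts⇒mins : ∀ c i b F → Starts (length F) c b (col F) → drop c (map (firstPos i) F) ≡ truesFrom i b
Starts⇒mins c i [] F le = drop-all c _ (subst (_≤ c) (sym (length-map (firstPos i) F)) le)
Starts⇒mins c i (true ∷ b) F (p , z , s) = mins-unstep-true c i F p z
  (Starts⇒mins (suc c) (suc i) b (tails F) (subst (λ M → Starts M (suc c) b (col (tails F))) (sym (length-map (drop 1) F))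
    (starts-cong (suc c) b (sym ∘ col-tails F) s)))
Starts⇒mins c i (false ∷ b) F (z , s) = mins-unstep-false c i F z
  (Starts⇒mins c (suc i) b (tails F) (subst (λ M → Starts M c b (col (tails F))) (sym (length-map (drop 1) F))
    (starts-cong c b (sym ∘ col-tails F) s)))

-- Admissible matrices

falses : List Bool → ℕ
falses []          = 0
falses (true ∷ b)  = falses b
falses (false ∷ b) = suc (falses b)

bounds : List Bool → List ℕ → List ℕ
bounds []          caps         = []
bounds (true ∷ b)  caps         = 1 ∷ bounds b caps
bounds (false ∷ b) []           = 0 ∷ bounds b []
bounds (false ∷ b) (cap ∷ caps) = cap ∷ bounds b caps

flags : List Bool → List Bool → List Bool
flags []          fcs        = []
flags (true ∷ b)  fcs        = false ∷ flags b fcs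
flags (false ∷ b) []         = false ∷ flags b []
flags (false ∷ b) (fc ∷ fcs) = fc ∷ flags b fcs

-- In a segmented family a block with minimum below a non-minimum b has no element above b. Reading
-- a non-minimum thus closes all rows opened so far.
next : Bool → ℕ → ℕ → ℕ
next seg lo c = if seg then c else lo

-- The assumption on `R` makes the column of a minimum a unit vector: its cap is 1, and the entry
-- that opens the row uses it up.
module Columns (R : ℕ → ℕ → Bool) (R⇒≤1 : ∀ {s} → T (R s 1) → s ≤ 1) where

  IsUnit : ℕ → List ℕ → Set
  IsUnit c l = 1 ≤ at l c × T (R (sum l) 1)

  record ColOK (lo c cap : ℕ) (fc : Bool) (l : List ℕ) : Set where
    constructor colOK
    field
      supported : ∀ r → 1 ≤ at l r → lo ≤ r × r < c
      total     : T (R (sum l) cap)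
      forced    : T fc → 1 ≤ at l 0
  open ColOK public

  -- Columns are read from left to right; c counts the blocks already opened, and blocks below lo are closed.
  Good : Bool → ℕ → ℕ → ℕ → List Bool → List ℕ → List Bool → (ℕ → List ℕ) → Set
  Good seg M lo c []          caps         fcs        κ = M ≤ c
  Good seg M lo c (true ∷ b)  caps         fcs        κ = IsUnit c (κ 0) × Good seg M lo (suc c) b caps fcs (κ ∘ suc)
  Good seg M lo c (false ∷ b) (cap ∷ caps) (fc ∷ fcs) κ = ColOK lo c cap fc (κ 0) × Good seg M (next seg lo c) c b caps fcs (κ ∘ suc)
  Good seg M lo c (false ∷ b) _            _          κ = ⊥

  good-cong : ∀ {seg M} lo c b caps fcs {κ κ'} → (∀ x → κ x ≡ κ' x) → Good seg M lo c b caps fcs κ → Good seg M lo c b caps fcs κ'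
  good-cong lo c [] caps fcs eq g = g
  good-cong lo c (true ∷ b) caps fcs eq (u , g) = subst (IsUnit c) (eq 0) u , good-cong lo (suc c) b caps fcs (eq ∘ suc) g
  good-cong {seg} lo c (false ∷ b) (cap ∷ caps) (fc ∷ fcs) eq (o , g) =
    subst (ColOK lo c cap fc) (eq 0) o , good-cong (next seg lo c) c b caps fcs (eq ∘ suc) g

  at-≤ : ∀ l c → at l c ≤ sum l
  at-≤ []      c       = z≤n
  at-≤ (x ∷ l) zero    = m≤m+n x (sum l)
  at-≤ (x ∷ l) (suc c) = ≤-trans (at-≤ l c) (m≤n+m (sum l) x)

  at-two : ∀ l {r c} → r ≢ c → at l r + at l c ≤ sum l
  at-two [] ne = z≤n
  at-two (x ∷ l) {zero}  {zero}  ne = ⊥-elim (ne refl)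
  at-two (x ∷ l) {zero}  {suc c} ne = +-monoʳ-≤ x (at-≤ l c)
  at-two (x ∷ l) {suc r} {zero}  ne = subst (_≤ x + sum l) (+-comm x (at l r)) (+-monoʳ-≤ x (at-≤ l r))
  at-two (x ∷ l) {suc r} {suc c} ne = ≤-trans (at-two l (ne ∘ cong suc)) (m≤n+m (sum l) x)

  isUnit-zero : ∀ l {c r} → IsUnit c l → r ≢ c → at l r ≡ 0
  isUnit-zero l {c} {r} (p , t) ne = n≤0⇒n≡0 (+-cancelʳ-≤ 1 (at l r) 0
    (≤-trans (+-monoʳ-≤ (at l r) p) (≤-trans (at-two l ne) (R⇒≤1 t))))

  supported-zero : ∀ {lo c cap fc l r} → ColOK lo c cap fc l → (lo ≤ r → ¬ r < c) → at l r ≡ 0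
  supported-zero {l = l} {r} o out with at l r in eq
  ... | zero  = refl
  ... | suc _ = let (p , q) = supported o r (subst (1 ≤_) (sym eq) (s≤s z≤n)) in ⊥-elim (out p q)

  -- `Closed` and `Dead` retain what segmentation says about columns already read. At a false,
  -- `Closed` for the c opened rows turns into `Dead` for the new lower bound c.
  Closed : Bool → ℕ → List Bool → (ℕ → List ℕ) → Set
  Closed seg c b κ = T seg → ∀ {r j x} → r < c → j < x → x < length b → nthB b j ≡ false → at (κ x) r ≡ 0

  Segmented : Bool → List Bool → (ℕ → List ℕ) → Set
  Segmented seg b κ = T seg → ∀ {r a j x} → a < j → j < x → x < length b → nthB b j ≡ false → 1 ≤ at (κ a) r → at (κ x) r ≡ 0

  Dead : ℕ → List Bool → (ℕ → List ℕ) → Set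
  Dead lo b κ = ∀ {r x} → r < lo → x < length b → at (κ x) r ≡ 0

  Totals : List Bool → List ℕ → (ℕ → List ℕ) → Set
  Totals b caps κ = ∀ x → x < length b → T (R (sum (κ x)) (at (bounds b caps) x))

  Forced : List Bool → List Bool → (ℕ → List ℕ) → Set
  Forced b fcs κ = ∀ x → x < length b → T (nthB (flags b fcs) x) → 1 ≤ at (κ x) 0

  starts⇒good : ∀ seg M lo c b caps fcs κ → length caps ≡ falses b → length fcs ≡ falses b → Starts M c b κ →
    Totals b caps κ → Forced b fcs κ → Segmented seg b κ → Closed seg c b κ → Dead lo b κ → Good seg M lo c b caps fcs κ
  starts⇒good seg M lo c [] caps fcs κ lc lf s tot frc sg cl dd = s
  starts⇒good seg M lo c (true ∷ b) caps fcs κ lc lf (p , z , s) tot frc sg cl dd =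
    (p , tot 0 (s≤s z≤n)) ,
    starts⇒good seg M lo (suc c) b caps fcs (κ ∘ suc) lc lf s (λ x lt → tot (suc x) (s≤s lt)) (λ x lt → frc (suc x) (s≤s lt))
      (λ t aj jx lt → sg t (s≤s aj) (s≤s jx) (s≤s lt)) cl' (λ rlt lt → dd rlt (s≤s lt))
    where
    cl' : Closed seg (suc c) b (κ ∘ suc)
    cl' t {r} r<sc jx lt mj with r ≟ c
    -- Row c was opened by the current column, so `Segmented` itself applies with a = 0.
    ... | yes refl = sg t (s≤s z≤n) (s≤s jx) (s≤s lt) mj p
    ... | no ne    = cl t (≤∧≢⇒< (m<1+n⇒m≤n r<sc) ne) (s≤s jx) (s≤s lt) mj
  starts⇒good seg M lo c (false ∷ b) (cap ∷ caps) (fc ∷ fcs) κ lc lf (z , s) tot frc sg cl dd =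
    colOK supp (tot 0 (s≤s z≤n)) (frc 0 (s≤s z≤n)) ,
    starts⇒good seg M (next seg lo c) c b caps fcs (κ ∘ suc) (suc-injective lc) (suc-injective lf) s
      (λ x lt → tot (suc x) (s≤s lt)) (λ x lt → frc (suc x) (s≤s lt))
      (λ t aj jx lt → sg t (s≤s aj) (s≤s jx) (s≤s lt)) (λ t rc jx lt → cl t rc (s≤s jx) (s≤s lt)) (dead' seg cl)
    where
    supp : ∀ r → 1 ≤ at (κ 0) r → lo ≤ r × r < c
    supp r p = ≮⇒≥ (λ r<lo → <⇒≢ p (sym (dd r<lo (s≤s z≤n)))) , ≰⇒> (λ c≤r → <⇒≢ p (sym (z r c≤r)))
    dead' : ∀ seg → Closed seg c (false ∷ b) κ → Dead (next seg lo c) b (κ ∘ suc)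
    dead' true  cl rlt lt = cl tt rlt (s≤s z≤n) (s≤s lt) refl
    dead' false cl rlt lt = dd rlt (s≤s lt)

  good⇒starts : ∀ {seg M} lo c b caps fcs κ → Good seg M lo c b caps fcs κ → Starts M c b κ
  good⇒starts lo c [] caps fcs κ g = g
  good⇒starts lo c (true ∷ b) caps fcs κ (u , g) =
    proj₁ u , (λ r lt → isUnit-zero (κ 0) u (<⇒≢ lt ∘ sym)) , good⇒starts lo (suc c) b caps fcs (κ ∘ suc) g
  good⇒starts {seg} lo c (false ∷ b) (cap ∷ caps) (fc ∷ fcs) κ (o , g) =
    (λ r le → supported-zero o (λ _ lt → <⇒≱ lt le)) , good⇒starts (next seg lo c) c b caps fcs (κ ∘ suc) g

  good⇒totals : ∀ {seg M} lo c b caps fcs κ → Good seg M lo c b caps fcs κ → Totals b caps κ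
  good⇒totals lo c (true ∷ b) caps fcs κ (u , g) zero _ = proj₂ u
  good⇒totals lo c (true ∷ b) caps fcs κ (u , g) (suc x) (s≤s lt) = good⇒totals lo (suc c) b caps fcs (κ ∘ suc) g x lt
  good⇒totals lo c (false ∷ b) (cap ∷ caps) (fc ∷ fcs) κ (o , g) zero _ = total o
  good⇒totals {seg} lo c (false ∷ b) (cap ∷ caps) (fc ∷ fcs) κ (o , g) (suc x) (s≤s lt) =
    good⇒totals (next seg lo c) c b caps fcs (κ ∘ suc) g x lt

  good⇒forced : ∀ {seg M} lo c b caps fcs κ → Good seg M lo c b caps fcs κ → Forced b fcs κ
  good⇒forced lo c (true ∷ b) caps fcs κ (u , g) (suc x) (s≤s lt) = good⇒forced lo (suc c) b caps fcs (κ ∘ suc) g x lt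
  good⇒forced lo c (false ∷ b) (cap ∷ caps) (fc ∷ fcs) κ (o , g) zero _ = forced o
  good⇒forced {seg} lo c (false ∷ b) (cap ∷ caps) (fc ∷ fcs) κ (o , g) (suc x) (s≤s lt) =
    good⇒forced (next seg lo c) c b caps fcs (κ ∘ suc) g x lt

  good⇒dead : ∀ {M} lo c b caps fcs κ → lo ≤ c → Good true M lo c b caps fcs κ → Dead lo b κ
  good⇒dead lo c (true ∷ b) caps fcs κ lc (u , g) {r} {zero} rlt _ = isUnit-zero (κ 0) u (<⇒≢ (<-≤-trans rlt lc))
  good⇒dead lo c (true ∷ b) caps fcs κ lc (u , g) {r} {suc x} rlt (s≤s lt) =
    good⇒dead lo (suc c) b caps fcs (κ ∘ suc) (m≤n⇒m≤1+n lc) g rlt lt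
  good⇒dead lo c (false ∷ b) (cap ∷ caps) (fc ∷ fcs) κ lc (o , g) {r} {zero} rlt _ = supported-zero o (λ le _ → <⇒≱ rlt le)
  good⇒dead lo c (false ∷ b) (cap ∷ caps) (fc ∷ fcs) κ lc (o , g) {r} {suc x} rlt (s≤s lt) =
    good⇒dead c c b caps fcs (κ ∘ suc) ≤-refl g (<-≤-trans rlt lc) lt

  good⇒closed : ∀ {M} lo c b caps fcs κ → lo ≤ c → Good true M lo c b caps fcs κ → Closed true c b κ
  good⇒closed lo c (true ∷ b) caps fcs κ lc (u , g) _ {r} {suc j} {suc x} rc (s≤s jx) (s≤s lt) mj =
    good⇒closed lo (suc c) b caps fcs (κ ∘ suc) (m≤n⇒m≤1+n lc) g _ (m≤n⇒m≤1+n rc) jx lt mj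
  good⇒closed lo c (false ∷ b) (cap ∷ caps) (fc ∷ fcs) κ lc (o , g) _ {r} {j} {suc x} rc jx (s≤s lt) mj =
    good⇒dead c c b caps fcs (κ ∘ suc) ≤-refl g rc lt

  good⇒segmented : ∀ {M} lo c b caps fcs κ → lo ≤ c → Good true M lo c b caps fcs κ → Segmented true b κ
  good⇒segmented lo c (true ∷ b) caps fcs κ lc (u , g) _ {r} {zero} {suc j} {suc x} aj (s≤s jx) (s≤s lt) mj p with r ≟ c
  ... | yes refl = good⇒closed lo (suc c) b caps fcs (κ ∘ suc) (m≤n⇒m≤1+n lc) g _ ≤-refl jx lt mj
  ... | no ne    = ⊥-elim (<⇒≢ p (sym (isUnit-zero (κ 0) u ne)))
  good⇒segmented lo c (true ∷ b) caps fcs κ lc (u , g) _ {r} {suc a} {suc j} {suc x} (s≤s aj) (s≤s jx) (s≤s lt) mj p =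
    good⇒segmented lo (suc c) b caps fcs (κ ∘ suc) (m≤n⇒m≤1+n lc) g _ aj jx lt mj p
  good⇒segmented lo c (false ∷ b) (cap ∷ caps) (fc ∷ fcs) κ lc (o , g) _ {r} {zero} {suc j} {suc x} aj (s≤s jx) (s≤s lt) mj p =
    good⇒closed c c b caps fcs (κ ∘ suc) ≤-refl g _ (proj₂ (supported o r p)) jx lt mj
  good⇒segmented lo c (false ∷ b) (cap ∷ caps) (fc ∷ fcs) κ lc (o , g) _ {r} {suc a} {suc j} {suc x} (s≤s aj) (s≤s jx) (s≤s lt) mj p =
    good⇒segmented c c b caps fcs (κ ∘ suc) ≤-refl g _ aj jx lt mj p

  -- Only the entries with value 0 and 1 have to be unique, because closed rows are zero and minima
  -- have unit columns; this covers both multiplicities and Booleans.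
  module Counting {A : Set} (val : A → ℕ) (zeroA oneA : A)
    (val-zeroA : val zeroA ≡ 0) (val-oneA : val oneA ≡ 1)
    (zero-val : ∀ {a} → val a ≡ 0 → a ≡ zeroA) (one-val : ∀ {a} → val a ≡ 1 → a ≡ oneA)
    (R11 : T (R 1 1)) where

    rows : ∀ {n} → List (Vec A n) → List (List ℕ)
    rows F = map (λ B → map val (toList B)) F

    unitCol : ℕ → ℕ → List A
    unitCol zero    c       = []
    unitCol (suc M) zero    = oneA ∷ replicate M zeroA
    unitCol (suc M) (suc c) = zeroA ∷ unitCol M c

    all-zero : ∀ l → sum (map val l) ≡ 0 → l ≡ replicate (length l) zeroA
    all-zero [] _ = refl
    all-zero (a ∷ l) eq = cong₂ _∷_ (zero-val (m+n≡0⇒m≡0 (val a) eq)) (all-zero l (m+n≡0⇒n≡0 (val a) eq))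

    sum-zeros : ∀ M → sum (map val (replicate M zeroA)) ≡ 0
    sum-zeros zero    = refl
    sum-zeros (suc M) = cong₂ _+_ val-zeroA (sum-zeros M)

    unit-unique : ∀ l c → 1 ≤ at (map val l) c → sum (map val l) ≤ 1 → l ≡ unitCol (length l) c
    unit-unique (a ∷ l) zero p le with val a in eq
    unit-unique (a ∷ l) zero (s≤s _) (s≤s le) | suc v =
      cong₂ _∷_ (one-val (trans eq (cong suc (m+n≡0⇒m≡0 v (n≤0⇒n≡0 le))))) (all-zero l (m+n≡0⇒n≡0 v (n≤0⇒n≡0 le)))
    unit-unique (a ∷ l) (suc c) p le = cong₂ _∷_ (zero-val va0) (unit-unique l c p (≤-trans (m≤n+m _ (val a)) le))
      where
      va0 : val a ≡ 0
      va0 = n≤0⇒n≡0 (+-cancelʳ-≤ 1 (val a) 0 (≤-trans (+-monoʳ-≤ (val a) (≤-trans p (at-≤ (map val l) c))) le))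

    unitCol-at : ∀ {M c} → c < M → at (map val (unitCol M c)) c ≡ 1
    unitCol-at {suc M} {zero}  _        = val-oneA
    unitCol-at {suc M} {suc c} (s≤s lt) = unitCol-at lt

    unitCol-sum : ∀ {M c} → c < M → sum (map val (unitCol M c)) ≡ 1
    unitCol-sum {suc M} {zero}  _        = cong₂ _+_ val-oneA (sum-zeros M)
    unitCol-sum {suc M} {suc c} (s≤s lt) = cong₂ _+_ val-zeroA (unitCol-sum lt)

    length-unitCol : ∀ M c → length (unitCol M c) ≡ M
    length-unitCol zero    c       = refl
    length-unitCol (suc M) zero    = cong suc (length-replicate M)
    length-unitCol (suc M) (suc c) = cong suc (length-unitCol M c)

    size-unit : ∀ {M c} → c < M → Size (λ l → length l ≡ M × IsUnit c (map val l)) 1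
    size-unit {M} {c} lt = Size-cong
      (λ { refl → length-unitCol M c , subst (1 ≤_) (sym (unitCol-at lt)) ≤-refl , subst (λ s → T (R s 1)) (sym (unitCol-sum lt)) R11 })
      (λ { (refl , p , t) → unit-unique _ c p (R⇒≤1 t) })
      (Size-≡ (unitCol M c))

    -- The forced entry in row 0 exhausts the cap 1, and c ≥ 1 puts row 0 among the opened rows.
    size-forced : ∀ {M c} → 1 ≤ c → c ≤ M → Size (λ l → length l ≡ M × ColOK 0 c 1 true (map val l)) 1
    size-forced {M} {c} c≥1 c≤M = Size-cong
      (λ { {l} (len , p , t) → len , colOK (λ r q → z≤n , ≤-trans (s≤s (≤-reflexive (only (map val l) p t r q))) c≥1) t (λ _ → p) })
      (λ { (len , o) → len , forced o _ , total o })
      (size-unit (≤-trans c≥1 c≤M))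
      where
      only : ∀ l → 1 ≤ at l 0 → T (R (sum l) 1) → ∀ r → 1 ≤ at l r → r ≡ 0
      only l p t zero    q = refl
      only l p t (suc r) q = ⊥-elim (<⇒≢ q (sym (isUnit-zero l (p , t) (λ ()))))

    ColSize : ℕ → ℕ → ℕ → ℕ → Bool → ℕ → Set
    ColSize M lo c cap fc s = Size (λ l → length l ≡ M × ColOK lo c cap fc (map val l)) s

    AllCols : (ℕ → ℕ → ℕ → Bool → Set) → Bool → ℕ → ℕ → List Bool → List ℕ → List Bool → Set
    AllCols P seg lo c []          caps         fcs        = ⊤
    AllCols P seg lo c (true ∷ b)  caps         fcs        = AllCols P seg lo (suc c) b caps fcs
    AllCols P seg lo c (false ∷ b) (cap ∷ caps) (fc ∷ fcs) = P lo c cap fc × AllCols P seg (next seg lo c) c b caps fcs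
    AllCols P seg lo c (false ∷ b) _            _          = ⊥

    prodSizes : (ℕ → ℕ → ℕ → Bool → ℕ) → Bool → ℕ → ℕ → List Bool → List ℕ → List Bool → ℕ
    prodSizes sz seg lo c (true ∷ b)  caps         fcs        = prodSizes sz seg lo (suc c) b caps fcs
    prodSizes sz seg lo c (false ∷ b) (cap ∷ caps) (fc ∷ fcs) = sz lo c cap fc * prodSizes sz seg (next seg lo c) c b caps fcs
    prodSizes sz seg lo c _           _            _          = 1

    col-rows-zero : ∀ {n} (F : List (Vec A (suc n))) → col (rows F) 0 ≡ map val (map V.head F)
    col-rows-zero F = trans (sym (map-∘ F)) (trans (map-cong (λ { (a V.∷ v) → refl }) F) (map-∘ F))

    col-rows-suc : ∀ {n} (F : List (Vec A (suc n))) x → col (rows F) (suc x) ≡ col (rows (map V.tail F)) x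
    col-rows-suc F x = trans (sym (map-∘ F)) (trans (map-cong (λ { (a V.∷ v) → refl }) F) (trans (map-∘ F) (map-∘ (map V.tail F))))

    head-zip : ∀ {n} l (F : List (Vec A n)) → length l ≡ length F → map V.head (zipWith V._∷_ l F) ≡ l
    head-zip []      []      _  = refl
    head-zip (a ∷ l) (v ∷ F) eq = cong (a ∷_) (head-zip l F (suc-injective eq))

    tail-zip : ∀ {n} l (F : List (Vec A n)) → length l ≡ length F → map V.tail (zipWith V._∷_ l F) ≡ F
    tail-zip []      []      _  = refl
    tail-zip (a ∷ l) (v ∷ F) eq = cong (v ∷_) (tail-zip l F (suc-injective eq))

    zip-head-tail : ∀ {n} (F : List (Vec A (suc n))) → zipWith V._∷_ (map V.head F) (map V.tail F) ≡ F
    zip-head-tail []            = refl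
    zip-head-tail ((a V.∷ v) ∷ F) = cong ((a V.∷ v) ∷_) (zip-head-tail F)

    length-zip : ∀ {n} l (F : List (Vec A n)) → length l ≡ length F → length (zipWith V._∷_ l F) ≡ length F
    length-zip []      []      _  = refl
    length-zip (a ∷ l) (v ∷ F) eq = cong suc (length-zip l F (suc-injective eq))

    -- A matrix is its first column and the rest. `Q` has to respect pointwise equality because the
    -- column functions of the two descriptions agree only pointwise.
    size-∷ : ∀ {n M s₁ s₂} {P : List ℕ → Set} {Q : (ℕ → List ℕ) → Set} → (∀ {κ κ'} → (∀ x → κ x ≡ κ' x) → Q κ → Q κ') →
      Size (λ l → length l ≡ M × P (map val l)) s₁ →
      Size (λ (F : List (Vec A n)) → length F ≡ M × Q (col (rows F))) s₂ →
      Size (λ (F : List (Vec A (suc n))) → length F ≡ M × P (col (rows F) 0) × Q (col (rows F) ∘ suc)) (s₁ * s₂)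
    size-∷ {M = M} {P = P} {Q} resp S₁ S₂ = Size-bij
      {P = λ lF → (length (proj₁ lF) ≡ M × P (map val (proj₁ lF))) × (length (proj₂ lF) ≡ M × Q (col (rows (proj₂ lF))))}
      (λ { (l , F) → zipWith V._∷_ l F }) (λ F → map V.head F , map V.tail F)
      (λ { {l , F} ((refl , p) , (eq , q)) →
        let hd = head-zip l F (sym eq)
            tl = tail-zip l F (sym eq) in
        trans (length-zip l F (sym eq)) eq ,
        subst P (sym (trans (col-rows-zero (zipWith V._∷_ l F)) (cong (map val) hd))) p ,
        resp (λ x → sym (trans (col-rows-suc (zipWith V._∷_ l F) x) (cong (λ G → col (rows G) x) tl))) q })
      (λ { {F} (refl , p , q) → (length-map V.head F , subst P (col-rows-zero F) p) , (length-map V.tail F , resp (col-rows-suc F) q) })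
      (λ { {l , F} ((refl , _) , (eq , _)) → cong₂ _,_ (head-zip l F (sym eq)) (tail-zip l F (sym eq)) })
      (λ {F} _ → zip-head-tail F)
      (Size-× S₁ S₂)

    size-empty : ∀ {M c} → M ≤ c → Size (λ (F : List (Vec A 0)) → length F ≡ M × M ≤ c) 1
    size-empty {M} M≤c = Size-cong
      (λ { refl → length-replicate M , M≤c })
      (λ { (refl , _) → only-[] _ })
      (Size-≡ (replicate M V.[]))
      where
      only-[] : (F : List (Vec A 0)) → F ≡ replicate (length F) V.[]
      only-[] []        = refl
      only-[] (V.[] ∷ F) = cong (V.[] ∷_) (only-[] F)

    -- What a column may be depends on the mask, not on the other columns, so the counts multiply.
    -- `M ≡ c + trues b` gives each true its row and ends with all rows open.
    size-good : ∀ {seg} M (sz : ℕ → ℕ → ℕ → Bool → ℕ) lo c b caps fcs n → length b ≡ n → M ≡ c + trues b →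
      AllCols (λ lo c cap fc → ColSize M lo c cap fc (sz lo c cap fc)) seg lo c b caps fcs →
      Size (λ (F : List (Vec A n)) → length F ≡ M × Good seg M lo c b caps fcs (col (rows F))) (prodSizes sz seg lo c b caps fcs)
    size-good M sz lo c [] caps fcs zero _ eq _ = size-empty (≤-reflexive (trans eq (+-identityʳ c)))
    size-good {seg} M sz lo c (true ∷ b) caps fcs (suc n) len eq ac =
      subst (Size _) (+-identityʳ _)
        (size-∷ {P = IsUnit c} {Q = Good seg M lo (suc c) b caps fcs} (good-cong lo (suc c) b caps fcs)
          (size-unit (subst (c <_) (sym eq') (s≤s (m≤m+n c (trues b)))))
          (size-good M sz lo (suc c) b caps fcs n (suc-injective len) eq' ac))
      where
      eq' : M ≡ suc c + trues b
      eq' = trans eq (+-suc c (trues b))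
    size-good {seg} M sz lo c (false ∷ b) (cap ∷ caps) (fc ∷ fcs) (suc n) len eq (s , ac) =
      size-∷ {P = ColOK lo c cap fc} {Q = Good seg M (next seg lo c) c b caps fcs} (good-cong (next seg lo c) c b caps fcs)
        s (size-good M sz (next seg lo c) c b caps fcs n (suc-injective len) eq ac)

    zeros : ∀ l → (∀ r → ¬ 1 ≤ at (map val l) r) → l ≡ replicate (length l) zeroA
    zeros [] none = refl
    zeros (a ∷ l) none = cong₂ _∷_ (zero-val (n<1⇒n≡0 (≰⇒> (none 0)))) (zeros l (none ∘ suc))

    zeros-at : ∀ M r → ¬ 1 ≤ at (map val (replicate M zeroA)) r
    zeros-at (suc M) zero    p = <⇒≢ p (sym val-zeroA)
    zeros-at (suc M) (suc r) p = zeros-at M r p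

    size-none : ∀ M cap → T (R 0 cap) → ColSize M 0 0 cap false 1
    size-none M cap t = Size-cong
      (λ { refl → length-replicate M ,
             colOK (λ r p → ⊥-elim (zeros-at M r p)) (subst (λ s → T (R s cap)) (sym (sum-zeros M)) t) (λ ()) })
      (λ { {l} (refl , o) → zeros l (λ r p → n≮0 (proj₂ (supported o r p))) })
      (Size-≡ (replicate M zeroA))

    size-none-⊥ : ∀ M cap → ¬ T (R 0 cap) → ColSize M 0 0 cap false 0
    size-none-⊥ M cap R≢ = Size-⊥ λ { {l} (refl , o) →
      R≢ (subst (λ s → T (R s cap))
        (trans (cong (sum ∘ map val) (zeros l (λ r p → n≮0 (proj₂ (supported o r p))))) (sum-zeros (length l))) (total o)) }

    ZeroHead PosHead : ℕ → ℕ → ℕ → ℕ → List A → Set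
    ZeroHead M lo c cap l = length l ≡ suc M × at (map val l) 0 ≡ 0 ×
      (∀ r → 1 ≤ at (map val l) (suc r) → lo ≤ r × r < c) × T (R (sum (map val l)) cap)
    PosHead M lo c cap l = length l ≡ suc M × 1 ≤ at (map val l) 0 ×
      (∀ r → 1 ≤ at (map val l) (suc r) → lo ≤ r × r < c) × T (R (sum (map val l)) cap)

    size-zero-head : ∀ {M lo c cap s} → ColSize M lo c cap false s → Size (ZeroHead M lo c cap) s
    size-zero-head {M} {lo} {c} {cap} = Size-bij {Q = ZeroHead M lo c cap} (zeroA ∷_) (drop 1)
      (λ { {l} (refl , o) → refl , val-zeroA , supported o , subst (λ z → T (R (z + sum (map val l)) cap)) (sym val-zeroA) (total o) })
      (λ { {a ∷ l} (len , z , sup , t) → suc-injective len , colOK sup (subst (λ z → T (R (z + sum (map val l)) cap)) z t) (λ ()) })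
      (λ _ → refl)
      (λ { {a ∷ l} (len , z , _) → cong (_∷ l) (sym (zero-val z)) })

    size-shift : ∀ {M lo c cap s} → ColSize M lo c cap false s → ColSize (suc M) (suc lo) (suc c) cap false s
    size-shift {M} {lo} {c} {cap} S = Size-cong
      (λ { {l} (len , z , sup , t) → len , colOK (λ { zero p → ⊥-elim (<⇒≢ p (sym z)) ; (suc r) p → s≤s (proj₁ (sup r p)) , s≤s (proj₂ (sup r p)) }) t (λ ()) })
      (λ { {l} (len , o) → len , n<1⇒n≡0 (≰⇒> λ p → n≮0 (proj₁ (supported o 0 p))) ,
         (λ r p → s≤s⁻¹ (proj₁ (supported o (suc r) p)) , s≤s⁻¹ (proj₂ (supported o (suc r) p))) , total o })
      (size-zero-head S)

    -- The case distinction on the entry in row 0 is the combinatorial form of Pascal's rule, to be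
    -- used in `size-ℕ` and `size-Bool`.
    size-split : ∀ {M c cap s₁ s₂} → ColSize M 0 c cap false s₁ → Size (PosHead M 0 c cap) s₂ → ColSize (suc M) 0 (suc c) cap false (s₁ + s₂)
    size-split {M} {c} {cap} S₁ S₂ = Size-cong {P = λ l → ZeroHead M 0 c cap l ⊎ PosHead M 0 c cap l}
      (λ { {l} (inj₁ (len , _ , sup , t)) → len , colOK (supp (map val l) sup) t (λ ()) ; {l} (inj₂ (len , _ , sup , t)) → len , colOK (supp (map val l) sup) t (λ ()) })
      (λ {l} → from l)
      (Size-⊎ (λ { (_ , z , _) (_ , p , _) → <⇒≢ p (sym z) }) (size-zero-head S₁) S₂)
      where
      supp : ∀ l → (∀ r → 1 ≤ at l (suc r) → 0 ≤ r × r < c) → ∀ r → 1 ≤ at l r → 0 ≤ r × r < suc c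
      supp l sup zero    p = z≤n , s≤s z≤n
      supp l sup (suc r) p = z≤n , s≤s (proj₂ (sup r p))
      from : ∀ l → length l ≡ suc M × ColOK 0 (suc c) cap false (map val l) → ZeroHead M 0 c cap l ⊎ PosHead M 0 c cap l
      from l (len , o) with at (map val l) 0 in eq
      ... | zero  = inj₁ (len , refl , (λ r p → z≤n , s≤s⁻¹ (proj₂ (supported o (suc r) p))) , total o)
      ... | suc _ = inj₂ (len , s≤s z≤n , (λ r p → z≤n , s≤s⁻¹ (proj₂ (supported o (suc r) p))) , total o)

    -- Closed rows carry only zeros and can be stripped, so only the number c - lo of open rows
    -- matters.
    size-offset : ∀ {lo c M cap} (s : ℕ → ℕ) → (∀ {M c} → c ≤ M → ColSize M 0 c cap false (s c)) →
      lo ≤ c → c ≤ M → ColSize M lo c cap false (s (c ∸ lo))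
    size-offset {zero} s S _ c≤M = S c≤M
    size-offset {suc lo} {suc c} {suc M} s S (s≤s le) (s≤s c≤M) = size-shift (size-offset s S le c≤M)

    freeSize : (ℕ → ℕ → ℕ) → ℕ → ℕ → ℕ → Bool → ℕ
    freeSize s lo c cap fc = if fc then 1 else s cap (c ∸ lo)

    module _ (s : ℕ → ℕ → ℕ) (base : ∀ {M c} cap → c ≤ M → ColSize M 0 c cap false (s cap c)) where

      allCols-free : ∀ M lo c b caps → lo ≤ c → M ≡ c + trues b → length caps ≡ falses b →
        AllCols (λ lo c cap fc → ColSize M lo c cap fc (freeSize s lo c cap fc)) true lo c b caps (replicate (length caps) false)
      allCols-free M lo c [] caps le eq len = tt
      allCols-free M lo c (true ∷ b) caps le eq len = allCols-free M lo (suc c) b caps (m≤n⇒m≤1+n le) (trans eq (+-suc c _)) len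
      allCols-free M lo c (false ∷ b) (cap ∷ caps) le eq len =
        size-offset (s cap) (base cap) le (subst (c ≤_) (sym eq) (m≤m+n c _)) , allCols-free M c c b caps ≤-refl eq (suc-injective len)

      allCols-firstForced : ∀ M c b caps → 1 ≤ c → M ≡ c + trues b → suc (length caps) ≡ falses b →
        AllCols (λ lo c cap fc → ColSize M lo c cap fc (freeSize s lo c cap fc)) true 0 c b (1 ∷ caps) (true ∷ replicate (length caps) false)
      allCols-firstForced M c (true ∷ b) caps c≥1 eq len = allCols-firstForced M (suc c) b caps (s≤s z≤n) (trans eq (+-suc c _)) len
      allCols-firstForced M c (false ∷ b) caps c≥1 eq len =
        size-forced c≥1 (subst (c ≤_) (sym eq) (m≤m+n c _)) , allCols-free M c c b caps ≤-refl eq (suc-injective len)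

-- Numbers of admissible columns

≤ᵇ-one : ∀ {s} → T (s ≤ᵇ 1) → s ≤ 1
≤ᵇ-one {s} = ≤ᵇ⇒≤ s 1

≡ᵇ-one : ∀ {s} → T (s ≡ᵇ 1) → s ≤ 1
≡ᵇ-one {s} t = ≤-reflexive (≡ᵇ⇒≡ s 1 t)

boolVal : Bool → ℕ
boolVal b = if b then 1 else 0

boolVal-zero : ∀ {b} → boolVal b ≡ 0 → b ≡ false
boolVal-zero {false} _ = refl

boolVal-one : ∀ {b} → boolVal b ≡ 1 → b ≡ true
boolVal-one {true} _ = refl

-- S: column sums are at most the cap (π₀); E: they equal the cap (σ₀, and cap 1 for set partitions).
-- ℕ, B: the entries are multiplicities in ℕ, or Booleans.
module CS = Columns _≤ᵇ_ ≤ᵇ-one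
module CE = Columns _≡ᵇ_ ≡ᵇ-one
module CℕS = CS.Counting {ℕ} id 0 1 refl refl id id tt
module CBE = CE.Counting {Bool} boolVal false true refl refl boolVal-zero boolVal-one tt

-- Multisets of at most cap of the c rows. A positive entry in row 0 is lowered by one, which lowers
-- the cap and keeps the row available.
size-ℕ : ∀ {M c} cap → c ≤ M → CℕS.ColSize M 0 c cap false ((cap + c) C c)
size-ℕ {M} {zero} cap _ = CℕS.size-none M cap tt
size-ℕ {suc M} {suc c} zero (s≤s le) = subst (CℕS.ColSize (suc M) 0 (suc c) 0 false)
  (trans (+-identityʳ _) (trans (nCn≡1 c) (sym (nCn≡1 (suc c)))))
  (CℕS.size-split (size-ℕ zero le) (Size-⊥ (λ { {x ∷ l} (_ , p , _ , t) → <⇒≱ p (≤-trans (m≤m+n x _) (≤ᵇ⇒≤ _ 0 t)) })))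
size-ℕ {suc M} {suc c} (suc cap) (s≤s le) = subst (CℕS.ColSize (suc M) 0 (suc c) (suc cap) false)
  (trans (cong (λ z → (suc cap + c) C c + z C suc c) (+-suc cap c))
    (trans (nCk+nC[k+1]≡[n+1]C[k+1] (suc cap + c) c) (cong (λ z → suc z C suc c) (sym (+-suc cap c)))))
  (CℕS.size-split (size-ℕ (suc cap) le)
    (Size-bij {Q = CℕS.PosHead M 0 c (suc cap)} inc dec
      (λ { {x ∷ l} (len , o) → len , s≤s z≤n , (λ r p → z≤n , s≤s⁻¹ (proj₂ (CS.supported o (suc r) p))) , ≤⇒≤ᵇ (s≤s (≤ᵇ⇒≤ (x + sum (map id l)) cap (CS.total o))) })
      (λ { {suc x ∷ l} (len , _ , sup , t) → len , CS.colOK (λ { zero _ → z≤n , s≤s z≤n ; (suc r) p → z≤n , s≤s (proj₂ (sup r p)) })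
             (≤⇒≤ᵇ (s≤s⁻¹ (≤ᵇ⇒≤ (suc x + sum (map id l)) (suc cap) t))) (λ ()) })
      (λ { {x ∷ l} _ → refl ; {[]} (() , _) })
      (λ { {suc x ∷ l} _ → refl })
      (size-ℕ cap (s≤s le))))
  where
  inc dec : List ℕ → List ℕ
  inc []      = []
  inc (x ∷ l) = suc x ∷ l
  dec []      = []
  dec (x ∷ l) = (x ∸ 1) ∷ l

-- Sets of exactly cap of the c rows. A true in row 0 is removed together with the row, so both cap
-- and c go down.
size-Bool : ∀ {M c} cap → c ≤ M → CBE.ColSize M 0 c cap false (c C cap)
size-Bool {M} {zero} zero _ = CBE.size-none M 0 tt
size-Bool {M} {zero} (suc cap) _ = CBE.size-none-⊥ M (suc cap) (λ ())
size-Bool {suc M} {suc c} zero (s≤s le) = CBE.size-split (size-Bool zero le)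
  (Size-⊥ (λ { {true ∷ l} (_ , p , _ , ()) ; {false ∷ l} (_ , () , _) }))
size-Bool {suc M} {suc c} (suc cap) (s≤s le) = subst (CBE.ColSize (suc M) 0 (suc c) (suc cap) false)
  (trans (+-comm (c C suc cap) _) (nCk+nC[k+1]≡[n+1]C[k+1] c cap))
  (CBE.size-split (size-Bool (suc cap) le)
    (Size-bij {Q = CBE.PosHead M 0 c (suc cap)} (true ∷_) (drop 1)
      (λ { {l} (refl , o) → refl , s≤s z≤n , CE.supported o , CE.total o })
      (λ { {true ∷ l} (len , _ , sup , t) → suc-injective len , CE.colOK sup t (λ ()) })
      (λ _ → refl)
      (λ { {true ∷ l} _ → refl ; {false ∷ l} (_ , () , _) })
      (size-Bool cap le)))

-- Products of the column counts

szS szP szJ : ℕ → ℕ → ℕ → Bool → ℕ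
szS = CℕS.freeSize (λ cap d → (cap + d) C d)
szP = CBE.freeSize (λ cap d → d C cap)
szJ lo c cap fc = if fc then 1 else c

allColsJ : ∀ M c b fcs → 1 ≤ c → M ≡ c + trues b → length fcs ≡ falses b →
  CBE.AllCols (λ lo c cap fc → CBE.ColSize M lo c cap fc (szJ lo c cap fc)) false 0 c b (replicate (length fcs) 1) fcs
allColsJ M c [] fcs c≥1 eq len = tt
allColsJ M c (true ∷ b) fcs c≥1 eq len = allColsJ M (suc c) b fcs (s≤s z≤n) (trans eq (+-suc c _)) len
allColsJ M c (false ∷ b) (true ∷ fcs) c≥1 eq len =
  CBE.size-forced c≥1 (subst (c ≤_) (sym eq) (m≤m+n c _)) , allColsJ M c b fcs c≥1 eq (suc-injective len)
allColsJ M c (false ∷ b) (false ∷ fcs) c≥1 eq len =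
  subst (CBE.ColSize M 0 c 1 false) (nC1≡n c) (size-Bool 1 (subst (c ≤_) (sym eq) (m≤m+n c _))) ,
  allColsJ M c b fcs c≥1 eq (suc-injective len)

kernelS-≡ : ∀ t i i' → 2 ≤ t → i ≤ i' → (t ∸ 2 + (i' ∸ i)) C (i' ∸ i) ≡ kernelS t i i'
kernelS-≡ (suc (suc t)) i i' _ le = cong (_C (i' ∸ i)) (sym (cong (_∸ 2) (+-∸-assoc (suc (suc t)) le)))
kernelS-≡ (suc zero) i i' (s≤s ()) le

-- lo is the number of minima below the previous non-minimum, hence the index preceding the code.
-- The false at the end is the element n + 1, above all minima, and supplies the last index c +
-- `trues b`.
prodSizesS-tail : ∀ lo c b ts → lo ≤ c → All (2 ≤_) ts → length ts ≡ suc (falses b) →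
  CℕS.prodSizes szS true lo c (b ++ false ∷ []) (map (_∸ 2) ts) (replicate (length (map (_∸ 2) ts)) false)
    ≡ product (zipWith3 kernelS ts (lo ∷ code id c b) (code id c b ++ (c + trues b) ∷ []))
prodSizesS-tail lo c [] (t ∷ []) le (t≥2 ∷ _) len =
  cong (_* 1) (trans (kernelS-≡ t lo c t≥2 le) (cong (kernelS t lo) (sym (+-identityʳ c))))
prodSizesS-tail lo c (true ∷ b) ts le ps len =
  trans (prodSizesS-tail lo (suc c) b ts (m≤n⇒m≤1+n le) ps len)
    (cong (λ z → product (zipWith3 kernelS ts (lo ∷ code id (suc c) b) (code id (suc c) b ++ z ∷ []))) (sym (+-suc c (trues b))))
prodSizesS-tail lo c (false ∷ b) (t ∷ ts) le (t≥2 ∷ ps) len =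
  cong₂ _*_ (kernelS-≡ t lo c t≥2 le) (prodSizesS-tail c c b ts ≤-refl ps (suc-injective len))

-- x_1 is forced and contributes 1, so the first label is used only at the next non-minimum.
prodSizesS : ∀ c b ts → All (2 ≤_) ts → 1 ≤ falses b → length ts ≡ falses b →
  CℕS.prodSizes szS true 0 c (b ++ false ∷ []) (1 ∷ map (_∸ 2) ts) (true ∷ replicate (length (map (_∸ 2) ts)) false)
    ≡ product (zipWith3 kernelS ts (code id c b) (drop 1 (code id c b) ++ (c + trues b) ∷ []))
prodSizesS c (true ∷ b) ts ps f≥1 len =
  trans (prodSizesS (suc c) b ts ps f≥1 len)
    (cong (λ z → product (zipWith3 kernelS ts (code id (suc c) b) (drop 1 (code id (suc c) b) ++ z ∷ []))) (sym (+-suc c (trues b))))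
prodSizesS c (false ∷ b) ts ps _ len = trans (+-identityʳ _) (prodSizesS-tail c c b ts ≤-refl ps len)

suc[m+n]∸m∸1≡n : ∀ m n → suc (m + n) ∸ m ∸ 1 ≡ n
suc[m+n]∸m∸1≡n m n = cong (_∸ 1) (trans (cong (_∸ m) (sym (+-suc m n))) (m+n∸m≡n m (suc n)))

-- c counts minima while p counts positions, and q is the previous index. The hypothesis on p says
-- that all positions strictly between q and p are minima, so the c - lo open rows number p - q - 1.
prodSizesP-tail : ∀ lo c p q b ts → lo ≤ c → p ≡ suc (q + (c ∸ lo)) → length ts ≡ suc (falses b) →
  CBE.prodSizes szP true lo c (b ++ false ∷ []) (map (_∸ 2) ts) (replicate (length (map (_∸ 2) ts)) false)
    ≡ product (zipWith3 kernelP ts (q ∷ code suc p b) (code suc p b ++ (p + length b) ∷ []))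
prodSizesP-tail lo c p q [] (t ∷ []) le eq len =
  cong (λ z → (z C (t ∸ 2)) * 1) (sym (trans (cong (λ z → z ∸ q ∸ 1) (trans (+-identityʳ p) eq)) (suc[m+n]∸m∸1≡n q (c ∸ lo))))
prodSizesP-tail lo c p q (true ∷ b) ts le eq len =
  trans (prodSizesP-tail lo (suc c) (suc p) q b ts (m≤n⇒m≤1+n le)
      (cong suc (trans eq (trans (sym (+-suc q (c ∸ lo))) (cong (q +_) (sym (+-∸-assoc 1 le)))))) len)
    (cong (λ z → product (zipWith3 kernelP ts (q ∷ code suc (suc p) b) (code suc (suc p) b ++ z ∷ []))) (sym (+-suc p (length b))))
prodSizesP-tail lo c p q (false ∷ b) (t ∷ ts) le eq len =
  cong₂ _*_ (cong (_C (t ∸ 2)) (sym (trans (cong (λ z → z ∸ q ∸ 1) eq) (suc[m+n]∸m∸1≡n q (c ∸ lo)))))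
    (trans (prodSizesP-tail c c (suc p) p b ts ≤-refl (cong suc (trans (sym (+-identityʳ p)) (cong (p +_) (sym (n∸n≡0 c))))) (suc-injective len))
      (cong (λ z → product (zipWith3 kernelP ts (p ∷ code suc (suc p) b) (code suc (suc p) b ++ z ∷ []))) (sym (+-suc p (length b)))))

prodSizesP : ∀ c p b ts → 1 ≤ falses b → length ts ≡ falses b →
  CBE.prodSizes szP true 0 c (b ++ false ∷ []) (1 ∷ map (_∸ 2) ts) (true ∷ replicate (length (map (_∸ 2) ts)) false)
    ≡ product (zipWith3 kernelP ts (code suc p b) (drop 1 (code suc p b) ++ (p + length b) ∷ []))
prodSizesP c p (true ∷ b) ts f≥1 len =
  trans (prodSizesP (suc c) (suc p) b ts f≥1 len)
    (cong (λ z → product (zipWith3 kernelP ts (code suc (suc p) b) (drop 1 (code suc (suc p) b) ++ z ∷ []))) (sym (+-suc p (length b))))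
prodSizesP c p (false ∷ b) ts _ len = trans (+-identityʳ _)
  (trans (prodSizesP-tail c c (suc p) p b ts ≤-refl (cong suc (trans (sym (+-identityʳ p)) (cong (p +_) (sym (n∸n≡0 c))))) len)
    (cong (λ z → product (zipWith3 kernelP ts (p ∷ code suc (suc p) b) (code suc (suc p) b ++ z ∷ []))) (sym (+-suc p (length b)))))

-- The number of j-th components: is lists the free choices of the non-minima, and those with a < j are forced.
choices : ℕ → List ℕ → List ℕ → ℕ
choices j is as = product (zipWith (λ i a → if a <ᵇ j then 1 else i) is as)

prodSizesJ : ∀ j c b as → length as ≡ falses b →
  CBE.prodSizes szJ false 0 c b (replicate (length (map (_<ᵇ j) as)) 1) (map (_<ᵇ j) as) ≡ choices j (code id c b) as
prodSizesJ j c [] as len = refl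
prodSizesJ j c (true ∷ b) as len = prodSizesJ j (suc c) b as len
prodSizesJ j c (false ∷ b) (a ∷ as) len = cong ((if a <ᵇ j then 1 else c) *_) (prodSizesJ j c b as (suc-injective len))

prodFrom : ℕ → ℕ → (ℕ → ℕ) → ℕ
prodFrom j zero    f = 1
prodFrom j (suc M) f = f j * prodFrom (suc j) M f

prodFrom-one : ∀ j M → prodFrom j M (λ _ → 1) ≡ 1
prodFrom-one j zero    = refl
prodFrom-one j (suc M) = trans (+-identityʳ _) (prodFrom-one (suc j) M)

prodFrom-* : ∀ j M f g → prodFrom j M (λ j → f j * g j) ≡ prodFrom j M f * prodFrom j M g
prodFrom-* j zero    f g = refl
prodFrom-* j (suc M) f g rewrite prodFrom-* (suc j) M f g = [m*n]*[o*p]≡[m*o]*[n*p] (f j) (g j) _ _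

prodFrom-power : ∀ j M a i → a < j + M → prodFrom j M (λ j → if a <ᵇ j then 1 else i) ≡ i ^ (suc a ∸ j)
prodFrom-power j zero a i lt = cong (i ^_) (sym (m≤n⇒m∸n≡0 (subst (a <_) (+-identityʳ j) lt)))
prodFrom-power j (suc M) a i lt with a <? j
... | yes a<j rewrite <⇒<ᵇ-true a<j = trans (+-identityʳ _)
  (trans (prodFrom-power (suc j) M a i (subst (a <_) (+-suc j M) lt)) (cong (i ^_) (trans (m≤n⇒m∸n≡0 (<⇒≤ a<j)) (sym (m≤n⇒m∸n≡0 a<j)))))
... | no a≮j rewrite ≮⇒<ᵇ-false a≮j =
  trans (cong (i *_) (prodFrom-power (suc j) M a i (subst (a <_) (+-suc j M) lt))) (cong (i ^_) (sym (+-∸-assoc 1 (≮⇒≥ a≮j))))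

-- A non-minimum with label a is free in the components 1, ..., a and forced in the others; over all
-- M components it contributes the power with exponent a.
prodFrom-choices : ∀ M is as → All (_≤ M) as → prodFrom 1 M (λ j → choices j is as) ≡ product (zipWith _^_ is as)
prodFrom-choices M []       as       les = prodFrom-one 1 M
prodFrom-choices M (i ∷ is) []       les = prodFrom-one 1 M
prodFrom-choices M (i ∷ is) (a ∷ as) (le ∷ les) =
  trans (prodFrom-* 1 M (λ j → if a <ᵇ j then 1 else i) (λ j → choices j is as))
    (cong₂ _*_ (prodFrom-power 1 M a i (s≤s le)) (prodFrom-choices M is as les))

-- The conditions on families in terms of columns

eqList⇒≡ : ∀ xs ys → T (eqList xs ys) → xs ≡ ys
eqList⇒≡ []       []       _ = refl
eqList⇒≡ (x ∷ xs) (y ∷ ys) t =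
  let (p , q) = T-∧⁻ {x ≡ᵇ y} t in cong₂ _∷_ (≡ᵇ⇒≡ x y p) (eqList⇒≡ xs ys q)

eqList-refl : ∀ xs → T (eqList xs xs)
eqList-refl []       = tt
eqList-refl (x ∷ xs) = T-∧⁺ {x ≡ᵇ x} (≡⇒≡ᵇ x x refl) (eqList-refl xs)

sim⇒common-row : ∀ F x y → T (simF F (suc x) (suc y)) → ∃ λ r → 1 ≤ at (col F x) r × 1 ≤ at (col F y) r
sim⇒common-row F x y t = go F (Any.any⁻ _ F t)
  where
  go : ∀ F → Any (λ B → T ((1 ≤ᵇ at B x) ∧ (1 ≤ᵇ at B y))) F → ∃ λ r → 1 ≤ at (col F x) r × 1 ≤ at (col F y) r
  go (B ∷ F) (here p) = let (q , q') = T-∧⁻ {1 ≤ᵇ at B x} p in 0 , ≤ᵇ⇒≤ 1 _ q , ≤ᵇ⇒≤ 1 _ q'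
  go (B ∷ F) (there p) = let (r , q) = go F p in suc r , q

common-row⇒sim : ∀ F x y r → 1 ≤ at (col F x) r → 1 ≤ at (col F y) r → T (simF F (suc x) (suc y))
common-row⇒sim F x y r p q = Any.any⁺ _ (go F r p q)
  where
  go : ∀ F r → 1 ≤ at (col F x) r → 1 ≤ at (col F y) r → Any (λ B → T ((1 ≤ᵇ at B x) ∧ (1 ≤ᵇ at B y))) F
  go (B ∷ F) zero    p q = here (T-∧⁺ {1 ≤ᵇ at B x} (≤⇒≤ᵇ p) (≤⇒≤ᵇ q))
  go (B ∷ F) (suc r) p q = there (go F r p q)

starts-first-row : ∀ {M b κ r} → Starts M 0 (true ∷ b) κ → 1 ≤ at (κ 0) r → r ≡ 0
starts-first-row {r = zero}  _           p = refl
starts-first-row {r = suc r} (_ , z , _) p = ⊥-elim (<⇒≢ p (sym (z (suc r) (s≤s z≤n))))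

-- The element 1 opens row 0 and occurs in no other row, so a common block with 1 can only be that
-- row.
sim-one⇒row-zero : ∀ {M b} F x → Starts M 0 (true ∷ b) (col F) → T (simF F (suc x) 1) → 1 ≤ at (col F x) 0
sim-one⇒row-zero F x s t with sim⇒common-row F x 0 t
... | r , p , q = subst (λ r → 1 ≤ at (col F x) r) (starts-first-row {κ = col F} s q) p

familyOK-mins : ∀ F b → minsF F ≡ truesFrom 1 b → T (familyOK F)
familyOK-mins F b eq = T-∧⁺ {all nonemptyBlock F} (All.all⁻ nonemptyBlock (nonempty F eq (truesFrom-≥ 1 b)))
  (subst (T ∘ strictlyIncreasing) (sym eq) (Chain⇒strictlyIncreasing (truesFrom-increasing 1 b)))
  where
  nonempty-block : ∀ i B → 1 ≤ firstPos i B → T (nonemptyBlock B)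
  nonempty-block i (zero ∷ B)  p = nonempty-block (suc i) B p
  nonempty-block i (suc _ ∷ B) p = tt
  nonempty : ∀ F {ys} → minsF F ≡ ys → All (1 ≤_) ys → All (T ∘ nonemptyBlock) F
  nonempty []      refl []       = []
  nonempty (B ∷ F) refl (p ∷ ps) = nonempty-block 1 B (subst (1 ≤_) (minBlock≡firstPos B) p) ∷ nonempty F refl ps

module SegmentedSpec (R : ℕ → ℕ → Bool) (R⇒≤1 : ∀ {s} → T (R s 1) → s ≤ 1) where
  open Columns R R⇒≤1

  segmented⇒ : ∀ F b → minsF F ≡ truesFrom 1 b → T (segmented (length b) F) → Segmented true b (col F)
  segmented⇒ F b eq t _ {r} {a} {j} {x} aj jx lt mj p with at (col F x) r in eqx
  ... | zero  = refl
  ... | suc _ = ⊥-elim (subst T (trans (trans (cong (memb (suc j)) eq) (memb-truesFrom 1 b j)) mj) isMin)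
    where
    isMin : T (memb (suc j) (minsF F))
    isMin = T-not∨⁻
      (T-all⁻ _ rg (T-all⁻ _ rg (T-all⁻ _ rg t
        (s≤s z≤n , <-trans aj (<-trans jx lt))) (s≤s z≤n , <-trans jx lt)) (s≤s z≤n , lt))
      (T-∧⁺ {suc a <ᵇ suc j} (<⇒<ᵇ (s≤s aj)) (T-∧⁺ {suc j <ᵇ suc x} (<⇒<ᵇ (s≤s jx))
        (common-row⇒sim F a x r p (subst (1 ≤_) (sym eqx) (s≤s z≤n)))))
      where rg = enumerates-range (length b)

  ⇒segmented : ∀ F b → minsF F ≡ truesFrom 1 b → Segmented true b (col F) → T (segmented (length b) F)
  ⇒segmented F b eq sg =
    T-all⁺ _ rg λ { {suc a} _ → T-all⁺ _ rg λ { {suc j} _ → T-all⁺ _ rg λ { {suc x} (_ , x<) → T-not∨⁺ λ t →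
      let (aj , t') = T-∧⁻ {suc a <ᵇ suc j} t
          (jx , sm) = T-∧⁻ {suc j <ᵇ suc x} t'
          (r , p , q) = sim⇒common-row F a x sm
      in subst T (sym (trans (cong (memb (suc j)) eq) (memb-truesFrom 1 b j)))
           (isTrue (nthB b j) λ mj → <⇒≢ q (sym (sg tt (<ᵇ⇒< a j aj) (<ᵇ⇒< j x jx) x< mj p))) } ; {zero} (() , _) } ; {zero} (() , _) }
    where
    rg = enumerates-range (length b)
    isTrue : ∀ b → ¬ b ≡ false → T b
    isTrue true  _  = tt
    isTrue false ne = ne refl

-- The component with index 0

truesFrom-snoc : ∀ i b → truesFrom i (b ++ false ∷ []) ≡ truesFrom i b
truesFrom-snoc i []          = refl
truesFrom-snoc i (true ∷ b)  = cong (i ∷_) (truesFrom-snoc (suc i) b)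
truesFrom-snoc i (false ∷ b) = truesFrom-snoc (suc i) b

falsesFrom-snoc : ∀ i b → falsesFrom i (b ++ false ∷ []) ≡ falsesFrom i b ++ (i + length b) ∷ []
falsesFrom-snoc i []          = cong (_∷ []) (sym (+-identityʳ i))
falsesFrom-snoc i (true ∷ b)  = trans (falsesFrom-snoc (suc i) b) (cong (λ z → falsesFrom (suc i) b ++ z ∷ []) (sym (+-suc i (length b))))
falsesFrom-snoc i (false ∷ b) = cong (i ∷_) (trans (falsesFrom-snoc (suc i) b) (cong (λ z → falsesFrom (suc i) b ++ z ∷ []) (sym (+-suc i (length b)))))

falses-snoc : ∀ b → falses (b ++ false ∷ []) ≡ suc (falses b)
falses-snoc []          = refl
falses-snoc (true ∷ b)  = falses-snoc b
falses-snoc (false ∷ b) = cong suc (falses-snoc b)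

trues-snoc : ∀ b → trues (b ++ false ∷ []) ≡ trues b
trues-snoc []          = refl
trues-snoc (true ∷ b)  = cong suc (trues-snoc b)
trues-snoc (false ∷ b) = trues-snoc b

length-snoc : ∀ (b : List Bool) → length (b ++ false ∷ []) ≡ suc (length b)
length-snoc b = trans (length-++ b) (+-comm (length b) 1)

falses-falsesFrom : ∀ i b → length (falsesFrom i b) ≡ falses b
falses-falsesFrom i []          = refl
falses-falsesFrom i (true ∷ b)  = falses-falsesFrom (suc i) b
falses-falsesFrom i (false ∷ b) = cong suc (falses-falsesFrom (suc i) b)

capAt : ℕ → ℕ → ℕ → ℕ
capAt u y cap = if u ≡ᵇ y then cap else 0

sum-capAt-absent : ∀ {u ys} caps → All (u <_) ys → sum (zipWith (capAt u) ys caps) ≡ 0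
sum-capAt-absent caps []           = refl
sum-capAt-absent []   (lt ∷ lts)   = refl
sum-capAt-absent (cap ∷ caps) (lt ∷ lts) rewrite ≢⇒≡ᵇ-false (<⇒≢ lt) = sum-capAt-absent caps lts

bounds-at : ∀ i b caps x → length caps ≡ falses b → x < length b →
  (if memb (i + x) (truesFrom i b) then 1 else 0) + sum (zipWith (capAt (i + x)) (falsesFrom i b) caps) ≡ at (bounds b caps) x
bounds-at i (true ∷ b) caps zero len lt rewrite +-identityʳ i | ≡ᵇ-refl i = cong suc (sum-capAt-absent caps (falsesFrom-≥ (suc i) b))
bounds-at i (true ∷ b) caps (suc x) len (s≤s lt)
  rewrite ≢⇒≡ᵇ-false {i + suc x} {i} (m+1+n≢m i) | +-suc i x = bounds-at (suc i) b caps x len lt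
bounds-at i (false ∷ b) (cap ∷ caps) zero len lt
  rewrite +-identityʳ i | memb-absent (truesFrom-≥ (suc i) b) | ≡ᵇ-refl i | sum-capAt-absent caps (falsesFrom-≥ (suc i) b) = +-identityʳ cap
bounds-at i (false ∷ b) (cap ∷ caps) (suc x) len (s≤s lt)
  rewrite ≢⇒≡ᵇ-false {i + suc x} {i} (m+1+n≢m i) | +-suc i x = bounds-at (suc i) b caps x (suc-injective len) lt

zipWith-capAt : ∀ u ys ts → zipWith (capAt u) ys (map (_∸ 2) ts) ≡ zipWith (λ y ti → if u ≡ᵇ y then ti ∸ 2 else 0) ys ts
zipWith-capAt u []       ts       = refl
zipWith-capAt u (y ∷ ys) []       = refl
zipWith-capAt u (y ∷ ys) (t ∷ ts) = cong (_ ∷_) (zipWith-capAt u ys ts)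

-- The single copy of x_1 acts as a cap 1 in front of the caps t_i - 2. The non-minima of the mask
-- extended by n + 1 then match the caps entry by entry, t_i going to x_{i+1}.
boundMult-at : ∀ b ts x → 1 ≤ falses b → length ts ≡ falses b → x < suc (length b) →
  boundMult (length b) ts (truesFrom 1 b) (falsesFrom 1 b) (suc x) ≡ at (bounds (b ++ false ∷ []) (1 ∷ map (_∸ 2) ts)) x
boundMult-at b ts x f≥1 len lt with falsesFrom 1 b in eq | falses-falsesFrom 1 b
... | [] | z = ⊥-elim (<⇒≢ f≥1 z)
... | y ∷ ys | _ = begin
  I + capAt u y 1 + sum (zipWith (λ y ti → if u ≡ᵇ y then ti ∸ 2 else 0) (ys ++ suc (length b) ∷ []) ts)
    ≡⟨ cong₂ (λ z w → z + capAt u y 1 + sum w) (cong (λ l → if memb u l then 1 else 0) (sym (truesFrom-snoc 1 b)))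
         (sym (zipWith-capAt u (ys ++ suc (length b) ∷ []) ts)) ⟩
  I' + capAt u y 1 + sum (zipWith (capAt u) (ys ++ suc (length b) ∷ []) (map (_∸ 2) ts))
    ≡⟨ +-assoc I' _ _ ⟩
  I' + sum (zipWith (capAt u) (y ∷ ys ++ suc (length b) ∷ []) (1 ∷ map (_∸ 2) ts))
    ≡⟨ cong (λ l → I' + sum (zipWith (capAt u) l (1 ∷ map (_∸ 2) ts))) (sym (trans (falsesFrom-snoc 1 b) (cong (_++ suc (length b) ∷ []) eq))) ⟩
  I' + sum (zipWith (capAt u) (falsesFrom 1 (b ++ false ∷ [])) (1 ∷ map (_∸ 2) ts))
    ≡⟨ bounds-at 1 (b ++ false ∷ []) (1 ∷ map (_∸ 2) ts) x
         (trans (cong suc (trans (length-map (_∸ 2) ts) len)) (sym (falses-snoc b))) (subst (x <_) (sym (length-snoc b)) lt) ⟩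
  at (bounds (b ++ false ∷ []) (1 ∷ map (_∸ 2) ts)) x ∎
  where
  u = suc x
  I = if memb u (truesFrom 1 b) then 1 else 0
  I' = if memb u (truesFrom 1 (b ++ false ∷ [])) then 1 else 0

flags-false : ∀ b k x → ¬ T (nthB (flags b (replicate k false)) x)
flags-false (true ∷ b)  k       (suc x) t = flags-false b k x t
flags-false (false ∷ b) (suc k) (suc x) t = flags-false b k x t
flags-false (false ∷ b) zero    (suc x) t = flags-false b zero x t

flags-first : ∀ i b k x → T (nthB (flags b (true ∷ replicate k false)) x) → at (falsesFrom i b) 0 ≡ i + x
flags-first i (true ∷ b) k (suc x) t = trans (flags-first (suc i) b k x t) (sym (+-suc i x))
flags-first i (false ∷ b) k zero t = sym (+-identityʳ i)
flags-first i (false ∷ b) k (suc x) t = ⊥-elim (flags-false b k x t)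

first-flag : ∀ i b fcs → 1 ≤ falses b → ∃ λ x → x < length b × at (falsesFrom i b) 0 ≡ i + x × T (nthB (flags b (true ∷ fcs)) x)
first-flag i (true ∷ b) fcs f≥1 = let (x , lt , eq , t) = first-flag (suc i) b fcs f≥1 in suc x , s≤s lt , trans eq (sym (+-suc i x)) , t
first-flag i (false ∷ b) fcs f≥1 = 0 , s≤s z≤n , sym (+-identityʳ i) , tt

at-snoc : ∀ xs {z} → 1 ≤ length xs → at (xs ++ z ∷ []) 0 ≡ at xs 0
at-snoc (x ∷ xs) _ = refl

module F0Spec (R : ℕ → ℕ → Bool) (R⇒≤1 : ∀ {s} → T (R s 1) → s ≤ 1) where
  open Columns R R⇒≤1
  open SegmentedSpec R R⇒≤1

  -- Definitionally the last five conjuncts of `isPartSystem` and `isPermSystem`, for `R` being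
  -- `_≤ᵇ_` and `_≡ᵇ_`, so one analysis serves both.
  f0Check : ℕ → List ℕ → List ℕ → List ℕ → List (List ℕ) → Bool
  f0Check n ts mins xs F = familyOK F ∧ segmented (suc n) F ∧ eqList (minsF F) mins ∧ simF F (at1 xs 1) 1
    ∧ all (λ u → R (multF F u) (boundMult n ts mins xs u)) (range (suc n))

  module _ (b₀ : List Bool) (ts : List ℕ) (f≥1 : 1 ≤ falses b₀) (len : length ts ≡ falses b₀) where

    b b' : List Bool
    b  = true ∷ b₀
    b' = b ++ false ∷ []

    caps : List ℕ
    caps = 1 ∷ map (_∸ 2) ts

    fcs : List Bool
    fcs = true ∷ replicate (length (map (_∸ 2) ts)) false

    firstFalse : at1 (falsesFrom 1 b) 1 ≡ at (falsesFrom 1 b') 0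
    firstFalse = sym (trans (cong (λ l → at l 0) (falsesFrom-snoc 1 b)) (at-snoc (falsesFrom 1 b) (subst (1 ≤_) (sym (falses-falsesFrom 1 b)) f≥1)))

    caps-length : length caps ≡ falses b'
    caps-length = trans (cong suc (trans (length-map (_∸ 2) ts) len)) (sym (falses-snoc b))

    fcs-length : length fcs ≡ falses b'
    fcs-length = trans (cong suc (length-replicate (length (map (_∸ 2) ts)))) caps-length

    f0⇒good : ∀ F → T (f0Check (length b) ts (truesFrom 1 b) (falsesFrom 1 b) F) →
      length F ≡ trues b × Good true (trues b) 0 0 b' caps fcs (col F)
    f0⇒good F t₀ = lenF , starts⇒good true (trues b) 0 0 b' caps fcs (col F) caps-length fcs-length starts tot frc
        (segmented⇒ F b' mins (subst (λ n → T (segmented n F)) (sym (length-snoc b)) sg)) (λ _ ()) (λ ())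
      where
      t₁ = proj₂ (T-∧⁻ {familyOK F} t₀)
      sg = proj₁ (T-∧⁻ {segmented (suc (length b)) F} t₁)
      t₂ = proj₂ (T-∧⁻ {segmented (suc (length b)) F} t₁)
      mins₀ = eqList⇒≡ (minsF F) (truesFrom 1 b) (proj₁ (T-∧⁻ {eqList (minsF F) (truesFrom 1 b)} t₂))
      t₃ = proj₂ (T-∧⁻ {eqList (minsF F) (truesFrom 1 b)} t₂)
      sm = proj₁ (T-∧⁻ {simF F (at1 (falsesFrom 1 b) 1) 1} t₃)
      bd = proj₂ (T-∧⁻ {simF F (at1 (falsesFrom 1 b) 1) 1} t₃)
      mins : minsF F ≡ truesFrom 1 b'
      mins = trans mins₀ (sym (truesFrom-snoc 1 b))
      lenF : length F ≡ trues b
      lenF = trans (sym (length-map minBlock F)) (trans (cong length mins₀) (length-truesFrom 1 b))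
      starts : Starts (trues b) 0 b' (col F)
      starts = subst (λ M → Starts M 0 b' (col F)) lenF (mins⇒Starts 0 1 b' F ≤-refl (trans (sym (minsF≡ F)) mins))
      tot : Totals b' caps (col F)
      tot x lt = subst (λ z → T (R (sum (col F x)) z)) (boundMult-at b ts x f≥1 len lt')
        (T-all⁻ (λ u → R (multF F u) (boundMult (length b) ts (truesFrom 1 b) (falsesFrom 1 b) u)) (enumerates-range (suc (length b))) bd (s≤s z≤n , lt'))
        where lt' = subst (x <_) (length-snoc b) lt
      frc : Forced b' fcs (col F)
      frc x lt fl = sim-one⇒row-zero F x starts
        (subst (λ y → T (simF F y 1)) (trans firstFalse (flags-first 1 b' (length (map (_∸ 2) ts)) x fl)) sm)

    good⇒f0 : ∀ F → length F ≡ trues b → Good true (trues b) 0 0 b' caps fcs (col F) →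
      T (f0Check (length b) ts (truesFrom 1 b) (falsesFrom 1 b) F)
    good⇒f0 F lenF g =
      T-∧⁺ {familyOK F} (familyOK-mins F b' mins)
      (T-∧⁺ {segmented (suc (length b)) F}
        (subst (λ n → T (segmented n F)) (length-snoc b) (⇒segmented F b' mins (good⇒segmented 0 0 b' caps fcs (col F) z≤n g)))
      (T-∧⁺ {eqList (minsF F) (truesFrom 1 b)}
        (subst (λ l → T (eqList (minsF F) l)) (trans mins (truesFrom-snoc 1 b)) (eqList-refl (minsF F)))
      (T-∧⁺ {simF F (at1 (falsesFrom 1 b) 1) 1} sm
        (T-all⁺ _ (enumerates-range (suc (length b))) bd))))
      where
      starts : Starts (length F) 0 b' (col F)
      starts = subst (λ M → Starts M 0 b' (col F)) (sym lenF) (good⇒starts 0 0 b' caps fcs (col F) g)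
      mins : minsF F ≡ truesFrom 1 b'
      mins = trans (minsF≡ F) (Starts⇒mins 0 1 b' F starts)
      sm : T (simF F (at1 (falsesFrom 1 b) 1) 1)
      sm with first-flag 1 b' (replicate (length (map (_∸ 2) ts)) false) (subst (1 ≤_) (sym (falses-snoc b)) (s≤s z≤n))
      ... | x , lt , eq , fl = subst (λ y → T (simF F y 1)) (sym (trans firstFalse eq))
        (common-row⇒sim F x 0 0 (good⇒forced 0 0 b' caps fcs (col F) g x lt fl) (proj₁ starts))
      bd : ∀ {u} → InRange (suc (length b)) u → T (R (multF F u) (boundMult (length b) ts (truesFrom 1 b) (falsesFrom 1 b) u))
      bd {suc x} (_ , lt) = subst (λ z → T (R (sum (col F x)) z)) (sym (boundMult-at b ts x f≥1 len lt))
        (good⇒totals 0 0 b' caps fcs (col F) g x (subst (x <_) (sym (length-snoc b)) lt))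

module F0S = F0Spec _≤ᵇ_ ≤ᵇ-one
module F0P = F0Spec _≡ᵇ_ ≡ᵇ-one

-- Set partitions as matrices

boolEntry : ∀ l x → indicator (1 ≤ᵇ at (boolMult l) x) ≡ at (boolMult l) x
boolEntry []          x       = refl
boolEntry (true ∷ l)  zero    = refl
boolEntry (false ∷ l) zero    = refl
boolEntry (_ ∷ l)     (suc x) = boolEntry l x

countᵇ-col : ∀ (ls : List (List Bool)) x → countᵇ (inBlock (suc x)) (map boolMult ls) ≡ sum (col (map boolMult ls) x)
countᵇ-col ls x = trans (countᵇ-sum (inBlock (suc x)) (map boolMult ls))
  (cong sum (trans (sym (map-∘ ls)) (trans (map-cong (λ l → boolEntry l x) ls) (map-∘ ls))))

bounds-ones : ∀ b k x → k ≡ falses b → x < length b → at (bounds b (replicate k 1)) x ≡ 1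
bounds-ones (true ∷ b)  k       zero    _  _        = refl
bounds-ones (true ∷ b)  k       (suc x) eq (s≤s lt) = bounds-ones b k x eq lt
bounds-ones (false ∷ b) (suc k) zero    _  _        = refl
bounds-ones (false ∷ b) (suc k) (suc x) eq (s≤s lt) = bounds-ones b k x (suc-injective eq) lt

-- The side conditions come as pairs (x_i, a_i), whereas columns are read by position; `flags` puts
-- the truth value of a_i < j at the position of x_i.
zip⇒flags : ∀ j {P : ℕ → Set} i b as → (∀ {y a} → (y , a) ∈ zip (falsesFrom i b) as → T (a <ᵇ j) → P y) →
  ∀ x → T (nthB (flags b (map (_<ᵇ j) as)) x) → P (i + x)
zip⇒flags j {P = P} i (true ∷ b) as f (suc x) t = subst P (sym (+-suc i x)) (zip⇒flags j {P = P} (suc i) b as f x t)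
zip⇒flags j {P = P} i (false ∷ b) (a ∷ as) f zero t = subst P (sym (+-identityʳ i)) (f (here refl) t)
zip⇒flags j {P = P} i (false ∷ b) (a ∷ as) f (suc x) t = subst P (sym (+-suc i x)) (zip⇒flags j {P = P} (suc i) b as (f ∘ there) x t)
zip⇒flags j {P = P} i (false ∷ b) [] f (suc x) t = subst P (sym (+-suc i x)) (zip⇒flags j {P = P} (suc i) b [] (λ m → ⊥-elim (none b m)) x t)
  where
  none : ∀ {i z} b → ¬ z ∈ zip (falsesFrom i b) ([] {A = ℕ})
  none {i} b m with falsesFrom i b
  none b () | []
  none b () | _ ∷ _

flags⇒zip : ∀ j {P : ℕ → Set} i b as → (∀ x → x < length b → T (nthB (flags b (map (_<ᵇ j) as)) x) → P (i + x)) →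
  ∀ {y a} → (y , a) ∈ zip (falsesFrom i b) as → T (a <ᵇ j) → P y
flags⇒zip j {P = P} i (true ∷ b) as f m t = flags⇒zip j {P = P} (suc i) b as (λ x lt fl → subst P (+-suc i x) (f (suc x) (s≤s lt) fl)) m t
flags⇒zip j {P = P} i (false ∷ b) (a ∷ as) f (here refl) t = subst P (+-identityʳ i) (f 0 (s≤s z≤n) t)
flags⇒zip j {P = P} i (false ∷ b) (a ∷ as) f (there m) t = flags⇒zip j {P = P} (suc i) b as (λ x lt fl → subst P (+-suc i x) (f (suc x) (s≤s lt) fl)) m t

-- A set partition is a Boolean matrix with all column sums 1 and no segmentation, so all caps are 1
-- and no row is ever closed.
module PartitionSpec (b₀ : List Bool) (as : List ℕ) (j : ℕ) (len : length as ≡ falses b₀) where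
  open CE

  b = true ∷ b₀
  fcs = map (_<ᵇ j) as
  ones = replicate (length fcs) 1

  fcs-length : length fcs ≡ falses b
  fcs-length = trans (length-map (_<ᵇ j) as) len

  PartGood : List (List ℕ) → Set
  PartGood P = length P ≡ trues b × Good false (trues b) 0 0 b ones fcs (col P)

  partition⇒good : ∀ (ls : List (List Bool)) → let P = map boolMult ls in
    T (isSetPartition (length b) P) → minsF P ≡ truesFrom 1 b →
    (∀ {y a} → (y , a) ∈ zip (falsesFrom 1 b) as → T (a <ᵇ j) → T (simF P y 1)) → PartGood P
  partition⇒good ls t mins f = lenP , starts⇒good false (trues b) 0 0 b ones fcs (col P)
      (trans (length-replicate (length fcs)) fcs-length) fcs-length starts tot frc (λ ()) (λ ()) (λ ())
    where
    P = map boolMult ls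
    lenP : length P ≡ trues b
    lenP = trans (sym (length-map minBlock P)) (trans (cong length mins) (length-truesFrom 1 b))
    starts : Starts (trues b) 0 b (col P)
    starts = subst (λ M → Starts M 0 b (col P)) lenP (mins⇒Starts 0 1 b P ≤-refl (trans (sym (minsF≡ P)) mins))
    tot : Totals b ones (col P)
    tot x lt = subst₂ (λ s z → T (s ≡ᵇ z)) (countᵇ-col ls x) (sym (bounds-ones b (length fcs) x fcs-length lt))
      (T-all⁻ _ (enumerates-range (length b)) (proj₂ (T-∧⁻ {familyOK P} t)) (s≤s z≤n , lt))
    frc : Forced b fcs (col P)
    frc x lt fl = sim-one⇒row-zero P x starts (zip⇒flags j {P = λ y → T (simF P y 1)} 1 b as f x fl)

  good⇒mins : ∀ P → PartGood P → minsF P ≡ truesFrom 1 b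
  good⇒mins P (lenP , g) = trans (minsF≡ P) (Starts⇒mins 0 1 b P
    (subst (λ M → Starts M 0 b (col P)) (sym lenP) (good⇒starts 0 0 b ones fcs (col P) g)))

  good⇒partition : ∀ ls → PartGood (map boolMult ls) → T (isSetPartition (length b) (map boolMult ls))
  good⇒partition ls pg@(lenP , g) = T-∧⁺ {familyOK P} (familyOK-mins P b (good⇒mins P pg))
    (T-all⁺ _ (enumerates-range (length b)) λ { {suc x} (_ , lt) →
      subst₂ (λ s z → T (s ≡ᵇ z)) (sym (countᵇ-col ls x)) (bounds-ones b (length fcs) x fcs-length lt)
        (good⇒totals 0 0 b ones fcs (col P) g x lt) })
    where P = map boolMult ls

  good⇒sim : ∀ P → PartGood P → ∀ {y a} → (y , a) ∈ zip (falsesFrom 1 b) as → T (a <ᵇ j) → T (simF P y 1)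
  good⇒sim P (lenP , g) = flags⇒zip j {P = λ y → T (simF P y 1)} 1 b as λ x lt fl →
    common-row⇒sim P x 0 0 (good⇒forced 0 0 b ones fcs (col P) g x lt fl) (proj₁ (good⇒starts 0 0 b ones fcs (col P) g))

-- Partition systems

falses-code : ∀ σ c b → length (code σ c b) ≡ falses b
falses-code σ c b = trans (sym (length-falsesFrom σ c 0 b)) (falses-falsesFrom 0 b)

-- Recursion on the index in place of `zip (range M)`, so that the count factors over the
-- components.
AllFrom : {A : Set} → ℕ → (ℕ → A → Set) → List A → Set
AllFrom j Q []       = ⊤
AllFrom j Q (x ∷ xs) = Q j x × AllFrom (suc j) Q xs

AllFrom⇒zip : {A : Set} {Q : ℕ → A → Set} → ∀ i n xs → AllFrom i Q xs → ∀ {j x} → (j , x) ∈ zip (rangeFrom i n) xs → Q j x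
AllFrom⇒zip i (suc n) (x ∷ xs) (q , qs) (here refl) = q
AllFrom⇒zip i (suc n) (x ∷ xs) (q , qs) (there m)   = AllFrom⇒zip (suc i) n xs qs m

zip⇒AllFrom : {A : Set} {Q : ℕ → A → Set} → ∀ i n xs → length xs ≡ n → (∀ {j x} → (j , x) ∈ zip (rangeFrom i n) xs → Q j x) → AllFrom i Q xs
zip⇒AllFrom i n [] _ f = tt
zip⇒AllFrom i (suc n) (x ∷ xs) len f = f (here refl) , zip⇒AllFrom (suc i) n xs (suc-injective len) (f ∘ there)

AllFrom-map : {A B : Set} (g : A → B) {Q : ℕ → B → Set} {Q' : ℕ → A → Set} → (∀ {j x} → Q j (g x) → Q' j x) →
  ∀ j xs → AllFrom j Q (map g xs) → AllFrom j Q' xs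
AllFrom-map g f j []       _        = tt
AllFrom-map g f j (x ∷ xs) (q , qs) = f q , AllFrom-map g f (suc j) xs qs

AllFrom-unmap : {A B : Set} (g : A → B) {Q : ℕ → B → Set} {Q' : ℕ → A → Set} → (∀ {j x} → Q' j x → Q j (g x)) →
  ∀ j xs → AllFrom j Q' xs → AllFrom j Q (map g xs)
AllFrom-unmap g f j []       _        = tt
AllFrom-unmap g f j (x ∷ xs) (q , qs) = f q , AllFrom-unmap g f (suc j) xs qs

AllFrom-All : {A : Set} {Q : ℕ → A → Set} {P : A → Set} → (∀ {j x} → Q j x → P x) → ∀ j xs → AllFrom j Q xs → All P xs
AllFrom-All f j []       _        = []
AllFrom-All f j (x ∷ xs) (q , qs) = f q ∷ AllFrom-All f (suc j) xs qs

size-AllFrom : {A : Set} {Q : ℕ → A → Set} (s : ℕ → ℕ) → (∀ j → Size (Q j) (s j)) →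
  ∀ j M → Size (λ (v : Vec A M) → AllFrom j Q (toList v)) (prodFrom j M s)
size-AllFrom s S j zero    = Size-cong (λ { {V.[]} _ → tt }) (λ { {V.[]} _ → refl }) (Size-≡ V.[])
size-AllFrom s S j (suc M) = Size-bij
  (λ { (x , v) → x V.∷ v }) (λ v → V.head v , V.tail v)
  id (λ { {x V.∷ v} q → q }) (λ _ → refl) (λ { {x V.∷ v} _ → refl })
  (Size-× (S j) (size-AllFrom s S (suc j) M))

max-≥ : ∀ as → All (_≤ maxL as) as
max-≥ []       = []
max-≥ (a ∷ as) = m≤m⊔n a (maxL as) ∷ All.map (λ le → ≤-trans le (m≤n⊔m a (maxL as))) (max-≥ as)

max-positive : ∀ {as} → 1 ≤ length as → All (1 ≤_) as → 1 ≤ maxL as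
max-positive {a ∷ as} _ (p ∷ _) = ≤-trans p (m≤m⊔n a (maxL as))

firstPos-< : ∀ i B → 1 ≤ firstPos i B → firstPos i B < i + length B
firstPos-< i (zero ∷ B)  p = subst (firstPos (suc i) B <_) (sym (+-suc i (length B))) (firstPos-< (suc i) B p)
firstPos-< i (suc _ ∷ B) p = m<m+n i (s≤s z≤n)

nonempty⇒firstPos : ∀ i B → 1 ≤ i → T (nonemptyBlock B) → 1 ≤ firstPos i B
nonempty⇒firstPos i (zero ∷ B)  i≥1 t = nonempty⇒firstPos (suc i) B (s≤s z≤n) t
nonempty⇒firstPos i (suc _ ∷ B) i≥1 t = i≥1

-- xs is a sorted list of elements of [n], among them 1.
MasksAs : ℕ → List ℕ → Set
MasksAs n xs = truesFrom 1 b ≡ xs × ∃ λ b₀ → b ≡ true ∷ b₀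
  where b = mask (λ x → memb x xs) 1 n

partition-mins : ∀ n P → All (λ B → length B ≡ n) P → 1 ≤ n → T (isSetPartition n P) →
  MasksAs n (minsF P)
partition-mins n P lens n≥1 t = increasing-mask n 1 (minsF P) chain (bounded P lens ne) , head n n≥1 one∈
  where
  fam = proj₁ (T-∧⁻ {familyOK P} t)
  ne : All (T ∘ nonemptyBlock) P
  ne = All.all⁺ nonemptyBlock P (proj₁ (T-∧⁻ {all nonemptyBlock P} fam))
  positive : ∀ P → All (T ∘ nonemptyBlock) P → All (1 ≤_) (minsF P)
  positive []      []       = []
  positive (B ∷ P) (q ∷ qs) = subst (1 ≤_) (sym (minBlock≡firstPos B)) (nonempty⇒firstPos 1 B ≤-refl q) ∷ positive P qs
  head-≥ : ∀ xs → All (1 ≤_) xs → T (strictlyIncreasing xs) → Chain suc 1 xs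
  head-≥ []       _       _ = []
  head-≥ (x ∷ xs) (p ∷ _) t = strictlyIncreasing⇒Chain (x ∷ xs) p t
  chain : Chain suc 1 (minsF P)
  chain = head-≥ (minsF P) (positive P ne) (proj₂ (T-∧⁻ {all nonemptyBlock P} fam))
  bounded : ∀ P → All (λ B → length B ≡ n) P → All (T ∘ nonemptyBlock) P → All (_< 1 + n) (minsF P)
  bounded []      []           []       = []
  bounded (B ∷ P) (refl ∷ ls) (q ∷ qs) = subst (_< 1 + n) (sym (minBlock≡firstPos B)) (firstPos-< 1 B (nonempty⇒firstPos 1 B ≤-refl q)) ∷ bounded P ls qs
  hasOne : ∀ P → 1 ≤ countᵇ (inBlock 1) P → 1 ∈ minsF P
  hasOne (B ∷ P) c with 1 ≤ᵇ at B 0 in eq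
  ... | true  = here (sym (trans (minBlock≡firstPos B) (firstPos-pos 1 B (≤ᵇ⇒≤ 1 _ (subst T (sym eq) tt)))))
  ... | false = there (hasOne P c)
  one∈ : T (memb 1 (minsF P))
  one∈ = ∈⇒memb (hasOne P (≤-reflexive (sym (≡ᵇ⇒≡ _ 1 (T-all⁻ _ (enumerates-range n) (proj₂ (T-∧⁻ {familyOK P} t)) (≤-refl , n≥1))))))
  head : ∀ n → 1 ≤ n → T (memb 1 (minsF P)) → ∃ λ b₀ → mask (λ x → memb x (minsF P)) 1 n ≡ true ∷ b₀
  head (suc n) _ t with memb 1 (minsF P)
  ... | true = _ , refl

zip-∈ : {A : Set} → ∀ i n (xs : List A) {j x} → (j , x) ∈ zip (rangeFrom i n) xs → x ∈ xs
zip-∈ i (suc n) (x ∷ xs) (here refl) = here refl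
zip-∈ i (suc n) (x ∷ xs) (there p)   = there (zip-∈ (suc i) n xs p)

-- Systems over a fixed mask of minima

record MaskOK (N m : ℕ) (b : List Bool) : Set where
  constructor maskOK
  field
    tail    : List Bool
    begins  : b ≡ true ∷ tail
    length≡ : length b ≡ N
    trues≡  : trues b ≡ m

module Masks {ℓ N m : ℕ} (m+ℓ : m + suc ℓ ≡ N) where

  falses≡ : ∀ {b} → MaskOK N m b → falses b ≡ suc ℓ
  falses≡ {b} k = +-cancelˡ-≡ m (falses b) (suc ℓ)
    (trans (cong₂ _+_ (sym (MaskOK.trues≡ k)) (sym (falses-code suc 0 b))) (trans (code-length suc 0 b) (trans (MaskOK.length≡ k) (sym m+ℓ))))

  labels-length : ∀ {b} (v : Vec ℕ (suc ℓ)) → MaskOK N m b → length (toList v) ≡ falses b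
  labels-length v k = trans (length-toList v) (sym (falses≡ k))

  falses-positive : ∀ {b} → MaskOK N m b → 1 ≤ falses b
  falses-positive k = subst (1 ≤_) (sym (falses≡ k)) (s≤s z≤n)

  N≥1 : 1 ≤ N
  N≥1 = subst (1 ≤_) m+ℓ (≤-trans (s≤s z≤n) (m≤n+m (suc ℓ) m))

  head-decode : ∀ σ n {i is} → 1 ≤ n → ∃ λ b₀ → decode σ n 0 (suc i ∷ is) ≡ true ∷ b₀
  head-decode σ (suc n) _ = _ , refl

  -- The first index is at least 1, so the decoder begins with true and 1 is a minimum. The number
  -- of trues is what the prescribed length leaves besides the entries.
  decode-mask : ∀ σ {is hi} → length is ≡ suc ℓ → All (InRange hi) is → code σ 0 (decode σ N 0 is) ≡ is → MaskOK N m (decode σ N 0 is)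
  decode-mask σ {suc i ∷ is} len _ eq = let (b₀ , hd) = head-decode σ N N≥1 in
    maskOK b₀ hd (length-decode σ N 0 (suc i ∷ is))
    (+-cancelʳ-≡ (suc ℓ) _ m (trans (cong (trues b +_) (sym (trans (cong length eq) len)))
      (trans (code-length σ 0 b) (trans (length-decode σ N 0 (suc i ∷ is)) (sym m+ℓ)))))
    where b = decode σ N 0 (suc i ∷ is)
  decode-mask σ {zero ∷ is} _ ((() , _) ∷ _)

-- Common frame of both kinds of systems: X₀ holds the 0-th component, X the others.
module Systems {ℓ N m : ℕ} (as : Vec ℕ (suc ℓ)) (a≥1 : All (1 ≤_) (toList as)) {X₀ X Y : Set}
  (view : X → Y) (check : Y → Bool) (mins : Y → List ℕ) (side : Y → ℕ → Bool) (check₀ : List ℕ → List ℕ → X₀ → Bool) where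

  asL : List ℕ
  asL = toList as

  M : ℕ
  M = maxL asL

  M≥1 : 1 ≤ M
  M≥1 = max-positive (subst (1 ≤_) (sym (length-toList as)) (s≤s z≤n)) a≥1

  Sides : List ℕ → ℕ → Y → Set
  Sides xs j y = ∀ x a → (x , a) ∈ zip xs asL → T (a <ᵇ j) → T (side y x)

  -- The value at the empty list is a mere default: all a_i ≥ 1, hence M ≥ 1 and there is a first
  -- component.
  minsOf : List Y → List ℕ
  minsOf []      = []
  minsOf (y ∷ _) = mins y

  record Spec (x₀ : X₀) (Ys : List Y) : Set where
    constructor spec
    field
      checks   : All (T ∘ check) Ys
      sameMins : All (λ y → mins y ≡ minsOf Ys) Ys
      card     : length (minsOf Ys) ≡ m
      sides    : ∀ {j y} → (j , y) ∈ zip (range M) Ys → Sides (complementL N (minsOf Ys)) j y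
      checked₀ : T (check₀ (minsOf Ys) (complementL N (minsOf Ys)) x₀)

  -- The validity predicates refer to the mask only and not to other components: once the mask is
  -- fixed, the components are independent.
  module Counted (Valid₀ : List Bool → X₀ → Set) (Valid₁ : List Bool → ℕ → X → Set)
    (check₀⇒ : ∀ {b} → MaskOK N m b → ∀ x → T (check₀ (truesFrom 1 b) (falsesFrom 1 b) x) → Valid₀ b x)
    (⇒check₀ : ∀ {b} → MaskOK N m b → ∀ x → Valid₀ b x → T (check₀ (truesFrom 1 b) (falsesFrom 1 b) x))
    (check⇒ : ∀ {b} → MaskOK N m b → ∀ j x → T (check (view x)) → mins (view x) ≡ truesFrom 1 b → Sides (falsesFrom 1 b) j (view x) → Valid₁ b j x)
    (⇒check : ∀ {b} → MaskOK N m b → ∀ j x → Valid₁ b j x → T (check (view x)) × mins (view x) ≡ truesFrom 1 b × Sides (falsesFrom 1 b) j (view x))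
    (mins-mask : ∀ x → T (check (view x)) → MasksAs N (mins (view x)))
    where

    Valid : List Bool → X₀ × Vec X M → Set
    Valid b (x₀ , xs) = Valid₀ b x₀ × AllFrom 1 (Valid₁ b) (toList xs)

    views : Vec X M → List Y
    views xs = map view (toList xs)

    length-views : ∀ xs → length (views xs) ≡ M
    length-views xs = trans (length-map view (toList xs)) (length-toList xs)

    nonmins : ∀ {b} Ys → MaskOK N m b → minsOf Ys ≡ truesFrom 1 b → complementL N (minsOf Ys) ≡ falsesFrom 1 b
    nonmins {b} Ys k eq = trans (cong₂ complementL (sym (MaskOK.length≡ k)) eq) (complementL-trues b)

    Good : List Bool → ℕ → Y → Set
    Good b j y = T (check y) × mins y ≡ truesFrom 1 b × Sides (falsesFrom 1 b) j y

    spec⇒valid : ∀ {b} x₀ xs → MaskOK N m b → minsOf (views xs) ≡ truesFrom 1 b → Spec x₀ (views xs) → Valid b (x₀ , xs)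
    spec⇒valid {b} x₀ xs k eq sp =
      check₀⇒ k x₀ (subst₂ (λ mn ns → T (check₀ mn ns x₀)) eq ns (Spec.checked₀ sp)) ,
      AllFrom-map view {Q = Good b} (λ {j} {x} (c , e , s) → check⇒ k j x c e s) 1 (toList xs)
        (zip⇒AllFrom 1 M (views xs) (length-views xs) λ {j} {y} y∈ →
          All.lookup (Spec.checks sp) (zip-∈ 1 M (views xs) y∈) ,
          trans (All.lookup (Spec.sameMins sp) (zip-∈ 1 M (views xs) y∈)) eq ,
          subst (λ l → Sides l j y) ns (Spec.sides sp (subst (λ r → (j , y) ∈ zip r (views xs)) (sym (range≡rangeFrom M)) y∈)))
      where ns = nonmins (views xs) k eq

    valid⇒good : ∀ {b} x₀ xs → MaskOK N m b → Valid b (x₀ , xs) → AllFrom 1 (Good b) (views xs)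
    valid⇒good x₀ xs k (_ , vs) = AllFrom-unmap view (λ {j} {x} → ⇒check k j x) 1 (toList xs) vs

    valid⇒mins : ∀ {b} x₀ xs → MaskOK N m b → Valid b (x₀ , xs) → minsOf (views xs) ≡ truesFrom 1 b
    valid⇒mins x₀ xs k v with views xs | length-views xs | valid⇒good x₀ xs k v
    ... | []    | len | _             = ⊥-elim (<⇒≢ M≥1 len)
    ... | _ ∷ _ | _   | (_ , e , _) , _ = e

    valid⇒spec : ∀ {b} x₀ xs → MaskOK N m b → Valid b (x₀ , xs) → Spec x₀ (views xs)
    valid⇒spec {b} x₀ xs k v = spec
      (AllFrom-All {P = T ∘ check} proj₁ 1 (views xs) good)
      (AllFrom-All {P = λ y → mins y ≡ minsOf (views xs)} (λ (_ , e , _) → trans e (sym eq)) 1 (views xs) good)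
      (trans (cong length eq) (trans (length-truesFrom 1 b) (MaskOK.trues≡ k)))
      (λ {j} {y} y∈ → subst (λ l → Sides l j y) (sym ns)
        (proj₂ (proj₂ (AllFrom⇒zip 1 M (views xs) good (subst (λ r → (j , y) ∈ zip r (views xs)) (range≡rangeFrom M) y∈)))))
      (subst₂ (λ mn ns → T (check₀ mn ns x₀)) (sym eq) (sym ns) (⇒check₀ k x₀ (proj₁ v)))
      where
      good = valid⇒good x₀ xs k v
      eq = valid⇒mins x₀ xs k v
      ns = nonmins (views xs) k eq

    maskOf : Vec X M → List Bool
    maskOf xs = mask (λ v → memb v (minsOf (views xs))) 1 N

    spec⇒mask : ∀ x₀ xs → Spec x₀ (views xs) → MaskOK N m (maskOf xs) × minsOf (views xs) ≡ truesFrom 1 (maskOf xs)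
    spec⇒mask x₀ xs sp = first (toList xs) (length-toList xs) (Spec.checks sp) (Spec.card sp)
      where
      first : ∀ xs → length xs ≡ M → All (T ∘ check) (map view xs) → length (minsOf (map view xs)) ≡ m →
        let b = mask (λ v → memb v (minsOf (map view xs))) 1 N in MaskOK N m b × minsOf (map view xs) ≡ truesFrom 1 b
      first []       len _       _ = ⊥-elim (<⇒≢ M≥1 len)
      first (x ∷ xs) len (t ∷ _) c =
        let (eq , b₀ , hd) = mins-mask x t in
        maskOK b₀ hd (length-mask _ 1 N) (trans (sym (length-truesFrom 1 (mask (λ v → memb v (mins (view x))) 1 N))) (trans (cong length eq) c)) , sym eq

    -- A system determines its mask of minima, and masks correspond to index words through `code`.
    -- Attaching its word to each system turns the count into a sum over words, with the product
    -- over components as summand.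
    size-spec : ∀ σ → (∀ c → c ≤ σ c) → {Word : List ℕ → Set} {ws : List (List ℕ)} → Enumerates Word ws →
      (∀ {b} → MaskOK N m b → Word (code σ 0 b)) →
      (∀ {is} → Word is → MaskOK N m (decode σ N 0 is)) → (∀ {is} → Word is → code σ 0 (decode σ N 0 is) ≡ is) →
      (s₀ : List ℕ → ℕ) → (∀ {b} → MaskOK N m b → Size (Valid₀ b) (s₀ (code σ 0 b))) →
      (∀ {b} → MaskOK N m b → ∀ j → Size (Valid₁ b j) (choices j (code σ 0 b) asL)) →
      Size (λ (d : X₀ × Vec X M) → Spec (proj₁ d) (views (proj₂ d))) (sum (map (λ is → product (zipWith _^_ is asL) * s₀ is) ws))
    size-spec σ inc {Word} e mask⇒word word⇒mask word-code s₀ size₀ size₁ =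
      Size-bij {P = λ (wd : List ℕ × X₀ × Vec X M) → Word (proj₁ wd) × Valid (decode σ N 0 (proj₁ wd)) (proj₂ wd)}
        proj₂ (λ d → code σ 0 (maskOf (proj₂ d)) , d)
        (λ { {is , x₀ , xs} (w , v) → valid⇒spec x₀ xs (word⇒mask w) v })
        (λ { {x₀ , xs} sp → let (k , eq) = spec⇒mask x₀ xs sp in
          mask⇒word k , subst (λ b → Valid b (x₀ , xs)) (sym (decode-code′ k)) (spec⇒valid x₀ xs k eq sp) })
        (λ { {is , x₀ , xs} (w , v) → cong (_, (x₀ , xs)) (trans (cong (code σ 0) (mask≡ (word⇒mask w) x₀ xs v)) (word-code w)) })
        (λ _ → refl)
        (Size-Σ term e (λ {is} w → subst (λ z → Size (Valid (decode σ N 0 is)) (term z)) (word-code w) (size-Valid (word⇒mask w))))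
      where
      term : List ℕ → ℕ
      term is = product (zipWith _^_ is asL) * s₀ is
      size-Valid : ∀ {b} → MaskOK N m b → Size (Valid b) (term (code σ 0 b))
      size-Valid {b} k = subst (Size _)
        (trans (*-comm (s₀ (code σ 0 b)) _) (cong (_* s₀ (code σ 0 b)) (prodFrom-choices M (code σ 0 b) asL (max-≥ asL))))
        (Size-× (size₀ k) (size-AllFrom (λ j → choices j (code σ 0 b) asL) (size₁ k) 1 M))
      decode-code′ : ∀ {b} → MaskOK N m b → decode σ N 0 (code σ 0 b) ≡ b
      decode-code′ {b} k = trans (cong (λ n → decode σ n 0 (code σ 0 b)) (sym (MaskOK.length≡ k))) (decode-code σ inc 0 b)
      mask≡ : ∀ {b} → MaskOK N m b → ∀ x₀ xs → Valid b (x₀ , xs) → maskOf xs ≡ b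
      mask≡ {b} k x₀ xs v = trans (cong₂ (λ l n → mask (λ x → memb x l) 1 n) (valid⇒mins x₀ xs k v) (sym (MaskOK.length≡ k))) (mask-memb-trues b)

module PartitionSystems {ℓ : ℕ} (as ts : Vec ℕ (suc ℓ)) (n m : ℕ) (m+ℓ : m + suc ℓ ≡ n)
  (a≥1 : All (1 ≤_) (toList as)) (t≥2 : All (2 ≤_) (toList ts)) where

  tsL capsS : List ℕ
  tsL = toList ts
  capsS = map (_∸ 2) tsL

  blocks : List (Vec Bool n) → List (List ℕ)
  blocks π = map boolMult (map toList π)

  simOne : List (List ℕ) → ℕ → Bool
  simOne P x = simF P x 1

  check₀ : List ℕ → List ℕ → List (Vec ℕ (suc n)) → Bool
  check₀ mn xs π₀ = F0S.f0Check n tsL mn xs (map toList π₀)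

  open Masks m+ℓ
  open Systems {N = n} {m = m} as a≥1 blocks (isSetPartition n) minsF simOne check₀

  blocks≡ : ∀ (πs : List (List (Vec Bool n))) → map (map boolMult) (map (map toList) πs) ≡ map blocks πs
  blocks≡ πs = sym (map-∘ πs)

  isPartSystem⇒ : ∀ π₀ πs → T (isPartSystem as ts n m (π₀ , πs)) → Spec π₀ (map blocks (toList πs))
  isPartSystem⇒ π₀ πs t = subst (Spec π₀) (blocks≡ (toList πs)) (unfolded t)
    where
    rows : List (List (List ℕ))
    rows = map (map boolMult) (map (map toList) (toList πs))
    unfolded : T (isPartSystem as ts n m (π₀ , πs)) → Spec π₀ rows
    -- The minima are read off the first component, so the check reduces only once the list is a
    -- cons; M ≥ 1 excludes the empty list.
    unfolded with rows in eq | trans (cong length (blocks≡ (toList πs))) (trans (length-map blocks (toList πs)) (length-toList πs))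
    ... | []     | len = ⊥-elim (<⇒≢ M≥1 len)
    ... | P ∷ Ps | _   = λ t →
      let (s , t₁) = T-∧⁻ {all (isSetPartition n) (P ∷ Ps)} t
          (e , t₂) = T-∧⁻ {all (λ Q → eqList (minsF Q) (minsF P)) (P ∷ Ps)} t₁
          (c , t₃) = T-∧⁻ {length (minsF P) ≡ᵇ m} t₂
          (q , f)  = T-∧⁻ {y = F0S.f0Check n tsL (minsF P) (complementL n (minsF P)) (map toList π₀)} t₃
      in spec (All.all⁺ _ (P ∷ Ps) s)
           (All.map (λ {Q} → eqList⇒≡ (minsF Q) (minsF P)) (All.all⁺ _ (P ∷ Ps) e))
           (≡ᵇ⇒≡ _ m c)
           (λ {j} {Q} Q∈ _ _ x∈ → T-not∨⁻ (All.lookup (All.all⁺ _ _ (All.lookup (All.all⁺ _ _ q) x∈)) (subst (λ z → (j , Q) ∈ zip (range M) z) (sym eq) Q∈)))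
           f

  ⇒isPartSystem : ∀ π₀ πs → Spec π₀ (map blocks (toList πs)) → T (isPartSystem as ts n m (π₀ , πs))
  ⇒isPartSystem π₀ πs sp = folded (subst (Spec π₀) (sym (blocks≡ (toList πs))) sp)
    where
    rows : List (List (List ℕ))
    rows = map (map boolMult) (map (map toList) (toList πs))
    folded : Spec π₀ rows → T (isPartSystem as ts n m (π₀ , πs))
    folded with rows in eq | trans (cong length (blocks≡ (toList πs))) (trans (length-map blocks (toList πs)) (length-toList πs))
    ... | []     | len = ⊥-elim (<⇒≢ M≥1 len)
    ... | P ∷ Ps | _   = λ { (spec s e c q f) →
      T-∧⁺ {all (isSetPartition n) (P ∷ Ps)} (All.all⁻ _ s)
      (T-∧⁺ {all (λ Q → eqList (minsF Q) (minsF P)) (P ∷ Ps)}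
        (All.all⁻ _ (All.map (λ {Q} eqQ → subst (λ l → T (eqList (minsF Q) l)) eqQ (eqList-refl (minsF Q))) e))
      (T-∧⁺ {length (minsF P) ≡ᵇ m} (≡⇒≡ᵇ _ m c)
      (T-∧⁺ {y = F0S.f0Check n tsL (minsF P) (complementL n (minsF P)) (map toList π₀)} (All.all⁻ _ (All.tabulate λ {xa} x∈ → All.all⁻ _ (All.tabulate λ {jQ} Q∈ → T-not∨⁺ (q (subst (λ z → jQ ∈ zip (range M) z) eq Q∈) (proj₁ xa) (proj₂ xa) x∈)))) f))) }

  WordS : List ℕ → Set
  WordS is = (length is ≡ suc ℓ × All (InRange m) is) × T (nondecreasing is)

  mask⇒word : ∀ {b} → MaskOK n m b → WordS (code id 0 b)
  mask⇒word k@(maskOK b₀ refl len tr) =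
    (trans (falses-code id 0 (true ∷ b₀)) (falses≡ k) ,
     All.zip (chain-≥ (λ _ → ≤-refl) (code-chain id (λ _ → ≤-refl) 1 b₀) , All.map (λ {x} → subst (x ≤_) tr) (code-id-≤ 0 (true ∷ b₀)))) ,
    Chain⇒nondecreasing (code-chain id (λ _ → ≤-refl) 0 (true ∷ b₀))

  word-code : ∀ {is} → WordS is → code id 0 (decode id n 0 is) ≡ is
  word-code {is} ((len , rg) , nd) = code-decode-id m n 0 is (nondecreasing⇒Chain is z≤n nd) (All.map proj₂ rg) z≤n
    (trans (cong (m +_) len) m+ℓ)

  word⇒mask : ∀ {is} → WordS is → MaskOK n m (decode id n 0 is)
  word⇒mask w@((len , rg) , _) = decode-mask id len rg (word-code w)

  Good₀ : ℕ → List Bool → List (List ℕ) → Set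
  Good₀ M b F = CS.Good true M 0 0 (b ++ false ∷ []) (1 ∷ capsS) (true ∷ replicate (length capsS) false) (col F)

  Good₁ : ℕ → List Bool → ℕ → List (List ℕ) → Set
  Good₁ M b j F = CE.Good false M 0 0 b (replicate (length (map (_<ᵇ j) asL)) 1) (map (_<ᵇ j) asL) (col F)

  Valid₀ : List Bool → List (Vec ℕ (suc n)) → Set
  Valid₀ b π₀ = length π₀ ≡ m × Good₀ m b (CℕS.rows π₀)

  Valid₁ : List Bool → ℕ → List (Vec Bool n) → Set
  Valid₁ b j π = length π ≡ m × Good₁ m b j (CBE.rows π)

  size-Valid₀ : ∀ {b} → MaskOK n m b → Size (Valid₀ b) (product (zipWith3 kernelS tsL (code id 0 b) (drop 1 (code id 0 b) ++ (m ∷ []))))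
  size-Valid₀ k@(maskOK b₀ refl len tr) = subst (Size _)
    (trans (prodSizesS 0 (true ∷ b₀) tsL t≥2 (falses-positive k) (labels-length ts k))
      (cong (λ z → product (zipWith3 kernelS tsL (code id 1 b₀) (drop 1 (code id 1 b₀) ++ z ∷ []))) tr))
    (CℕS.size-good m szS 0 0 (true ∷ b₀ ++ false ∷ []) (1 ∷ capsS) (true ∷ replicate (length capsS) false) (suc n)
      (trans (length-snoc (true ∷ b₀)) (cong suc len))
      (sym (trans (trues-snoc (true ∷ b₀)) tr))
      (CℕS.allCols-firstForced _ size-ℕ m 1 (b₀ ++ false ∷ []) capsS ≤-refl (sym (trans (trues-snoc (true ∷ b₀)) tr))
        (trans (cong suc (trans (length-map (_∸ 2) tsL) (labels-length ts k))) (sym (falses-snoc b₀)))))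

  size-Valid₁ : ∀ {b} → MaskOK n m b → ∀ j → Size (Valid₁ b j) (choices j (code id 0 b) asL)
  size-Valid₁ k@(maskOK b₀ refl len tr) j = subst (Size _) (prodSizesJ j 0 (true ∷ b₀) asL (labels-length as k))
    (CBE.size-good m szJ 0 0 (true ∷ b₀) (replicate (length (map (_<ᵇ j) asL)) 1) (map (_<ᵇ j) asL) n len (sym tr)
      (allColsJ m 1 b₀ (map (_<ᵇ j) asL) ≤-refl (sym tr) (trans (length-map (_<ᵇ j) asL) (labels-length as k))))

  rowsℕ : ∀ (π₀ : List (Vec ℕ (suc n))) → CℕS.rows π₀ ≡ map toList π₀
  rowsℕ = map-cong (λ B → map-id (toList B))

  rowsBool : ∀ π → CBE.rows π ≡ blocks π
  rowsBool = map-∘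

  length-blocks : ∀ π → length (blocks π) ≡ length π
  length-blocks π = trans (length-map boolMult (map toList π)) (length-map toList π)

  check₀⇒ : ∀ {b} → MaskOK n m b → ∀ π₀ → T (check₀ (truesFrom 1 b) (falsesFrom 1 b) π₀) → Valid₀ b π₀
  check₀⇒ {b} k@(maskOK b₀ refl len tr) π₀ t =
    let (l , g) = F0S.f0⇒good b₀ tsL (falses-positive k) (labels-length ts k) (map toList π₀)
          (subst (λ n → T (F0S.f0Check n tsL (truesFrom 1 b) (falsesFrom 1 b) (map toList π₀))) (sym len) t)
    in trans (sym (length-map toList π₀)) (trans l tr) , subst₂ (λ M F → Good₀ M b F) tr (sym (rowsℕ π₀)) g

  ⇒check₀ : ∀ {b} → MaskOK n m b → ∀ π₀ → Valid₀ b π₀ → T (check₀ (truesFrom 1 b) (falsesFrom 1 b) π₀)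
  ⇒check₀ {b} k@(maskOK b₀ refl len tr) π₀ (l , g) =
    subst (λ n → T (F0S.f0Check n tsL (truesFrom 1 b) (falsesFrom 1 b) (map toList π₀))) len
      (F0S.good⇒f0 b₀ tsL (falses-positive k) (labels-length ts k) (map toList π₀) (trans (length-map toList π₀) (trans l (sym tr)))
        (subst₂ (λ M F → Good₀ M b F) (sym tr) (rowsℕ π₀) g))

  check⇒ : ∀ {b} → MaskOK n m b → ∀ j π → T (isSetPartition n (blocks π)) → minsF (blocks π) ≡ truesFrom 1 b →
    Sides (falsesFrom 1 b) j (blocks π) → Valid₁ b j π
  check⇒ {b} k@(maskOK b₀ refl len tr) j π t e s =
    let (l , g) = PartitionSpec.partition⇒good b₀ asL j (labels-length as k) (map toList π)
          (subst (λ n → T (isSetPartition n (blocks π))) (sym len) t) e (λ {y} {a} → s y a)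
    in trans (sym (length-blocks π)) (trans l tr) , subst₂ (λ M F → Good₁ M b j F) tr (sym (rowsBool π)) g

  ⇒check : ∀ {b} → MaskOK n m b → ∀ j π → Valid₁ b j π →
    T (isSetPartition n (blocks π)) × minsF (blocks π) ≡ truesFrom 1 b × Sides (falsesFrom 1 b) j (blocks π)
  ⇒check {b} k@(maskOK b₀ refl len tr) j π (l , g) =
    subst (λ n → T (isSetPartition n (blocks π))) len (PartitionSpec.good⇒partition b₀ asL j (labels-length as k) (map toList π) pg) ,
    PartitionSpec.good⇒mins b₀ asL j (labels-length as k) (blocks π) pg ,
    λ _ _ → PartitionSpec.good⇒sim b₀ asL j (labels-length as k) (blocks π) pg
    where
    pg : PartitionSpec.PartGood b₀ asL j (labels-length as k) (blocks π)
    pg = trans (length-blocks π) (trans l (sym tr)) , subst₂ (λ M F → Good₁ M b j F) (sym tr) (rowsBool π) g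

  mins-mask : ∀ π → T (isSetPartition n (blocks π)) → MasksAs n (minsF (blocks π))
  mins-mask π = partition-mins n (blocks π)
    (All.map⁺ (All.map⁺ (All.tabulate λ {B} _ → trans (length-map boolVal (toList B)) (length-toList B)))) N≥1

  size-PartSystem : Size (T ∘ isPartSystem as ts n m) (sumS as ts m)
  size-PartSystem = Size-cong (λ {d} → ⇒isPartSystem (proj₁ d) (proj₂ d)) (λ {d} → isPartSystem⇒ (proj₁ d) (proj₂ d))
    (Counted.size-spec Valid₀ Valid₁ check₀⇒ ⇒check₀ check⇒ ⇒check mins-mask id (λ _ → ≤-refl)
      (enumerates-filterᵇ nondecreasing (enumerates-words (suc ℓ) m)) mask⇒word word⇒mask word-code
      (λ is → product (zipWith3 kernelS tsL is (drop 1 is ++ (m ∷ [])))) size-Valid₀ size-Valid₁)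

-- Permutation systems

T⇒≡ : ∀ {b} → T b → b ≡ true
T⇒≡ {true} _ = refl

-- Phrased as avoided sublists, like the Stirling condition, so that `rem-mono` and `ins-⊇` carry
-- them through insertions.
LeftMin RightMin : ℕ → List ℕ → Set
LeftMin  v w = ∀ {y} → y < v → ¬ (y ∷ v ∷ [] ⊆ w)
RightMin v w = ∀ {y} → y < v → ¬ (v ∷ y ∷ [] ⊆ w)

-- With every letter occurring once the avoidance is automatic, and the whole insertion machinery is
-- available for permutations.
Perm : ℕ → List ℕ → Set
Perm n = Stirling n (λ _ → 1)

count-⊆ : ∀ {xs ys} v → xs ⊆ ys → count v xs ≤ count v ys
count-⊆ v [] = z≤n
count-⊆ v (y ∷ʳ s) with y ≡ᵇ v
... | true  = m≤n⇒m≤1+n (count-⊆ v s)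
... | false = count-⊆ v s
count-⊆ {x ∷ _} v (refl ∷ s) with x ≡ᵇ v
... | true  = s≤s (count-⊆ v s)
... | false = count-⊆ v s

no-repeat : ∀ {n w v} → (∀ v → InRange n v → count v w ≡ 1) → All (InRange n) w → ¬ (v ∷ v ∷ [] ⊆ w)
no-repeat {n} {w} {v} cs rg s with ⊆-All s rg
... | r ∷ _ = <⇒≱ (s≤s (s≤s z≤n)) (subst₂ _≤_ (trans (count-≡ {v} (v ∷ [])) (cong suc (count-≡ {v} []))) (cs v r) (count-⊆ v s))

isPermutation⇒Perm : ∀ n w → T (isPermutation n w) → Perm n w
isPermutation⇒Perm n w t = stirling cs rg (λ {a} {b} _ s → no-repeat cs rg (⊆-trans (refl ∷ (b ∷ʳ ⊆-refl)) s))
  where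
  tt' = T-∧⁻ {all (λ v → countᵇ (λ x → x ≡ᵇ v) w ≡ᵇ 1) (range n)} t
  cs : ∀ v → InRange n v → count v w ≡ 1
  cs v r = ≡ᵇ⇒≡ _ 1 (T-all⁻ _ (enumerates-range n) (proj₁ tt') r)
  rg : All (InRange n) w
  rg = All.map (λ {x} m → Enumerates.sound (enumerates-range n) (memb⇒∈ x (range n) m)) (All.all⁺ _ w (proj₂ tt'))

Perm⇒isPermutation : ∀ {n w} → Perm n w → T (isPermutation n w)
Perm⇒isPermutation {n} {w} s = T-∧⁺ {all (λ v → countᵇ (λ x → x ≡ᵇ v) w ≡ᵇ 1) (range n)}
  (T-all⁺ _ (enumerates-range n) (λ r → ≡⇒≡ᵇ _ 1 (counts s _ r)))
  (All.all⁻ (λ x → memb x (range n)) (All.map (λ r → ∈⇒memb (Enumerates.complete (enumerates-range n) r)) (inRange s)))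

Perm-length : ∀ {n w} → Perm n w → length w ≡ n
Perm-length {n} s = trans (stirling-length n (λ _ _ → ≤-refl) s) (ones n)
  where
  ones : ∀ n → ∑ n (λ _ → 1) ≡ n
  ones zero    = refl
  ones (suc n) = trans (+-comm _ 1) (cong suc (ones n))

isLmin : List ℕ → ℕ → Bool
isLmin σ v = any (λ p → (at σ p ≡ᵇ v) ∧ all (λ q → not (q <ᵇ p) ∨ (v <ᵇ at σ q)) (upTo (length σ))) (upTo (length σ))

isLmin⇒ : ∀ {n σ} v → Perm n σ → T (isLmin σ v) → LeftMin v σ
isLmin⇒ {n} {σ} v s t {y} y<v sub with Any.satisfied (Any.any⁻ (λ p → (at σ p ≡ᵇ v) ∧ all (λ q → not (q <ᵇ p) ∨ (v <ᵇ at σ q)) (upTo (length σ))) (upTo (length σ)) t) | ⊆-at₂ sub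
... | p , tp | i , j , ij , j< , refl , eqj with T-∧⁻ {at σ p ≡ᵇ v} tp
-- p is the position supplied by the check, i < j are those of the pattern y, v. If j = p, the check
-- at i gives v < y; if j < p, it gives v < v; if p < j, the letter v occurs twice.
...   | eqp , tq with <-cmp j p
...     | tri≈ _ refl _ = <-asym y<v (<ᵇ⇒< _ _ (T-not∨⁻ (T-all⁻ _ (enumerates-upTo (length σ)) tq (<-trans ij j<)) (<⇒<ᵇ ij)))
...     | tri< jp _ _ = <-irrefl (sym eqj) (<ᵇ⇒< _ _ (T-not∨⁻ (T-all⁻ _ (enumerates-upTo (length σ)) tq j<) (<⇒<ᵇ jp)))
...     | tri> _ _ pj = no-repeat (counts s) (inRange s) (subst₂ (λ a b → a ∷ b ∷ [] ⊆ σ) (≡ᵇ⇒≡ (at σ p) v eqp) eqj (at-⊆₂ σ pj j<))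

⇒isLmin : ∀ {n σ} v → Perm n σ → InRange n v → LeftMin v σ → T (isLmin σ v)
⇒isLmin {n} {σ} v s r lm with ⊆-at₁ (present-⊆ σ (counts s v r))
... | p , p< , refl = Any.any⁺ _ (Any.map (λ { refl → T-∧⁺ {at σ p ≡ᵇ v} (≡⇒≡ᵇ (at σ p) (at σ p) refl)
    (T-all⁺ _ (enumerates-upTo (length σ)) λ {q} _ → T-not∨⁺ λ qp → <⇒<ᵇ (before q (<ᵇ⇒< q p qp))) })
    (Enumerates.complete (enumerates-upTo (length σ)) p<))
  where
  before : ∀ q → q < p → at σ p < at σ q
  before q qp = ≰⇒> λ le → case-≤ (m≤n⇒m<n∨m≡n le)
    where
    case-≤ : at σ q < at σ p ⊎ at σ q ≡ at σ p → ⊥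
    case-≤ (inj₁ lt) = lm lt (at-⊆₂ σ qp p<)
    case-≤ (inj₂ eq) = no-repeat (counts s) (inRange s) (subst (λ a → a ∷ at σ p ∷ [] ⊆ σ) eq (at-⊆₂ σ qp p<))

lmin-trues : ∀ {n σ} b → Perm n σ → length b ≡ n → (∀ x → x < n → isLmin σ (suc x) ≡ nthB b x) → lmin σ ≡ truesFrom 1 b
lmin-trues {σ = σ} b s refl eq = trans (cong (filterᵇ (isLmin σ)) (trans (cong range (Perm-length s)) (range≡rangeFrom (length b))))
  (filter-rangeFrom (isLmin σ) 1 b eq)

trues-lmin : ∀ {n σ} b → Perm n σ → lmin σ ≡ truesFrom 1 b → ∀ x → x < n → isLmin σ (suc x) ≡ nthB b x
trues-lmin {n} {σ} b s eq x lt = trans (sym (nthB-mask (isLmin σ) 1 n x lt)) (trans (sym (memb-truesFrom 1 (mask (isLmin σ) 1 n) x))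
  (trans (cong (memb (suc x)) (trans (truesFrom-mask (isLmin σ) n) (trans (cong (filterᵇ (isLmin σ) ∘ range) (sym (Perm-length s))) eq)))
    (memb-truesFrom 1 b x)))

rightCheck : ℕ → List ℕ → ℕ → Bool
rightCheck n σ x = all (λ p → all (λ q → not ((at σ p ≡ᵇ x) ∧ (p <ᵇ q)) ∨ (x <ᵇ at σ q)) (upTo n)) (upTo n)

rightCheck⇒ : ∀ {n σ} x → Perm n σ → T (rightCheck n σ x) → RightMin x σ
rightCheck⇒ {n} {σ} x s t y<x sub with ⊆-at₂ sub
... | i , j , ij , j< , refl , refl = <-asym y<x (<ᵇ⇒< _ _ (T-not∨⁻
  (T-all⁻ _ up (T-all⁻ _ up t (<-trans ij j<')) j<')
  (T-∧⁺ {at σ i ≡ᵇ at σ i} (≡⇒≡ᵇ (at σ i) (at σ i) refl) (<⇒<ᵇ ij))))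
  where
  up = enumerates-upTo n
  j<' = subst (j <_) (Perm-length s) j<

⇒rightCheck : ∀ {n σ} x → Perm n σ → RightMin x σ → T (rightCheck n σ x)
⇒rightCheck {n} {σ} x s rm = T-all⁺ _ up λ {p} _ → T-all⁺ _ up λ {q} q< → T-not∨⁺ λ t →
  let (eq , pq) = T-∧⁻ {at σ p ≡ᵇ x} t in <⇒<ᵇ (after p q (≡ᵇ⇒≡ (at σ p) x eq) (<ᵇ⇒< p q pq) (subst (q <_) (sym (Perm-length s)) q<))
  where
  up = enumerates-upTo n
  after : ∀ p q → at σ p ≡ x → p < q → q < length σ → x < at σ q
  after p q refl pq q< = ≰⇒> λ le → case-≤ (m≤n⇒m<n∨m≡n le)
    where
    case-≤ : at σ q < at σ p ⊎ at σ q ≡ at σ p → ⊥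
    case-≤ (inj₁ lt) = rm lt (at-⊆₂ σ pq q<)
    case-≤ (inj₂ eq) = no-repeat (counts s) (inRange s) (subst (λ a → at σ p ∷ a ∷ [] ⊆ σ) eq (at-⊆₂ σ pq q<))

-- Kinds of letters under insertion

insTop : ℕ → ℕ → List ℕ → List ℕ
insTop n p w = ins p (suc n ∷ []) w

insTop-LeftMin⇒ : ∀ {n w} p → Perm n w → p ≤ length w → LeftMin (suc n) (insTop n p w) → p ≡ 0
insTop-LeftMin⇒ zero s le lm = refl
insTop-LeftMin⇒ {n} {x ∷ w} (suc p) s (s≤s le) lm with inRange s
... | (_ , x≤n) ∷ rg = ⊥-elim (lm (s≤s x≤n) (refl ∷ present-⊆ (ins p (suc n ∷ []) w) (count-ins-self p 1 (top-absent rg))))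

insTop-zero-LeftMin : ∀ {n w} → Perm n w → LeftMin (suc n) (insTop n 0 w)
insTop-zero-LeftMin s y< (_ ∷ʳ sub) with ⊆-All sub (top-absent (inRange s))
... | _ ∷ ne ∷ [] = ne refl
insTop-zero-LeftMin s y< (refl ∷ sub) = <-irrefl refl y<

insTop-RightMin⇒ : ∀ {n w} p → All (InRange n) w → p ≤ length w → RightMin (suc n) (insTop n p w) → p ≡ length w
insTop-RightMin⇒ {w = []} zero rg le rm = refl
insTop-RightMin⇒ {w = x ∷ w} zero ((_ , x≤n) ∷ rg) le rm = ⊥-elim (rm (s≤s x≤n) (refl ∷ refl ∷ minimum w))
insTop-RightMin⇒ {w = x ∷ w} (suc p) (_ ∷ rg) (s≤s le) rm = cong suc (insTop-RightMin⇒ p rg le (λ lt sub → rm lt (x ∷ʳ sub)))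

insTop-end-RightMin : ∀ {n w} → All (_≢ suc n) w → RightMin (suc n) (insTop n (length w) w)
insTop-end-RightMin {w = []} ne y< (_ ∷ʳ ())
insTop-end-RightMin {w = []} ne y< (refl ∷ ())
insTop-end-RightMin {w = x ∷ w} (_ ∷ ne) y< (_ ∷ʳ sub) = insTop-end-RightMin ne y< sub
insTop-end-RightMin {w = x ∷ w} (x≢ ∷ ne) y< (refl ∷ sub) = x≢ refl

-- `mn` marks minima and `fl` forced letters. Arguments are mask positions, so x stands for the
-- letter x + 1.
KindAt : (mn fl : ℕ → Bool) → ℕ → List ℕ → Set
KindAt mn fl x w = (mn x ≡ true → LeftMin (suc x) w) × (mn x ≡ false → ¬ LeftMin (suc x) w) × (T (fl x) → RightMin (suc x) w)

PermWith : (mn fl : ℕ → Bool) → ℕ → List ℕ → Set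
PermWith mn fl n w = Perm n w × (∀ x → x < n → KindAt mn fl x w)

module PermCount (mn fl : ℕ → Bool) (mn-zero : mn 0 ≡ true) (mn-fl : ∀ x → mn x ≡ true → fl x ≡ false) where

  KindOK : ℕ → List ℕ → Set
  KindOK = KindAt mn fl

  PermK : ℕ → List ℕ → Set
  PermK = PermWith mn fl

  PosOK : ℕ → ℕ → Set
  PosOK n p = p ≤ n × (mn n ≡ true → p ≡ 0) × (mn n ≡ false → p ≢ 0) × (T (fl n) → p ≡ n)

  kindSize : ℕ → ℕ
  kindSize x = if mn x then 1 else (if fl x then 1 else x)

  size-PosOK : ∀ n → Size (PosOK n) (kindSize n)
  size-PosOK n with mn n in eqm | fl n in eqf
  ... | true | true with () ← trans (sym eqf) (mn-fl n eqm)
  ... | true | false = Size-cong (λ { refl → z≤n , (λ _ → refl) , (λ ()) , λ () }) (λ { (_ , z , _) → z refl }) (Size-≡ 0)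
  ... | false | true = Size-cong (λ { refl → ≤-refl , (λ ()) , (λ _ → n≢0) , λ _ → refl }) (λ { (_ , _ , _ , e) → e tt }) (Size-≡ n)
    where
    -- The front is also the last place only in the empty word, and the letter inserted there is 1,
    -- a minimum.
    n≢0 : n ≢ 0
    n≢0 refl with () ← trans (sym eqm) mn-zero
  ... | false | false = Size-cong
    (λ { (suc-p , le) → le , (λ ()) , (λ _ → λ { refl → n≮0 suc-p }) , λ () })
    (λ { {p} (le , _ , ne , _) → n≢0⇒n>0 (ne refl) , le })
    (subst (Size (InRange n)) (trans (length-map suc (upTo n)) (length-upTo n)) (enumerates⇒Size (enumerates-range n)))

  module _ {n w} (s : Perm n w) where

    W : ℕ → List ℕ
    W p = insTop n p w

    absent : All (_≢ suc n) w
    absent = top-absent (inRange s)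

    -- Inserting n + 1 creates and destroys no pair of smaller letters, so the kind of every earlier
    -- letter is kept.
    lower : ∀ p {v y} → v < suc n → y < v → (y ∷ v ∷ [] ⊆ W p → y ∷ v ∷ [] ⊆ w) × (v ∷ y ∷ [] ⊆ W p → v ∷ y ∷ [] ⊆ w)
    lower p v< y<v =
      (λ sub → subst (_ ⊆_) (rem-ins p 1 absent) (rem-mono ((<⇒≢ (<-trans y<v v<)) ∷ (<⇒≢ v<) ∷ []) sub)) ,
      (λ sub → subst (_ ⊆_) (rem-ins p 1 absent) (rem-mono ((<⇒≢ v<) ∷ (<⇒≢ (<-trans y<v v<)) ∷ []) sub))

    kind-ins : ∀ p {x} → x < n → KindOK x w → KindOK x (W p)
    kind-ins p x<n (l , nl , r) =
      (λ e y< sub → l e y< (proj₁ (lower p (s≤s x<n) y<) sub)) ,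
      (λ e lm → nl e (λ y< sub → lm y< (⊆-trans sub (ins-⊇ p (suc n ∷ []) w)))) ,
      (λ f y< sub → r f y< (proj₂ (lower p (s≤s x<n) y<) sub))

    kind-rem : ∀ p {x} → x < n → KindOK x (W p) → KindOK x w
    kind-rem p x<n (l , nl , r) =
      (λ e y< sub → l e y< (⊆-trans sub (ins-⊇ p (suc n ∷ []) w))) ,
      (λ e lm → nl e (λ y< sub → lm y< (proj₁ (lower p (s≤s x<n) y<) sub))) ,
      (λ f y< sub → r f y< (⊆-trans sub (ins-⊇ p (suc n ∷ []) w)))

    kind-top : ∀ p → PosOK n p → KindOK n (W p)
    kind-top p (le , z , nz , e) =
      (λ m → subst (λ p → LeftMin (suc n) (W p)) (sym (z m)) (insTop-zero-LeftMin s)) ,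
      (λ m lm → nz m (insTop-LeftMin⇒ p s (subst (p ≤_) (sym (Perm-length s)) le) lm)) ,
      (λ f → subst (λ p → RightMin (suc n) (W p)) (trans (Perm-length s) (sym (e f))) (insTop-end-RightMin absent))

    top-pos : ∀ p → p ≤ n → KindOK n (W p) → PosOK n p
    top-pos p le (l , nl , r) = le ,
      (λ m → insTop-LeftMin⇒ p s le' (l m)) ,
      (λ { m refl → nl m (insTop-zero-LeftMin s) }) ,
      (λ f → trans (insTop-RightMin⇒ p (inRange s) le' (r f)) (Perm-length s))
      where le' = subst (p ≤_) (sym (Perm-length s)) le

  prodFrom-snoc : ∀ j n f → prodFrom j (suc n) f ≡ prodFrom j n f * f (j + n)
  prodFrom-snoc j zero    f = trans (*-identityʳ (f j)) (trans (cong f (sym (+-identityʳ j))) (sym (+-identityʳ _)))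
  prodFrom-snoc j (suc n) f = trans (cong (f j *_) (trans (prodFrom-snoc (suc j) n f) (cong (λ z → prodFrom (suc j) n f * f z) (sym (+-suc j n)))))
    (sym (*-assoc (f j) _ _))

  size-PermK : ∀ n → Size (PermK n) (prodFrom 0 n kindSize)
  size-PermK zero = Size-cong (λ { refl → []-stirling , λ _ () }) (λ { (s , _) → stirling-zero s }) (Size-≡ [])
  size-PermK (suc n) = subst (Size _) (sym (prodFrom-snoc 0 n kindSize))
    (Size-bij {P = λ (wp : List ℕ × ℕ) → PermK n (proj₁ wp) × PosOK n (proj₂ wp)} {Q = PermK (suc n)}
      (λ { (w , p) → insTop n p w }) (λ W → rem (suc n) W , firstIndex (suc n) W)
      (λ { {w , p} ((s , k) , po) → stirling-ins p s , kinds s k po })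
      (λ { {W} (s , k) → let s' = stirling-rem s
                             eq = stirling-ins-rem ≤-refl s
                             le = subst (firstIndex (suc n) W ≤_) (Perm-length s') (firstIndex-≤ (suc n) W) in
        (s' , λ x lt → kind-rem s' (firstIndex (suc n) W) lt (subst (KindOK x) (sym eq) (k x (m≤n⇒m≤1+n lt)))) ,
        top-pos s' (firstIndex (suc n) W) le (subst (KindOK n) (sym eq) (k n ≤-refl)) })
      (λ { {w , p} ((s , k) , (le , _)) → cong₂ _,_ (rem-ins p 1 (top-absent (inRange s)))
             (firstIndex-ins p 0 (top-absent (inRange s)) (subst (p ≤_) (sym (Perm-length s)) le)) })
      (λ { {W} (s , _) → stirling-ins-rem ≤-refl s })
      (Size-× (size-PermK n) (size-PosOK n)))
    where
    kinds : ∀ {w p} → Perm n w → (∀ x → x < n → KindOK x w) → PosOK n p → ∀ x → x < suc n → KindOK x (insTop n p w)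
    kinds {w} {p} s k po x lt with x ≟ n
    ... | yes refl = kind-top s p po
    ... | no ne    = kind-ins s p (≤∧≢⇒< (m<1+n⇒m≤n lt) ne) (k x (≤∧≢⇒< (m<1+n⇒m≤n lt) ne))

nthB-flags : ∀ b fcs x → nthB b x ≡ true → nthB (flags b fcs) x ≡ false
nthB-flags (true ∷ b)  fcs        zero    _ = refl
nthB-flags (true ∷ b)  fcs        (suc x) e = nthB-flags b fcs x e
nthB-flags (false ∷ b) []         (suc x) e = nthB-flags b [] x e
nthB-flags (false ∷ b) (_ ∷ fcs)  (suc x) e = nthB-flags b fcs x e

-- Mask position x carries the letter x + 1, which has x places if it is free; this x is also its
-- entry in `code suc`.
prodFrom-kinds : ∀ j c b as (f : ℕ → ℕ) → length as ≡ falses b →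
  (∀ x → x < length b → f (c + x) ≡ (if nthB b x then 1 else (if nthB (flags b (map (_<ᵇ j) as)) x then 1 else (c + x)))) →
  prodFrom c (length b) f ≡ choices j (code suc c b) as
prodFrom-kinds j c [] as f len eq = refl
prodFrom-kinds j c (true ∷ b) as f len eq =
  trans (cong₂ _*_ (trans (cong f (sym (+-identityʳ c))) (eq 0 (s≤s z≤n)))
    (prodFrom-kinds j (suc c) b as f len (λ x lt → subst (λ z → f z ≡ (if nthB b x then 1 else (if nthB (flags b (map (_<ᵇ j) as)) x then 1 else z))) (+-suc c x) (eq (suc x) (s≤s lt)))))
    (+-identityʳ _)
prodFrom-kinds j c (false ∷ b) (a ∷ as) f len eq =
  cong₂ _*_ (trans (cong f (sym (+-identityʳ c))) (trans (eq 0 (s≤s z≤n)) (cong (λ z → if a <ᵇ j then 1 else z) (+-identityʳ c))))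
    (prodFrom-kinds j (suc c) b as f (suc-injective len) (λ x lt → subst (λ z → f z ≡ (if nthB b x then 1 else (if nthB (flags b (map (_<ᵇ j) as)) x then 1 else z))) (+-suc c x) (eq (suc x) (s≤s lt))))

module PermSpecs (b₀ : List Bool) (as : List ℕ) (j : ℕ) (len : length as ≡ falses b₀) where

  b = true ∷ b₀
  N = length b
  fcs = map (_<ᵇ j) as

  open PermCount (nthB b) (nthB (flags b fcs)) refl (nthB-flags b fcs) public

  perm⇒good : ∀ σ → T (isPermutation N σ) → lmin σ ≡ truesFrom 1 b →
    (∀ {y a} → (y , a) ∈ zip (falsesFrom 1 b) as → T (a <ᵇ j) → T (rightCheck N σ y)) → PermK N σ
  perm⇒good σ t mins f = s , λ x lt →
      (λ e → isLmin⇒ (suc x) s (subst T (sym (trans (agree x lt) e)) tt)) ,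
      (λ e lm → subst T (trans (agree x lt) e) (⇒isLmin (suc x) s (s≤s z≤n , lt) lm)) ,
      (λ fl → rightCheck⇒ (suc x) s (zip⇒flags j {P = λ y → T (rightCheck N σ y)} 1 b as f x fl))
    where
    s = isPermutation⇒Perm N σ t
    agree = trues-lmin b s mins

  good⇒lmin : ∀ σ → PermK N σ → lmin σ ≡ truesFrom 1 b
  good⇒lmin σ (s , k) = lmin-trues b s refl agree
    where
    agree : ∀ x → x < N → isLmin σ (suc x) ≡ nthB b x
    agree x lt with nthB b x | k x lt
    ... | true | l , _ = T⇒≡ (⇒isLmin (suc x) s (s≤s z≤n , lt) (l refl))
    ... | false | _ , nl , _ with isLmin σ (suc x) in eq
    ...   | false = refl
    ...   | true  = ⊥-elim (nl refl (isLmin⇒ (suc x) s (subst T (sym eq) tt)))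

  good⇒right : ∀ σ → PermK N σ → ∀ {y a} → (y , a) ∈ zip (falsesFrom 1 b) as → T (a <ᵇ j) → T (rightCheck N σ y)
  good⇒right σ (s , k) = flags⇒zip j {P = λ y → T (rightCheck N σ y)} 1 b as λ x lt fl →
    ⇒rightCheck (suc x) s (proj₂ (proj₂ (k x lt)) fl)

  size-perms : Size (PermK N) (choices j (code suc 0 b) as)
  size-perms = subst (Size (PermK N)) (prodFrom-kinds j 0 b as kindSize len (λ _ _ → refl)) (size-PermK N)

toVec : ∀ n → List ℕ → Vec ℕ n
toVec zero    _       = V.[]
toVec (suc n) []      = 0 V.∷ toVec n []
toVec (suc n) (x ∷ w) = x V.∷ toVec n w

toList-toVec : ∀ n w → length w ≡ n → toList (toVec n w) ≡ w
toList-toVec zero    []      _   = refl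
toList-toVec (suc n) (x ∷ w) len = cong (x ∷_) (toList-toVec n w (suc-injective len))

toVec-toList : ∀ {n} (v : Vec ℕ n) → toVec n (toList v) ≡ v
toVec-toList V.[]      = refl
toVec-toList (x V.∷ v) = cong (x V.∷_) (toVec-toList v)

size-toVec : ∀ {n s} {P : List ℕ → Set} → (∀ {w} → P w → length w ≡ n) → Size P s → Size (λ (v : Vec ℕ n) → P (toList v)) s
size-toVec {n} {P = P} len = Size-bij (toVec n) toList
  (λ {w} p → subst P (sym (toList-toVec n w (len p))) p) id
  (λ {w} p → toList-toVec n w (len p)) (λ {v} _ → toVec-toList v)

lmin-mask : ∀ {n σ} → Perm n σ → 1 ≤ n → MasksAs n (lmin σ)
lmin-mask {suc n} {σ} s n≥1 = trans (cong (truesFrom 1) mask≡) (sym lmin≡) , _ ,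
  trans mask≡ (cong (_∷ mask (isLmin σ) 2 n) (T⇒≡ (⇒isLmin 1 s (≤-refl , n≥1) one-min)))
  where
  lmin≡ : lmin σ ≡ truesFrom 1 (mask (isLmin σ) 1 (suc n))
  lmin≡ = trans (cong (filterᵇ (isLmin σ) ∘ range) (Perm-length s)) (sym (truesFrom-mask (isLmin σ) (suc n)))
  mask≡ : mask (λ v → memb v (lmin σ)) 1 (suc n) ≡ mask (isLmin σ) 1 (suc n)
  mask≡ = trans (cong₂ (λ l k → mask (λ v → memb v l) 1 k) lmin≡ (sym (length-mask (isLmin σ) 1 (suc n))))
    (mask-memb-trues (mask (isLmin σ) 1 (suc n)))
  one-min : LeftMin 1 σ
  one-min (s≤s z≤n) sub with ⊆-All sub (inRange s)
  ... | (() , _) ∷ _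

module PermutationSystems {ℓ : ℕ} (as ts : Vec ℕ (suc ℓ)) (N m : ℕ) (m+ℓ : m + suc ℓ ≡ N)
  (a≥1 : All (1 ≤_) (toList as)) where

  tsL capsP : List ℕ
  tsL = toList ts
  capsP = map (_∸ 2) tsL

  check₀ : List ℕ → List ℕ → List (Vec Bool (suc N)) → Bool
  check₀ mn xs σ₀ = F0P.f0Check N tsL mn xs (CBE.rows σ₀)

  open Masks m+ℓ
  open Systems {N = N} {m = m} as a≥1 {X = Vec ℕ N} toList (isPermutation N) lmin (rightCheck N) check₀

  wordsOf : Vec (Vec ℕ N) M → List (List ℕ)
  wordsOf σs = map toList (toList σs)

  length-wordsOf : ∀ σs → length (wordsOf σs) ≡ M
  length-wordsOf σs = trans (length-map toList (toList σs)) (length-toList σs)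

  isPermSystem⇒ : ∀ σ₀ σs → T (isPermSystem as ts N m (σ₀ , σs)) → Spec σ₀ (wordsOf σs)
  isPermSystem⇒ σ₀ σs with wordsOf σs in eq | length-wordsOf σs
  ... | []     | len = ⊥-elim (<⇒≢ M≥1 len)
  ... | σ ∷ Ss | _   = λ t →
    let (s , t₁) = T-∧⁻ {all (isPermutation N) (σ ∷ Ss)} t
        (e , t₂) = T-∧⁻ {all (λ τ → eqList (lmin τ) (lmin σ)) (σ ∷ Ss)} t₁
        (c , t₃) = T-∧⁻ {length (lmin σ) ≡ᵇ m} t₂
        (q , f)  = T-∧⁻ {y = F0P.f0Check N tsL (lmin σ) (complementL N (lmin σ)) (CBE.rows σ₀)} t₃
    in spec (All.all⁺ _ (σ ∷ Ss) s)
         (All.map (λ {τ} → eqList⇒≡ (lmin τ) (lmin σ)) (All.all⁺ _ (σ ∷ Ss) e))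
         (≡ᵇ⇒≡ _ m c)
         (λ {j} {τ} τ∈ _ _ x∈ → T-not∨⁻ (All.lookup (All.all⁺ _ _ (All.lookup (All.all⁺ _ _ q) x∈)) (subst (λ z → (j , τ) ∈ zip (range M) z) (sym eq) τ∈)))
         f

  ⇒isPermSystem : ∀ σ₀ σs → Spec σ₀ (wordsOf σs) → T (isPermSystem as ts N m (σ₀ , σs))
  ⇒isPermSystem σ₀ σs with wordsOf σs in eq | length-wordsOf σs
  ... | []     | len = ⊥-elim (<⇒≢ M≥1 len)
  ... | σ ∷ Ss | _   = λ { (spec s e c q f) →
    T-∧⁺ {all (isPermutation N) (σ ∷ Ss)} (All.all⁻ _ s)
    (T-∧⁺ {all (λ τ → eqList (lmin τ) (lmin σ)) (σ ∷ Ss)}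
      (All.all⁻ _ (All.map (λ {τ} eqτ → subst (λ l → T (eqList (lmin τ) l)) eqτ (eqList-refl (lmin τ))) e))
    (T-∧⁺ {length (lmin σ) ≡ᵇ m} (≡⇒≡ᵇ _ m c)
    (T-∧⁺ {y = F0P.f0Check N tsL (lmin σ) (complementL N (lmin σ)) (CBE.rows σ₀)}
      (All.all⁻ _ (All.tabulate λ {xa} x∈ → All.all⁻ _ (All.tabulate λ {jτ} τ∈ → T-not∨⁺ (q (subst (λ z → jτ ∈ zip (range M) z) eq τ∈) (proj₁ xa) (proj₂ xa) x∈)))) f))) }

  WordP : List ℕ → Set
  WordP is = (length is ≡ suc ℓ × All (InRange (N ∸ 1)) is) × T (strictlyIncreasing is)

  mask⇒word : ∀ {b} → MaskOK N m b → WordP (code suc 0 b)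
  mask⇒word k@(maskOK b₀ refl len tr) =
    (trans (falses-code suc 0 (true ∷ b₀)) (falses≡ k) ,
     All.zip (chain-≥ n≤1+n (code-chain suc n≤1+n 1 b₀) , All.map (λ lt → ∸-monoˡ-≤ 1 (subst (_ <_) len lt)) (code-suc-< 0 (true ∷ b₀)))) ,
    Chain⇒strictlyIncreasing (code-chain suc n≤1+n 0 (true ∷ b₀))

  word-code : ∀ {is} → WordP is → code suc 0 (decode suc N 0 is) ≡ is
  word-code {is} ((len , rg) , si) = code-decode-suc N N 0 is (strictlyIncreasing⇒Chain is z≤n si)
    (All.map (λ { {i} (_ , le) → subst (i <_) (m+[n∸m]≡n N≥1) (s≤s le) }) rg) refl

  word⇒mask : ∀ {is} → WordP is → MaskOK N m (decode suc N 0 is)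
  word⇒mask w@((len , rg) , _) = decode-mask suc len rg (word-code w)

  Good₀ : ℕ → List Bool → List (List ℕ) → Set
  Good₀ M b F = CE.Good true M 0 0 (b ++ false ∷ []) (1 ∷ capsP) (true ∷ replicate (length capsP) false) (col F)

  Good₁ : ℕ → List Bool → ℕ → List ℕ → Set
  Good₁ N b j = PermWith (nthB b) (nthB (flags b (map (_<ᵇ j) asL))) N

  Valid₀ : List Bool → List (Vec Bool (suc N)) → Set
  Valid₀ b σ₀ = length σ₀ ≡ m × Good₀ m b (CBE.rows σ₀)

  Valid₁ : List Bool → ℕ → Vec ℕ N → Set
  Valid₁ b j σ = Good₁ N b j (toList σ)

  size-Valid₀ : ∀ {b} → MaskOK N m b → Size (Valid₀ b) (product (zipWith3 kernelP tsL (code suc 0 b) (drop 1 (code suc 0 b) ++ (N ∷ []))))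
  size-Valid₀ k@(maskOK b₀ refl len tr) = subst (Size _)
    (trans (prodSizesP 0 0 (true ∷ b₀) tsL (falses-positive k) (labels-length ts k))
      (cong (λ z → product (zipWith3 kernelP tsL (code suc 1 b₀) (drop 1 (code suc 1 b₀) ++ z ∷ []))) len))
    (CBE.size-good m szP 0 0 (true ∷ b₀ ++ false ∷ []) (1 ∷ capsP) (true ∷ replicate (length capsP) false) (suc N)
      (trans (length-snoc (true ∷ b₀)) (cong suc len))
      (sym (trans (trues-snoc (true ∷ b₀)) tr))
      (CBE.allCols-firstForced _ size-Bool m 1 (b₀ ++ false ∷ []) capsP ≤-refl (sym (trans (trues-snoc (true ∷ b₀)) tr))
        (trans (cong suc (trans (length-map (_∸ 2) tsL) (labels-length ts k))) (sym (falses-snoc b₀)))))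

  size-Valid₁ : ∀ {b} → MaskOK N m b → ∀ j → Size (Valid₁ b j) (choices j (code suc 0 b) asL)
  size-Valid₁ {b} k@(maskOK b₀ refl len tr) j = size-toVec (λ { (s , _) → Perm-length s })
    (subst (λ N → Size (Good₁ N b j) (choices j (code suc 0 b) asL)) len (PermSpecs.size-perms b₀ asL j (labels-length as k)))

  check₀⇒ : ∀ {b} → MaskOK N m b → ∀ σ₀ → T (check₀ (truesFrom 1 b) (falsesFrom 1 b) σ₀) → Valid₀ b σ₀
  check₀⇒ {b} k@(maskOK b₀ refl len tr) σ₀ t =
    let (l , g) = F0P.f0⇒good b₀ tsL (falses-positive k) (labels-length ts k) (CBE.rows σ₀)
          (subst (λ n → T (F0P.f0Check n tsL (truesFrom 1 b) (falsesFrom 1 b) (CBE.rows σ₀))) (sym len) t)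
    in trans (sym (length-map _ σ₀)) (trans l tr) , subst (λ M → Good₀ M b (CBE.rows σ₀)) tr g

  ⇒check₀ : ∀ {b} → MaskOK N m b → ∀ σ₀ → Valid₀ b σ₀ → T (check₀ (truesFrom 1 b) (falsesFrom 1 b) σ₀)
  ⇒check₀ {b} k@(maskOK b₀ refl len tr) σ₀ (l , g) =
    subst (λ n → T (F0P.f0Check n tsL (truesFrom 1 b) (falsesFrom 1 b) (CBE.rows σ₀))) len
      (F0P.good⇒f0 b₀ tsL (falses-positive k) (labels-length ts k) (CBE.rows σ₀) (trans (length-map _ σ₀) (trans l (sym tr)))
        (subst (λ M → Good₀ M b (CBE.rows σ₀)) (sym tr) g))

  check⇒ : ∀ {b} → MaskOK N m b → ∀ j (σ : Vec ℕ N) → T (isPermutation N (toList σ)) → lmin (toList σ) ≡ truesFrom 1 b →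
    Sides (falsesFrom 1 b) j (toList σ) → Valid₁ b j σ
  check⇒ {b} k@(maskOK b₀ refl len tr) j σ t e s = subst (λ N → Good₁ N b j (toList σ)) len
    (PermSpecs.perm⇒good b₀ asL j (labels-length as k) (toList σ) (subst (λ N → T (isPermutation N (toList σ))) (sym len) t) e
      (λ {y} {a} y∈ a<j → subst (λ N → T (rightCheck N (toList σ) y)) (sym len) (s y a y∈ a<j)))

  ⇒check : ∀ {b} → MaskOK N m b → ∀ j (σ : Vec ℕ N) → Valid₁ b j σ →
    T (isPermutation N (toList σ)) × lmin (toList σ) ≡ truesFrom 1 b × Sides (falsesFrom 1 b) j (toList σ)
  ⇒check {b} k@(maskOK b₀ refl len tr) j σ v =
    Perm⇒isPermutation (proj₁ v) ,
    PermSpecs.good⇒lmin b₀ asL j (labels-length as k) (toList σ) v' ,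
    λ y a y∈ a<j → subst (λ N → T (rightCheck N (toList σ) y)) len
      (PermSpecs.good⇒right b₀ asL j (labels-length as k) (toList σ) v' y∈ a<j)
    where v' = subst (λ N → Good₁ N b j (toList σ)) (sym len) v

  mins-mask : ∀ (σ : Vec ℕ N) → T (isPermutation N (toList σ)) → MasksAs N (lmin (toList σ))
  mins-mask σ t = lmin-mask (isPermutation⇒Perm N (toList σ) t) N≥1

  size-PermSystem : Size (T ∘ isPermSystem as ts N m) (sumP as ts N)
  size-PermSystem = Size-cong (λ {d} → ⇒isPermSystem (proj₁ d) (proj₂ d)) (λ {d} → isPermSystem⇒ (proj₁ d) (proj₂ d))
    (Counted.size-spec Valid₀ Valid₁ check₀⇒ ⇒check₀ check⇒ ⇒check mins-mask suc n≤1+n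
      (enumerates-filterᵇ strictlyIncreasing (enumerates-words (suc ℓ) (N ∸ 1))) mask⇒word word⇒mask word-code
      (λ is → product (zipWith3 kernelP tsL is (drop 1 is ++ (N ∷ [])))) size-Valid₀ size-Valid₁)

chain-length : ∀ {lo hi is} → Chain suc lo is → All (_≤ hi) is → lo ≤ suc hi → length is + lo ≤ suc hi
chain-length []       []         lo≤ = lo≤
chain-length {lo} {is = i ∷ is} (l ∷ ch) (le ∷ les) _ =
  ≤-trans (s≤s (+-monoʳ-≤ (length is) l)) (≤-trans (≤-reflexive (sym (+-suc (length is) i))) (chain-length ch les (s≤s le)))

-- A strictly increasing word with entries between 0 and m - 1 has at most m letters. This settles
-- the case of negative m - ℓ.
sumP-short : ∀ {ℓ} (as ts : Vec ℕ ℓ) m → 1 ≤ m → m < ℓ → sumP as ts m ≡ 0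
sumP-short {ℓ} as ts m m≥1 m<ℓ = sum-zero _ (filterᵇ strictlyIncreasing (words ℓ (m ∸ 1))) λ {is} is∈ →
  ⊥-elim (none (Enumerates.sound (enumerates-filterᵇ strictlyIncreasing (enumerates-words ℓ (m ∸ 1))) is∈))
  where
  none : ∀ {is} → ¬ ((length is ≡ ℓ × All (InRange (m ∸ 1)) is) × T (strictlyIncreasing is))
  none {is} ((len , rg) , si) = <⇒≱ m<ℓ (subst (_≤ m) len (≤-trans (m≤m+n (length is) 0)
    (subst (length is + 0 ≤_) (m+[n∸m]≡n m≥1) (chain-length (strictlyIncreasing⇒Chain is z≤n si) (All.map proj₂ rg) z≤n))))

theorem3 : (ℓ : ℕ) → 1 ≤ ℓ → (as ts : Vec ℕ ℓ)
    → (∀ i → 1 ≤ lookup as i) → (∀ i → 2 ≤ lookup ts i)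
    → (m : ℕ) → 1 ≤ m
    → (PartSystem as ts (ℓ + m) m ↔ Fin (Bpoly (weightTuple as ts 0) m))
    × (PartSystem as ts (ℓ + m) m ↔ Fin (sumS as ts m))
    × ((m' : ℕ) → m' + ℓ ≡ m
    → (PermSystem as ts m m' ↔ Fin (bpoly (weightTuple as ts 0) m))
    × (PermSystem as ts m m' ↔ Fin (sumP as ts m)))
    × (m < ℓ → (bpoly (weightTuple as ts 0) m ≡ 0) × (sumP as ts m ≡ 0))
theorem3 (suc ℓ) _ as ts a≥1 t≥2 m m≥1 =
    Size⇒↔ (subst (Size _) (sym (Bpoly≡sumS m)) partitions)
  , Size⇒↔ partitions
  , (λ m' eq → let permutations = PermutationSystems.size-PermSystem as ts m m' eq allA in
        Size⇒↔ (subst (Size _) (sym (bpoly≡sumP m m≥1)) permutations)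
      , Size⇒↔ permutations)
  , λ m<ℓ → trans (bpoly≡sumP m m≥1) (sumP-short as ts m m≥1 m<ℓ) , sumP-short as ts m m≥1 m<ℓ
  where
  open ClosedSums as ts a≥1 t≥2
  allA = All-toList as a≥1
  allT = All-toList ts t≥2
  partitions = PartitionSystems.size-PartSystem as ts (suc ℓ + m) m (+-comm m (suc ℓ)) allA allT
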